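{- There is a polynomial-time algorithm that, given $n$ points in the plane and a positive integer $k\le n$, constructs a rectilinear tree spanning at least $k$ of these points such that the total length of the tree is at most $O(k^{1/4})$ times that of a minimum-length rectilinear tree spanning any $k$ of the points.
   Context: A rectilinear tree spanning a subset of the points is a spanning tree on the points of the subset in which the length of an edge is the rectilinear ($L_1$) distance between its endpoints; the length of the tree is the sum of its edge lengths. The minimum is over all choices of $k$ of the points and all rectilinear trees spanning them. The constant hidden in $O(\cdot)$ is absolute.
   Formalization: The given points in the plane have rational coordinates (numerator and denominator in binary) instead of arbitrary real coordinates; polynomial time is measured in the bit length of this input. -}

module Defs where

import Algebra.Definitions.RawSemiring as RawSemiring
open import Data.Bool.Base using (if_then_else_)
open import Data.Fin.Base using (Fin; toℕ; _<_)
open import Data.Fin.Subset using (Subset; _∈_; Nonempty; ∣_∣)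
open import Data.Integer.Base as ℤ using (ℤ; +_; 0ℤ; 1ℤ)
import Data.Integer.Properties as ℤ
open import Data.List.Base as List using (List; []; _∷_; _++_; _∷ʳ_; concatMap)
open import Data.List.Membership.Propositional using () renaming (_∈_ to _∈ˡ_)
open import Data.List.Relation.Unary.All using (All)
open import Data.List.Relation.Unary.Linked using (Linked)
open import Data.List.Relation.Unary.Unique.Propositional using (Unique)
open import Data.Nat.Base as ℕ using (ℕ; suc)
open import Data.Nat.ListAction using (sum)
open import Data.Nat.Logarithm using (⌊log₂_⌋)
open import Data.Product.Base using (_×_; _,_; Σ-syntax; ∃-syntax)
open import Data.Rational.Base as ℚ using (ℚ; 0ℚ; ↥_; ↧_)
open import Data.Sum.Base using (_⊎_)
open import Data.Vec.Base as Vec using (Vec; lookup)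
open import Relation.Binary.Construct.Closure.ReflexiveTransitive using (Star)
open import Relation.Binary.PropositionalEquality using (_≡_)
open import Relation.Nullary using (¬_)
open import Relation.Nullary.Decidable using (does)

infixr 8 _^ℚ_

_^ℚ_ : ℚ → ℕ → ℚ
_^ℚ_ = RawSemiring._^_ ℚ.+-*-rawSemiring

------------------------------------------------------------------------
-- Graphs and trees

-- A finite simple graph whose vertex set is a subset of Fin n.  Each
-- undirected edge {i , j} is listed once, as the pair (i , j) with i < j.

record Graph (n : ℕ) : Set where
  field
    vertices : Subset n
    edges    : List (Fin n × Fin n)
    ordered  : All (λ (i , j) → i < j) edges
    incident : All (λ (i , j) → i ∈ vertices × j ∈ vertices) edges
    unique   : Unique edges

open Graph public

Adjacent : ∀ {n} → Graph n → Fin n → Fin n → Set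
Adjacent G i j = (i , j) ∈ˡ edges G ⊎ (j , i) ∈ˡ edges G

Connected : ∀ {n} → Graph n → Set
Connected G = ∀ i j → i ∈ vertices G → j ∈ vertices G → Star (Adjacent G) i j

-- A cycle u , v , w , ws , u through at least three distinct vertices.

HasCycle : ∀ {n} → Graph n → Set
HasCycle G = ∃[ u ] ∃[ v ] ∃[ w ] ∃[ ws ]
  Unique (u ∷ v ∷ w ∷ ws) × Linked (Adjacent G) (u ∷ v ∷ w ∷ ws ∷ʳ u)

record IsTree {n} (G : Graph n) : Set where
  field
    nonempty  : Nonempty (vertices G)
    connected : Connected G
    acyclic   : ¬ HasCycle G

------------------------------------------------------------------------
-- Rectilinear length

Point : Set
Point = ℚ × ℚ

L₁ : Point → Point → ℚ
L₁ (x , y) (x′ , y′) = ℚ.∣ x ℚ.- x′ ∣ ℚ.+ ℚ.∣ y ℚ.- y′ ∣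

length : ∀ {n} → Vec Point n → Graph n → ℚ
length ps G =
  List.foldr ℚ._+_ 0ℚ
    (List.map (λ (i , j) → L₁ (lookup ps i) (lookup ps j)) (edges G))

record IsMinimumTree {n} (k : ℕ) (ps : Vec Point n) (G : Graph n) : Set where
  field
    isTree  : IsTree G
    spans   : ∣ vertices G ∣ ≡ k
    minimum : ∀ H → IsTree H → ∣ vertices H ∣ ≡ k → length ps G ℚ.≤ length ps H

------------------------------------------------------------------------
-- Random access machine programs
--
-- Registers are indexed by ℤ, hold integers, and are initially 0.  The only
-- arithmetic is addition and subtraction, so the largest bit length grows
-- by at most one per operation.  Counting each operation as one step
-- therefore gives the same polynomial-time functions as Turing machines;
-- this would fail if multiplication also cost one step.

infixl 6 _⊕_ _⊖_
infix  5 _≔_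
infixr 4 _⨾_

data Exp : Set where
  lit     : ℤ → Exp
  reg     : Exp → Exp
  _⊕_ _⊖_ : Exp → Exp → Exp

data Program : Set where
  skip           : Program
  _≔_            : Exp → Exp → Program         -- reg a ≔ e, written a ≔ e
  read           : Exp → Program               -- reg a ≔ next input
  write          : Exp → Program
  _⨾_            : Program → Program → Program
  if_>0then_else_ : Exp → Program → Program → Program
  while_>0do_     : Exp → Program → Program

Memory : Set
Memory = ℤ → ℤ

_[_↦_] : Memory → ℤ → ℤ → Memory
(m [ a ↦ v ]) b = if does (a ℤ.≟ b) then v else m b

record State : Set where
  constructor ⟨_,_,_⟩
  field
    memory : Memory
    input  : List ℤ
    output : List ℤ

⟦_⟧ : Exp → Memory → ℤ
⟦ lit z ⟧ m = z
⟦ reg e ⟧ m = m (⟦ e ⟧ m)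
⟦ e ⊕ f ⟧ m = ⟦ e ⟧ m ℤ.+ ⟦ f ⟧ m
⟦ e ⊖ f ⟧ m = ⟦ e ⟧ m ℤ.- ⟦ f ⟧ m

cost : Exp → ℕ
cost (lit _) = 1
cost (reg e) = 1 ℕ.+ cost e
cost (e ⊕ f) = 1 ℕ.+ (cost e ℕ.+ cost f)
cost (e ⊖ f) = 1 ℕ.+ (cost e ℕ.+ cost f)

-- P ∶ s ⇓[ t ] s′ : started in state s, P halts in state s′ after t steps.

infix 3 _∶_⇓[_]_

data _∶_⇓[_]_ : Program → State → ℕ → State → Set where

  ⇓skip : ∀ {s} → skip ∶ s ⇓[ 1 ] s

  ⇓assign : ∀ {a e m i o} →
    (a ≔ e) ∶ ⟨ m , i , o ⟩
      ⇓[ 1 ℕ.+ (cost a ℕ.+ cost e) ] ⟨ m [ ⟦ a ⟧ m ↦ ⟦ e ⟧ m ] , i , o ⟩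

  ⇓read : ∀ {a m z i o} →
    read a ∶ ⟨ m , z ∷ i , o ⟩
      ⇓[ 1 ℕ.+ cost a ] ⟨ m [ ⟦ a ⟧ m ↦ z ] , i , o ⟩

  ⇓write : ∀ {e m i o} →
    write e ∶ ⟨ m , i , o ⟩ ⇓[ 1 ℕ.+ cost e ] ⟨ m , i , o ∷ʳ ⟦ e ⟧ m ⟩

  ⇓seq : ∀ {P Q s s′ s″ t t′} →
    P ∶ s ⇓[ t ] s′ → Q ∶ s′ ⇓[ t′ ] s″ → (P ⨾ Q) ∶ s ⇓[ t ℕ.+ t′ ] s″

  ⇓then : ∀ {e P Q s s′ t} →
    0ℤ ℤ.< ⟦ e ⟧ (State.memory s) → P ∶ s ⇓[ t ] s′ →
    (if e >0then P else Q) ∶ s ⇓[ 1 ℕ.+ cost e ℕ.+ t ] s′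

  ⇓else : ∀ {e P Q s s′ t} →
    ⟦ e ⟧ (State.memory s) ℤ.≤ 0ℤ → Q ∶ s ⇓[ t ] s′ →
    (if e >0then P else Q) ∶ s ⇓[ 1 ℕ.+ cost e ℕ.+ t ] s′

  ⇓loop : ∀ {e P s s′ s″ t t′} →
    0ℤ ℤ.< ⟦ e ⟧ (State.memory s) →
    P ∶ s ⇓[ t ] s′ → (while e >0do P) ∶ s′ ⇓[ t′ ] s″ →
    (while e >0do P) ∶ s ⇓[ 1 ℕ.+ cost e ℕ.+ t ℕ.+ t′ ] s″

  ⇓exit : ∀ {e P s} →
    ⟦ e ⟧ (State.memory s) ℤ.≤ 0ℤ → (while e >0do P) ∶ s ⇓[ 1 ℕ.+ cost e ] s

_maps_to_within_ : Program → List ℤ → List ℤ → ℕ → Set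
P maps i to o within b = ∃[ m ] ∃[ i′ ] ∃[ t ]
  P ∶ ⟨ (λ _ → 0ℤ) , i , [] ⟩ ⇓[ t ] ⟨ m , i′ , o ⟩ × t ℕ.≤ b

------------------------------------------------------------------------
-- Polynomial-time solvability of a search problem

bits : ℤ → ℕ
bits z = suc ⌊log₂ ℤ.∣ z ∣ ⌋

size : List ℤ → ℕ
size zs = sum (List.map bits zs)

-- One program and one polynomial bound serve all instances.

PolynomialTimeSolvable :
  {I : Set} {O : I → Set} →
  (I → List ℤ) → (∀ x → O x → List ℤ) → (∀ x → O x → Set) → Set
PolynomialTimeSolvable {I} {O} encodeᴵ encodeᴼ Correct =
  Σ[ P ∈ Program ] Σ[ a ∈ ℕ ] Σ[ d ∈ ℕ ] ∀ (x : I) → Σ[ y ∈ O x ]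
    Correct x y ×
    P maps encodeᴵ x to encodeᴼ x y within (a ℕ.* size (encodeᴵ x) ℕ.^ d)

------------------------------------------------------------------------
-- Instances and encodings

-- Points are given as an indexed family, so coincident points are allowed.

record Instance : Set where
  field
    n k    : ℕ
    1≤k    : 1 ℕ.≤ k
    k≤n    : k ℕ.≤ n
    points : Vec Point n

encodePoint : Point → List ℤ
encodePoint (x , y) = ↥ x ∷ ↧ x ∷ ↥ y ∷ ↧ y ∷ []

encodeInstance : Instance → List ℤ
encodeInstance I = + n ∷ + k ∷ concatMap encodePoint (Vec.toList points)
  where open Instance I

-- The characteristic vector of the vertex set, then the edges.

encodeGraph : ∀ {n} → Graph n → List ℤ
encodeGraph G =
  List.map (λ b → if b then 1ℤ else 0ℤ) (Vec.toList (vertices G)) ++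
  concatMap (λ (i , j) → + toℕ i ∷ + toℕ j ∷ []) (edges G)

module Submission where

-- Scale the points to a grid of natural numbers and order them along the
-- Z-order curve; dynamic programming finds a shortest path through k points
-- that visits them in this order.  It remains to see that the vertices S of
-- an optimal tree of length L, visited in Z-order, give a path of length
-- O(L log k), which is O(k^{1/4} L).  Doubling the tree yields a closed walk
-- of length at most 2 L through S, so S meets only O(1 + L / s) grid cells of
-- side s, and the path leaves each of them once, since the cells of one side
-- are intervals of the curve.  Charging every step of the path to the largest
-- cells that it leaves, the sides between L / k and L contribute O(L) each,
-- the k steps inside cells of side L / k contribute O(L) together, and so do
-- the steps between the O(1) cells of side L, none of which is longer than L.
--
-- Every loop of the program, apart from one that measures the input, is
-- bounded by a parameter of polynomial size fixed beforehand; this is enforced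
-- by the syntax of the language from which the program is compiled.

open import Data.Bool.Base using (Bool; true; false; if_then_else_; T)
import Data.Fin.Properties as Fin
import Data.Integer.Properties as ℤ
import Data.Integer.Tactic.RingSolver as ℤ-Solver
open import Data.Nat.Properties
open import Data.Nat.Tactic.RingSolver using (solve-∀)
open import Data.Product.Base using (_×_; _,_; proj₁; proj₂; Σ-syntax; ∃-syntax)
open import Data.Sum.Base using (inj₁; inj₂; _⊎_)
open import Function.Base using (_∘_)
open import Relation.Binary.Definitions using (tri<; tri≈; tri>)
open import Relation.Binary.PropositionalEquality
open import Relation.Nullary using (yes; no; ¬_; contradiction; Dec; does)
open import Relation.Nullary.Decidable using (dec-true; dec-false; _⊎-dec_)

-- Logarithms and roots never occur. If r satisfies 16^r ≤ k ≤ 16^(r+1), then 4 (r + 1) levels of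
-- cells suffice, r + 1 ≤ 2^r, and 2^r is at most the fourth root of k; accordingly the final
-- inequality compares fourth powers. The dynamic program does not record which points a path has
-- used. Repetitions are excluded by distinct labels, namely the Z-order code refined by the index
-- of the point: a step that does not increase the label costs more than any admissible path does in
-- total. Multiplying every coordinate by the product D of all 2n denominators makes all lengths
-- natural numbers and scales every tree by the same factor, so approximation ratios survive. All
-- numerators and denominators are below 2^ℓ with ℓ at most the bit size of the input, so the scaled
-- coordinates have polynomially many bits. The machine cannot multiply, so products and Z-order
-- codes are built by doubling and adding, over the bits of numbers that are extracted with a table
-- of powers of two.

module Compiler where

  open import Defs hiding (length)
  open import Data.Fin.Base as Fin using (Fin; zero; suc; toℕ)
  open import Data.Integer.Base as ℤ using (ℤ; +_; 0ℤ; 1ℤ)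
  open import Data.List.Base as List using (List; []; _∷_; _++_; _∷ʳ_)
  import Data.List.Properties as List
  open import Data.Nat.Base hiding (_/_)
  open import Data.Vec.Base using (Vec; []; _∷_; lookup; _[_]≔_)
  open import Data.Vec.Properties using (lookup∘update; lookup∘update′)

  -- Counted iteration and polynomial bounds

  foldn : ∀ {a} {A : Set a} → ℕ → (ℕ → A → A) → A → A
  foldn zero    f a = a
  foldn (suc n) f a = f n (foldn n f a)

  -- The base is `suc n` rather than n so that powers are positive and grow with the exponent even
  -- at n = 0; the closure under sums and composition relies on this.
  PolyBounded : (ℕ → ℕ) → Set
  PolyBounded f = Σ[ c ∈ ℕ ] Σ[ d ∈ ℕ ] ∀ n → f n ≤ c * suc n ^ d

  poly-const : ∀ c → PolyBounded (λ _ → c)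
  poly-const c = c , 0 , λ n → ≤-reflexive (sym (*-identityʳ c))

  poly-id : PolyBounded (λ n → n)
  poly-id = 1 , 1 , λ n → ≤-trans (n≤1+n n) (≤-reflexive (sym (trans (*-identityˡ _) (*-identityʳ _))))

  poly-+ : ∀ {f g} → PolyBounded f → PolyBounded g → PolyBounded (λ n → f n + g n)
  poly-+ {f} {g} (c , d , p) (c′ , d′ , q) = c + c′ , d + d′ , λ n → begin
    f n + g n                                        ≤⟨ +-mono-≤ (p n) (q n) ⟩
    c * suc n ^ d + c′ * suc n ^ d′                  ≤⟨ +-mono-≤ (*-monoʳ-≤ c (^-monoʳ-≤ (suc n) (m≤m+n d d′)))
                                                                (*-monoʳ-≤ c′ (^-monoʳ-≤ (suc n) (m≤n+m d′ d))) ⟩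
    c * suc n ^ (d + d′) + c′ * suc n ^ (d + d′)     ≡⟨ *-distribʳ-+ (suc n ^ (d + d′)) c c′ ⟨
    (c + c′) * suc n ^ (d + d′)                      ∎
    where open ≤-Reasoning

  poly-* : ∀ {f g} → PolyBounded f → PolyBounded g → PolyBounded (λ n → f n * g n)
  poly-* {f} {g} (c , d , p) (c′ , d′ , q) = c * c′ , d + d′ , λ n → begin
    f n * g n                              ≤⟨ *-mono-≤ (p n) (q n) ⟩
    c * suc n ^ d * (c′ * suc n ^ d′)      ≡⟨ rearrange c (suc n ^ d) c′ (suc n ^ d′) ⟩
    c * c′ * (suc n ^ d * suc n ^ d′)      ≡⟨ cong (c * c′ *_) (^-distribˡ-+-* (suc n) d d′) ⟨
    c * c′ * suc n ^ (d + d′)              ∎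
    where
    open ≤-Reasoning
    rearrange : ∀ a b c d → a * b * (c * d) ≡ a * c * (b * d)
    rearrange = solve-∀

  ^-distribʳ-* : ∀ o m n → (m * n) ^ o ≡ m ^ o * n ^ o
  ^-distribʳ-* zero    m n = refl
  ^-distribʳ-* (suc o) m n rewrite ^-distribʳ-* o m n = rearrange m n (m ^ o) (n ^ o)
    where
    rearrange : ∀ a b c d → a * b * (c * d) ≡ a * c * (b * d)
    rearrange = solve-∀

  poly-∘ : ∀ {f g} → PolyBounded f → PolyBounded g → PolyBounded (λ n → f (g n))
  poly-∘ {f} {g} (c , d , p) (c′ , d′ , q) = c * suc c′ ^ d , d′ * d , λ n → begin
    f (g n)                                ≤⟨ p (g n) ⟩
    c * suc (g n) ^ d                      ≤⟨ *-monoʳ-≤ c (^-monoˡ-≤ d (s≤s (q n))) ⟩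
    -- The extra 1 is absorbed into the coefficient: a power of `suc n` is at least 1, which turns
    -- c′ into `suc c′`.
    c * suc (c′ * suc n ^ d′) ^ d          ≤⟨ *-monoʳ-≤ c (^-monoˡ-≤ d (+-monoˡ-≤ (c′ * suc n ^ d′) (m^n>0 (suc n) d′))) ⟩
    c * (suc c′ * suc n ^ d′) ^ d          ≡⟨ cong (c *_) (^-distribʳ-* d (suc c′) (suc n ^ d′)) ⟩
    c * (suc c′ ^ d * (suc n ^ d′) ^ d)    ≡⟨ cong (λ z → c * (suc c′ ^ d * z)) (^-*-assoc (suc n) d′ d) ⟩
    c * (suc c′ ^ d * suc n ^ (d′ * d))    ≡⟨ *-assoc c _ _ ⟨
    c * suc c′ ^ d * suc n ^ (d′ * d)      ∎
    where open ≤-Reasoning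

  -- The source language with bounded loops

  -- A language of integer expressions in which every loop is bounded by one of
  -- seven parameters.  Its variables are de Bruijn indices; in the body of a
  -- fold, index 0 is the loop counter and index 1 the accumulator.

  data Ex (Γ : ℕ) : Set where
    int     : ℤ → Ex Γ
    var     : Fin Γ → Ex Γ
    par     : Fin 7 → Ex Γ
    get     : Fin 8 → Ex Γ → Ex Γ
    _⊞_ _⊟_ : Ex Γ → Ex Γ → Ex Γ
    ifpos   : Ex Γ → Ex Γ → Ex Γ → Ex Γ
    bind    : Ex Γ → Ex (suc Γ) → Ex Γ
    fold    : Fin 7 → Ex Γ → Ex (suc (suc Γ)) → Ex Γ

  infixl 6 _⊞_ _⊟_

  Params Arrays : Set
  Params = Vec ℕ 7
  Arrays = Vec (ℤ → ℤ) 8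

  pos? : ℤ → Bool
  pos? (+ zero)    = false
  pos? (+ suc _)   = true
  pos? ℤ.-[1+ _ ] = false

  eval : ∀ {Γ} → Params → Arrays → Vec ℤ Γ → Ex Γ → ℤ
  eval π σ ρ (int z)       = z
  eval π σ ρ (var x)       = lookup ρ x
  eval π σ ρ (par p)       = + lookup π p
  eval π σ ρ (get a e)     = lookup σ a (eval π σ ρ e)
  eval π σ ρ (e ⊞ f)       = eval π σ ρ e ℤ.+ eval π σ ρ f
  eval π σ ρ (e ⊟ f)       = eval π σ ρ e ℤ.- eval π σ ρ f
  eval π σ ρ (ifpos e f g) = if pos? (eval π σ ρ e) then eval π σ ρ f else eval π σ ρ g
  eval π σ ρ (bind e f)    = eval π σ (eval π σ ρ e ∷ ρ) f
  eval π σ ρ (fold p e f)  =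
    foldn (lookup π p) (λ i acc → eval π σ (+ i ∷ acc ∷ ρ) f) (eval π σ ρ e)

  -- tab a p e fills entries 0 , … , p − 1 of the array a in increasing order,
  -- and e may read entries of a that are already filled.

  data Stmt : Set where
    tab  : Fin 8 → Fin 7 → Ex 1 → Stmt
    emit : Fin 7 → List (Ex 1) → Stmt

  filled : Params → Arrays → Fin 8 → Ex 1 → ℕ → ℤ → ℤ
  filled π σ a e zero    = lookup σ a
  filled π σ a e (suc t) =
    filled π σ a e t [ + t ↦ eval π (σ [ a ]≔ filled π σ a e t) (+ t ∷ []) e ]

  arraysAfter : Params → Arrays → Stmt → Arrays
  arraysAfter π σ (tab a p e) = σ [ a ]≔ filled π σ a e (lookup π p)
  arraysAfter π σ (emit p es) = σ

  emitted : Params → Arrays → List (Ex 1) → ℕ → List ℤ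
  emitted π σ es zero    = []
  emitted π σ es (suc t) = emitted π σ es t ++ List.map (eval π σ (+ t ∷ [])) es

  output : Params → Arrays → Stmt → List ℤ
  output π σ (tab a p e) = []
  output π σ (emit p es) = emitted π σ es (lookup π p)

  outputs : Params → Arrays → List Stmt → List ℤ
  outputs π σ []       = []
  outputs π σ (c ∷ cs) = output π σ c ++ outputs π (arraysAfter π σ c) cs

  -- Compilation to the machine and its running time

  -- Memory layout: entry j of region a has address 16 j + a.  Region 0 is the
  -- evaluation stack, region 1 holds the parameters, and region 2 + a is the
  -- array a.

  dbl : ℤ → ℤ
  dbl i = i ℤ.+ i

  -- Multiplication by 16 is spelled as four doublings because the machine only adds. The value of
  -- `entryᴱ` is then an `address` by mere computation.
  address : ℕ → ℤ → ℤ
  address a j = dbl (dbl (dbl (dbl j))) ℤ.+ + a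

  slot : ℕ → ℤ
  slot s = address 0 (+ s)

  cell : Fin 7 → ℤ
  cell p = address 1 (+ toℕ p)

  entry : Fin 8 → ℤ → ℤ
  entry a j = address (2 + toℕ a) j

  dblᴱ : Exp → Exp
  dblᴱ e = e ⊕ e

  slotᴱ : ℕ → Exp
  slotᴱ s = lit (slot s)

  valᴱ : ℕ → Exp
  valᴱ s = reg (slotᴱ s)

  parᴱ : Fin 7 → Exp
  parᴱ p = reg (lit (cell p))

  entryᴱ : Fin 8 → ℕ → Exp
  entryᴱ a s = dblᴱ (dblᴱ (dblᴱ (dblᴱ (valᴱ s)))) ⊕ lit (+ (2 + toℕ a))

  increment : ℕ → Program
  increment s = slotᴱ s ≔ valᴱ s ⊕ lit 1ℤ

  -- compile s ν e leaves the value of e in slot s, using only slots from s on;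
  -- ν lists the slots of the variables.

  compile : ∀ {Γ} → ℕ → Vec ℕ Γ → Ex Γ → Program
  compile s ν (int z)       = slotᴱ s ≔ lit z
  compile s ν (var x)       = slotᴱ s ≔ valᴱ (lookup ν x)
  compile s ν (par p)       = slotᴱ s ≔ parᴱ p
  compile s ν (get a e)     = compile s ν e ⨾ slotᴱ s ≔ reg (entryᴱ a s)
  compile s ν (e ⊞ f)       =
    compile s ν e ⨾ compile (suc s) ν f ⨾ slotᴱ s ≔ valᴱ s ⊕ valᴱ (suc s)
  compile s ν (e ⊟ f)       =
    compile s ν e ⨾ compile (suc s) ν f ⨾ slotᴱ s ≔ valᴱ s ⊖ valᴱ (suc s)
  compile s ν (ifpos e f g) =
    compile s ν e ⨾ (if valᴱ s >0then compile s ν f else compile s ν g)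
  compile s ν (bind e f)    =
    compile s ν e ⨾ compile (suc s) (s ∷ ν) f ⨾ slotᴱ s ≔ valᴱ (suc s)
  compile s ν (fold p e f)  =
    compile s ν e ⨾ slotᴱ (suc s) ≔ lit 0ℤ ⨾
    (while parᴱ p ⊖ valᴱ (suc s) >0do
      (compile (suc (suc s)) (suc s ∷ s ∷ ν) f ⨾
       slotᴱ s ≔ valᴱ (suc (suc s)) ⨾ increment (suc s)))

  writeAll : List (Ex 1) → Program
  writeAll []       = skip
  writeAll (e ∷ es) = compile 1 (0 ∷ []) e ⨾ write (valᴱ 1) ⨾ writeAll es

  body : Stmt → Program
  body (tab a p e) = compile 1 (0 ∷ []) e ⨾ entryᴱ a 0 ≔ valᴱ 1
  body (emit p es) = writeAll es

  range : Stmt → Fin 7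
  range (tab a p e) = p
  range (emit p es) = p

  compileStmt : Stmt → Program
  compileStmt c =
    slotᴱ 0 ≔ lit 0ℤ ⨾ (while parᴱ (range c) ⊖ valᴱ 0 >0do (body c ⨾ increment 0))

  compileAll : List Stmt → Program
  compileAll []       = skip
  compileAll (c ∷ cs) = compileStmt c ⨾ compileAll cs

  -- M is a bound on the parameters.

  time : ∀ {Γ} → Ex Γ → ℕ → ℕ
  time (int z)       M = 3
  time (var x)       M = 4
  time (par p)       M = 4
  time (get a e)     M = time e M + 52
  time (e ⊞ f)       M = time e M + (time f M + 7)
  time (e ⊟ f)       M = time e M + (time f M + 7)
  time (ifpos e f g) M = time e M + (3 + (time f M + time g M))
  time (bind e f)    M = time e M + (time f M + 4)
  time (fold p e f)  M = time e M + (3 + (6 + M * (6 + (time f M + (4 + 6)))))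

  timeAll : List (Ex 1) → ℕ → ℕ
  timeAll []       M = 1
  timeAll (e ∷ es) M = time e M + (3 + timeAll es M)

  -- The 52 counts one store into an array: 49 for the address, whose expression grows through four
  -- nested doublings, 2 for the value and 1 for the assignment.
  timeBody : Stmt → ℕ → ℕ
  timeBody (tab a p e) M = time e M + 52
  timeBody (emit p es) M = timeAll es M

  timeStmt : Stmt → ℕ → ℕ
  timeStmt c M = 3 + (6 + M * (6 + (timeBody c M + 6)))

  timeStmts : List Stmt → ℕ → ℕ
  timeStmts []       M = 1
  timeStmts (c ∷ cs) M = timeStmt c M + timeStmts cs M

  poly-time : ∀ {Γ} (e : Ex Γ) → PolyBounded (time e)
  poly-time (int z)       = poly-const 3
  poly-time (var x)       = poly-const 4
  poly-time (par p)       = poly-const 4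
  poly-time (get a e)     = poly-+ (poly-time e) (poly-const 52)
  poly-time (e ⊞ f)       = poly-+ (poly-time e) (poly-+ (poly-time f) (poly-const 7))
  poly-time (e ⊟ f)       = poly-+ (poly-time e) (poly-+ (poly-time f) (poly-const 7))
  poly-time (ifpos e f g) =
    poly-+ (poly-time e) (poly-+ (poly-const 3) (poly-+ (poly-time f) (poly-time g)))
  poly-time (bind e f)    = poly-+ (poly-time e) (poly-+ (poly-time f) (poly-const 4))
  poly-time (fold p e f)  =
    poly-+ (poly-time e) (poly-+ (poly-const 3) (poly-+ (poly-const 6)
      (poly-* poly-id (poly-+ (poly-const 6) (poly-+ (poly-time f) (poly-const 10))))))

  poly-timeAll : ∀ es → PolyBounded (timeAll es)
  poly-timeAll []       = poly-const 1
  poly-timeAll (e ∷ es) = poly-+ (poly-time e) (poly-+ (poly-const 3) (poly-timeAll es))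

  poly-timeBody : ∀ c → PolyBounded (timeBody c)
  poly-timeBody (tab a p e) = poly-+ (poly-time e) (poly-const 52)
  poly-timeBody (emit p es) = poly-timeAll es

  poly-timeStmts : ∀ cs → PolyBounded (timeStmts cs)
  poly-timeStmts []       = poly-const 1
  poly-timeStmts (c ∷ cs) = poly-+
    (poly-+ (poly-const 3) (poly-+ (poly-const 6)
      (poly-* poly-id (poly-+ (poly-const 6) (poly-+ (poly-timeBody c) (poly-const 6))))))
    (poly-timeStmts cs)

  -- Correctness of the compiler

  dbl⁴ : ∀ j → dbl (dbl (dbl (dbl j))) ≡ j ℤ.* + 16
  dbl⁴ = lemma
    where
    lemma : ∀ j → let d = j ℤ.+ j; e = d ℤ.+ d; f = e ℤ.+ e in f ℤ.+ f ≡ j ℤ.* + 16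
    lemma = ℤ-Solver.solve-∀

  ∣+m-+n∣<k : ∀ {m n k} → m < k → n < k → ℤ.∣ + m ℤ.- + n ∣ < k
  ∣+m-+n∣<k {m} {n} m<k n<k rewrite ℤ.m-n≡m⊖n m n with ≤-total m n
  ... | inj₁ m≤n = subst (_< _) (sym (ℤ.∣⊖∣-≤ m≤n)) (≤-<-trans (m∸n≤m n m) n<k)
  ... | inj₂ n≤m = subst (_< _) (sym (cong ℤ.∣_∣ (ℤ.⊖-≥ n≤m))) (≤-<-trans (m∸n≤m m n) m<k)

  -- Equal addresses make b - a equal to 16 (i - j). Both regions are below 16, so this multiple of
  -- 16 has absolute value less than 16 and must be 0.
  address-injective : ∀ {a b i j} → a < 16 → b < 16 → address a i ≡ address b j → a ≡ b × i ≡ j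
  address-injective {a} {b} {i} {j} a<16 b<16 eq rewrite dbl⁴ i | dbl⁴ j = a≡b , i≡j
    where
    move : ∀ i j a b → i ℤ.* + 16 ℤ.+ a ℤ.- (j ℤ.* + 16 ℤ.+ b) ℤ.+ (b ℤ.- a) ≡ (i ℤ.- j) ℤ.* + 16
    move = ℤ-Solver.solve-∀
    difference : (i ℤ.- j) ℤ.* + 16 ≡ + b ℤ.- + a
    difference = trans (sym (move i j (+ a) (+ b)))
      (trans (cong (ℤ._+ (+ b ℤ.- + a)) (ℤ.i≡j⇒i-j≡0 eq)) (ℤ.+-identityˡ _))
    small : ℤ.∣ i ℤ.- j ∣ * 16 < 1 * 16
    small = subst (_< 16) (trans (cong ℤ.∣_∣ (sym difference)) (ℤ.abs-* (i ℤ.- j) (+ 16))) (∣+m-+n∣<k b<16 a<16)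
    i-j≡0 : i ℤ.- j ≡ 0ℤ
    i-j≡0 = ℤ.∣i∣≡0⇒i≡0 (n<1⇒n≡0 (*-cancelʳ-< _ _ _ small))
    i≡j : i ≡ j
    i≡j = ℤ.i-j≡0⇒i≡j i j i-j≡0
    a≡b : a ≡ b
    a≡b = ℤ.+-injective (sym (ℤ.i-j≡0⇒i≡j (+ b) (+ a) (trans (sym difference) (cong (ℤ._* + 16) i-j≡0))))

  ≡-update : ∀ (m : Memory) a v → (m [ a ↦ v ]) a ≡ v
  ≡-update m a v rewrite dec-true (a ℤ.≟ a) refl = refl

  ≢-update : ∀ (m : Memory) {a b} v → a ≢ b → (m [ a ↦ v ]) b ≡ m b
  ≢-update m {a} {b} v a≢b rewrite dec-false (a ℤ.≟ b) a≢b = refl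

  region<16 : ∀ (a : Fin 8) → 2 + toℕ a < 16
  region<16 a = ≤-trans (s≤s (s≤s (Fin.toℕ<n a))) (m≤m+n 10 6)

  slot-injective : ∀ {s u} → slot s ≡ slot u → s ≡ u
  slot-injective {s} {u} eq = ℤ.+-injective (proj₂ (address-injective {0} {0} {+ s} {+ u} (m≤m+n 1 15) (m≤m+n 1 15) eq))

  slot≢address : ∀ {s a j} → 0 < a → a < 16 → slot s ≢ address a j
  slot≢address {s} {a} {j} 0<a a<16 eq = <⇒≢ 0<a (proj₁ (address-injective {0} {a} {+ s} {j} (m≤m+n 1 15) a<16 eq))

  slot≢cell : ∀ {s} p → slot s ≢ cell p
  slot≢cell {s} p = slot≢address {s} {1} {+ toℕ p} (m≤m+n 1 0) (m≤m+n 2 14)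

  slot≢entry : ∀ {s} a j → slot s ≢ entry a j
  slot≢entry {s} a j = slot≢address {s} {2 + toℕ a} {j} (m≤m+n 1 _) (region<16 a)

  -- The step count is kept only up to an upper bound, so that branches and loop bodies whose cost
  -- depends on the data compose with fixed constants.
  Runs : Program → State → State → ℕ → Set
  Runs P s s′ c = ∃[ t ] P ∶ s ⇓[ t ] s′ × t ≤ c

  infixr 5 _⨾ᴿ_

  _⨾ᴿ_ : ∀ {P Q s s′ s″ c d} → Runs P s s′ c → Runs Q s′ s″ d → Runs (P ⨾ Q) s s″ (c + d)
  (t , p , t≤) ⨾ᴿ (u , q , u≤) = t + u , ⇓seq p q , +-mono-≤ t≤ u≤

  run : ∀ {P s s′ t} → P ∶ s ⇓[ t ] s′ → Runs P s s′ t
  run p = _ , p , ≤-refl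

  runs-mono : ∀ {P s s′ c d} → c ≤ d → Runs P s s′ c → Runs P s s′ d
  runs-mono c≤d (t , p , t≤c) = t , p , ≤-trans t≤c c≤d

  module Loop (e : Exp) (P : Program) (c : ℕ) (I : ℕ → State → Set) where

    Step : ℕ → State → Set
    Step i s = 0ℤ ℤ.< ⟦ e ⟧ (State.memory s) × ∃[ s′ ] Runs P s s′ c × I (suc i) s′

    -- Induction on the number n of remaining rounds needs a variable index r of the current round.
    -- The guard is never inspected on its own: the invariant decides it, positive before the last
    -- index and nonpositive at it.
    counted : ∀ n r →
      (∀ i s → r ≤ i → i < n + r → I i s → Step i s) →
      (∀ s → I (n + r) s → ⟦ e ⟧ (State.memory s) ℤ.≤ 0ℤ) →
      ∀ s → I r s →
      ∃[ s′ ] Runs (while e >0do P) s s′ (1 + cost e + n * (1 + cost e + c)) × I (n + r) s′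
    counted zero r step end s h = s , (_ , ⇓exit (end s h) , m≤m+n _ 0) , h
    counted (suc n) r step end s h with step r s ≤-refl (s≤s (m≤n+m r n)) h
    ... | guard , s′ , (t , p , t≤c) , h′
      with counted n (suc r)
        (λ i s r<i i<n → step i s (<⇒≤ r<i) (subst (i <_) (+-suc n r) i<n))
        (λ s h → end s (subst (λ x → I x s) (+-suc n r) h)) s′ h′
    ... | s″ , (u , q , u≤) , h″ =
      s″ , (_ , ⇓loop guard p q , bound) , subst (λ x → I x s″) (+-suc n r) h″
      where
      open ≤-Reasoning
      bound : 1 + cost e + t + u ≤ 1 + cost e + suc n * (1 + cost e + c)
      bound = begin
        1 + cost e + t + u                                               ≤⟨ +-mono-≤ (+-monoʳ-≤ (1 + cost e) t≤c) u≤ ⟩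
        1 + cost e + c + (1 + cost e + n * (1 + cost e + c))             ≡⟨ swap (1 + cost e + c) (1 + cost e) _ ⟩
        1 + cost e + suc n * (1 + cost e + c)                            ∎
        where
        swap : ∀ a b c → a + (b + c) ≡ b + (a + c)
        swap = solve-∀

    loop : ∀ n →
      (∀ i s → i < n → I i s → Step i s) →
      (∀ s → I n s → ⟦ e ⟧ (State.memory s) ℤ.≤ 0ℤ) →
      ∀ s → I 0 s →
      ∃[ s′ ] Runs (while e >0do P) s s′ (1 + cost e + n * (1 + cost e + c)) × I n s′
    loop n step end s h with counted n 0
        (λ i s _ i<n → step i s (subst (i <_) (+-identityʳ n) i<n))
        (λ s h → end s (subst (λ x → I x s) (+-identityʳ n) h)) s h
    ... | s′ , r , h′ = s′ , r , subst (λ x → I x s′) (+-identityʳ n) h′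

  0<+n-+i : ∀ {i n} → i < n → 0ℤ ℤ.< + n ℤ.- + i
  0<+n-+i {i} {n} i<n rewrite ℤ.m-n≡m⊖n n i | ℤ.⊖-≥ (<⇒≤ i<n) = ℤ.+<+ (m<n⇒0<n∸m i<n)

  +n-+n≤0 : ∀ n → + n ℤ.- + n ℤ.≤ 0ℤ
  +n-+n≤0 n = ℤ.≤-reflexive (ℤ.i≡j⇒i-j≡0 {+ n} refl)

  -- The frame condition of compiled code: only stack slots from s on may change. Parameters, arrays
  -- and the variables of enclosing binders all lie elsewhere.
  Preserves : ℕ → Memory → Memory → Set
  Preserves s m m′ = ∀ b → (∀ u → s ≤ u → slot u ≢ b) → m′ b ≡ m b

  preserves-refl : ∀ {s m} → Preserves s m m
  preserves-refl b _ = refl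

  preserves-trans : ∀ {s u m m′ m″} → s ≤ u → Preserves s m m′ → Preserves u m′ m″ → Preserves s m m″
  preserves-trans s≤u p q b h = trans (q b (λ v u≤v → h v (≤-trans s≤u u≤v))) (p b h)

  preserves-update : ∀ {s u m m′} v → s ≤ u → Preserves s m m′ → Preserves s m (m′ [ slot u ↦ v ])
  preserves-update {m′ = m′} v s≤u p b h = trans (≢-update m′ v (h _ s≤u)) (p b h)

  preserves-slot : ∀ {s u m m′} → Preserves s m m′ → u < s → m′ (slot u) ≡ m (slot u)
  preserves-slot p u<s = p _ λ v s≤v eq → <⇒≱ u<s (subst (_ ≤_) (slot-injective {v} eq) s≤v)

  record Represents (π : Params) (σ : Arrays) (m : Memory) : Set where
    field
      params : ∀ p → m (cell p) ≡ + lookup π p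
      arrays : ∀ a j → m (entry a j) ≡ lookup σ a j

  open Represents

  represents-preserved : ∀ {π σ s m m′} → Preserves s m m′ → Represents π σ m → Represents π σ m′
  represents-preserved p r .params q   = trans (p _ (λ u _ → slot≢cell {u} q)) (r .params q)
  represents-preserved p r .arrays a j = trans (p _ (λ u _ → slot≢entry {u} a j)) (r .arrays a j)

  -- Every variable sits strictly below the working slot s, hence in a place that code satisfying
  -- `Preserves s` leaves alone.
  record Located {Γ} (s : ℕ) (ν : Vec ℕ Γ) (ρ : Vec ℤ Γ) (m : Memory) : Set where
    constructor located
    field at : ∀ x → lookup ν x < s × m (slot (lookup ν x)) ≡ lookup ρ x

  open Located

  located-preserved : ∀ {Γ s u} {ν : Vec ℕ Γ} {ρ m m′} → s ≤ u →
    Preserves s m m′ → Located s ν ρ m → Located u ν ρ m′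
  located-preserved s≤u p l .at x =
    ≤-trans (proj₁ (l .at x)) s≤u , trans (preserves-slot p (proj₁ (l .at x))) (proj₂ (l .at x))

  located-∷ : ∀ {Γ s u v} {ν : Vec ℕ Γ} {ρ m} → u < s → m (slot u) ≡ v →
    Located s ν ρ m → Located s (u ∷ ν) (v ∷ ρ) m
  located-∷ u<s eq l .at zero    = u<s , eq
  located-∷ u<s eq l .at (suc x) = l .at x

  pos?-true : ∀ {z} → 0ℤ ℤ.< z → pos? z ≡ true
  pos?-true (ℤ.+<+ (s≤s _)) = refl

  pos?-false : ∀ {z} → z ℤ.≤ 0ℤ → pos? z ≡ false
  pos?-false {+ zero}      _ = refl
  pos?-false {+ suc n}     (ℤ.+≤+ ())
  pos?-false {ℤ.-[1+ n ]} _ = refl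

  module Simulation (π : Params) (M : ℕ) (π≤M : ∀ p → lookup π p ≤ M) where

    -- Operands occupy consecutive slots, so the value of the first survives in slot s while the
    -- second is evaluated from `suc s` on. Returning `Preserves` lets both `Represents` and
    -- `Located` be carried past each subprogram.
    simulate : ∀ {Γ} (e : Ex Γ) {σ s ν ρ m i o} → Represents π σ m → Located s ν ρ m →
      ∃[ m′ ] Runs (compile s ν e) ⟨ m , i , o ⟩ ⟨ m′ , i , o ⟩ (time e M)
            × m′ (slot s) ≡ eval π σ ρ e × Preserves s m m′
    simulate (int z) {s = s} {m = m} r l =
      _ , run ⇓assign , ≡-update m (slot s) _ , preserves-update _ ≤-refl preserves-refl
    simulate (var x) {s = s} {m = m} r l =
      _ , run ⇓assign , trans (≡-update m (slot s) _) (proj₂ (l .at x)) , preserves-update _ ≤-refl preserves-refl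
    simulate (par p) {s = s} {m = m} r l =
      _ , run ⇓assign , trans (≡-update m (slot s) _) (r .params p) , preserves-update _ ≤-refl preserves-refl
    simulate (get a e) {σ} {s} {m = m} r l with simulate e {s = s} r l
    ... | m₁ , p₁ , v₁ , q₁ =
      _ , p₁ ⨾ᴿ run ⇓assign
        , trans (≡-update m₁ (slot s) _)
            (trans (represents-preserved q₁ r .arrays a (m₁ (slot s))) (cong (lookup σ a) v₁))
        , preserves-update _ ≤-refl q₁
    simulate (e ⊞ f) {σ} {s} {m = m} r l with simulate e {s = s} r l
    ... | m₁ , p₁ , v₁ , q₁ with simulate f {s = suc s} (represents-preserved q₁ r) (located-preserved (n≤1+n s) q₁ l)
    ... | m₂ , p₂ , v₂ , q₂ =
      _ , p₁ ⨾ᴿ p₂ ⨾ᴿ run ⇓assign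
        , trans (≡-update m₂ (slot s) _) (cong₂ ℤ._+_ (trans (preserves-slot q₂ ≤-refl) v₁) v₂)
        , preserves-update _ ≤-refl (preserves-trans (n≤1+n s) q₁ q₂)
    simulate (e ⊟ f) {σ} {s} {m = m} r l with simulate e {s = s} r l
    ... | m₁ , p₁ , v₁ , q₁ with simulate f {s = suc s} (represents-preserved q₁ r) (located-preserved (n≤1+n s) q₁ l)
    ... | m₂ , p₂ , v₂ , q₂ =
      _ , p₁ ⨾ᴿ p₂ ⨾ᴿ run ⇓assign
        , trans (≡-update m₂ (slot s) _) (cong₂ ℤ._-_ (trans (preserves-slot q₂ ≤-refl) v₁) v₂)
        , preserves-update _ ≤-refl (preserves-trans (n≤1+n s) q₁ q₂)
    simulate (ifpos e f g) {σ} {s} {ρ = ρ} r l with simulate e {s = s} r l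
    ... | m₁ , p₁ , v₁ , q₁ with 0ℤ ℤ.<? m₁ (slot s)
    ...   | yes 0<v with simulate f {s = s} (represents-preserved q₁ r) (located-preserved ≤-refl q₁ l)
    ...     | m₂ , (t , p₂ , t≤) , v₂ , q₂ =
      _ , p₁ ⨾ᴿ (_ , ⇓then 0<v p₂ , +-monoʳ-≤ 3 (≤-trans t≤ (m≤m+n _ _)))
        , trans v₂ (cong (if_then eval π σ ρ f else eval π σ ρ g) (sym (trans (cong pos? (sym v₁)) (pos?-true 0<v))))
        , preserves-trans ≤-refl q₁ q₂
    simulate (ifpos e f g) {σ} {s} {ρ = ρ} r l
        | m₁ , p₁ , v₁ , q₁ | no 0≮v with simulate g {s = s} (represents-preserved q₁ r) (located-preserved ≤-refl q₁ l)
    ...     | m₂ , (t , p₂ , t≤) , v₂ , q₂ =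
      _ , p₁ ⨾ᴿ (_ , ⇓else (ℤ.≮⇒≥ 0≮v) p₂ , +-monoʳ-≤ 3 (≤-trans t≤ (m≤n+m _ _)))
        , trans v₂ (cong (if_then eval π σ ρ f else eval π σ ρ g) (sym (trans (cong pos? (sym v₁)) (pos?-false (ℤ.≮⇒≥ 0≮v)))))
        , preserves-trans ≤-refl q₁ q₂
    simulate (bind e f) {σ} {s} {m = m} r l with simulate e {s = s} r l
    ... | m₁ , p₁ , v₁ , q₁
      with simulate f {s = suc s} (represents-preserved q₁ r) (located-∷ ≤-refl v₁ (located-preserved (n≤1+n s) q₁ l))
    ... | m₂ , p₂ , v₂ , q₂ =
      _ , p₁ ⨾ᴿ p₂ ⨾ᴿ run ⇓assign
        , trans (≡-update m₂ (slot s) _) v₂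
        , preserves-update _ ≤-refl (preserves-trans (n≤1+n s) q₁ q₂)
    simulate (fold p e f) {σ} {s} {ν} {ρ} {m} {i} {o} r l with simulate e {s = s} {i = i} {o} r l
    ... | m₁ , p₁ , v₁ , q₁ = finish (loop (lookup π p) step end _ start)
      where
      value : ℕ → ℤ
      value n = foldn n (λ i acc → eval π σ (+ i ∷ acc ∷ ρ) f) (eval π σ ρ e)

      -- Memory is compared with m, the memory before the initial value was computed, so that
      -- initialisation and loop share one frame condition.
      I : ℕ → State → Set
      I n ⟨ m′ , i′ , o′ ⟩ = i′ ≡ i × o′ ≡ o × m′ (slot s) ≡ value n × m′ (slot (suc s)) ≡ + n × Preserves s m m′

      open Loop (parᴱ p ⊖ valᴱ (suc s))
        (compile (suc (suc s)) (suc s ∷ s ∷ ν) f ⨾ slotᴱ s ≔ valᴱ (suc (suc s)) ⨾ increment (suc s))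
        (time f M + (4 + 6)) I

      guard≡ : ∀ {n m′} → Preserves s m m′ → m′ (slot (suc s)) ≡ + n →
        m′ (cell p) ℤ.- m′ (slot (suc s)) ≡ + lookup π p ℤ.- + n
      guard≡ q c = cong₂ ℤ._-_ (represents-preserved q r .params p) c

      s≢1+s : slot s ≢ slot (suc s)
      s≢1+s eq = <⇒≢ (n<1+n s) (slot-injective {s} eq)

      step : ∀ n st → n < lookup π p → I n st → Step n st
      step n ⟨ m₂ , i′ , o′ ⟩ n<p (refl , refl , v , c , q)
        with simulate f {s = suc (suc s)} {suc s ∷ s ∷ ν} {+ n ∷ value n ∷ ρ} {i = i} {o}
               (represents-preserved q r)
               (located-∷ ≤-refl c (located-∷ (n≤1+n (suc s)) v (located-preserved (m≤n+m s 2) q l)))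
      ... | m₃ , p₃ , v₃ , q₃ =
        subst (0ℤ ℤ.<_) (sym (guard≡ q c)) (0<+n-+i n<p) ,
        _ , p₃ ⨾ᴿ run ⇓assign ⨾ᴿ run ⇓assign ,
        refl , refl ,
        trans (≢-update m₄ _ (≢-sym s≢1+s)) (trans (≡-update m₃ (slot s) _) v₃) ,
        trans (≡-update m₄ (slot (suc s)) _) (trans (cong (ℤ._+ 1ℤ)
          (trans (≢-update m₃ _ s≢1+s) (trans (preserves-slot q₃ ≤-refl) c))) (cong +_ (+-comm n 1))) ,
        preserves-update _ (n≤1+n s) (preserves-update _ ≤-refl (preserves-trans (m≤n+m s 2) q q₃))
        where
        m₄ : Memory
        m₄ = m₃ [ slot s ↦ m₃ (slot (suc (suc s))) ]

      end : ∀ st → I (lookup π p) st → ⟦ parᴱ p ⊖ valᴱ (suc s) ⟧ (State.memory st) ℤ.≤ 0ℤ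
      end ⟨ m₂ , _ , _ ⟩ (_ , _ , _ , c , q) =
        subst (ℤ._≤ 0ℤ) (sym (guard≡ q c)) (+n-+n≤0 (lookup π p))

      start : I 0 ⟨ m₁ [ slot (suc s) ↦ 0ℤ ] , i , o ⟩
      start = refl , refl , trans (≢-update m₁ _ (≢-sym s≢1+s)) v₁ , ≡-update m₁ (slot (suc s)) _ ,
        preserves-update _ (n≤1+n s) q₁

      finish : (∃[ st ] Runs _ _ st (6 + lookup π p * (6 + (time f M + (4 + 6)))) × I (lookup π p) st) → _
      finish (⟨ m₂ , _ , _ ⟩ , p₂ , refl , refl , v , c , q) =
        m₂ , p₁ ⨾ᴿ run ⇓assign ⨾ᴿ runs-mono (+-monoʳ-≤ 6 (*-monoˡ-≤ _ (π≤M p))) p₂ , v , q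

    represents-set : ∀ {σ m a g} → (∀ p → m (cell p) ≡ + lookup π p) → (∀ j → m (entry a j) ≡ g j) →
      (∀ b j → b ≢ a → m (entry b j) ≡ lookup σ b j) → Represents π (σ [ a ]≔ g) m
    represents-set p here there .params = p
    represents-set {σ} {a = a} {g} p here there .arrays b j with b Fin.≟ a
    ... | yes refl = trans (here j) (sym (cong (λ f → f j) (lookup∘update a σ g)))
    ... | no b≢a   = trans (there b j b≢a) (sym (cong (λ f → f j) (lookup∘update′ b≢a σ g)))

    entry-injective : ∀ {a b i j} → entry a i ≡ entry b j → a ≡ b × i ≡ j
    entry-injective {a} {b} {i} {j} eq with address-injective {2 + toℕ a} {2 + toℕ b} {i} {j} (region<16 a) (region<16 b) eq
    ... | eq₁ , eq₂ = Fin.toℕ-injective (suc-injective (suc-injective eq₁)) , eq₂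

    cell≢entry : ∀ p a j → entry a j ≢ cell p
    cell≢entry p a j eq with address-injective {2 + toℕ a} {1} {j} {+ toℕ p} (region<16 a) (m≤m+n 2 14) eq
    ... | ()

    represents-store : ∀ {σ m a g} i v → Represents π (σ [ a ]≔ g) m →
      Represents π (σ [ a ]≔ (g [ i ↦ v ])) (m [ entry a i ↦ v ])
    represents-store {σ} {m} {a} {g} i v r = represents-set
      (λ p → trans (≢-update m v (cell≢entry p a i)) (r .params p))
      here
      (λ b j b≢a → trans (≢-update m v (λ eq → b≢a (sym (proj₁ (entry-injective {a} {b} {i} {j} eq)))))
                     (trans (r .arrays b j) (cong (λ f → f j) (lookup∘update′ b≢a σ g))))
      where
      here : ∀ j → (m [ entry a i ↦ v ]) (entry a j) ≡ (g [ i ↦ v ]) j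
      here j with i ℤ.≟ j
      ... | yes refl = ≡-update m (entry a i) v
      ... | no i≢j   = trans (≢-update m v (λ eq → i≢j (proj₂ (entry-injective {a} {a} {i} {j} eq))))
        (trans (r .arrays a j) (cong (λ f → f j) (lookup∘update a σ g)))

    step-counter : ∀ {m n} → m (slot 0) ≡ + n → (m [ slot 0 ↦ m (slot 0) ℤ.+ 1ℤ ]) (slot 0) ≡ + suc n
    step-counter {m} {n} c = trans (≡-update m (slot 0) _) (trans (cong (ℤ._+ 1ℤ) c) (cong +_ (+-comm n 1)))

    located-counter : ∀ {m n} → m (slot 0) ≡ + n → Located 1 (0 ∷ []) (+ n ∷ []) m
    located-counter c = located-∷ {u = 0} ≤-refl c (located λ ())

    simulateWrites : ∀ es {σ m i o n} → Represents π σ m → m (slot 0) ≡ + n →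
      ∃[ m′ ] Runs (writeAll es) ⟨ m , i , o ⟩ ⟨ m′ , i , o ++ List.map (eval π σ (+ n ∷ [])) es ⟩ (timeAll es M)
            × Represents π σ m′ × m′ (slot 0) ≡ + n
    simulateWrites [] {m = m} {i} {o} r c =
      m , subst (λ o′ → Runs skip ⟨ m , i , o ⟩ ⟨ m , i , o′ ⟩ 1) (sym (List.++-identityʳ o)) (run ⇓skip) , r , c
    simulateWrites (e ∷ es) {σ} {m} {i} {o} {n} r c with simulate e {s = 1} {i = i} {o} r (located-counter c)
    ... | m₁ , p₁ , v₁ , q₁
      with simulateWrites es {i = i} {o ∷ʳ m₁ (slot 1)} (represents-preserved q₁ r) (trans (preserves-slot q₁ ≤-refl) c)
    ... | m₂ , p₂ , r₂ , c₂ =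
      m₂ , subst (λ o′ → Runs (writeAll (e ∷ es)) ⟨ m , i , o ⟩ ⟨ m₂ , i , o′ ⟩ (timeAll (e ∷ es) M))
             (trans (List.++-assoc o (m₁ (slot 1) ∷ []) _) (cong (λ v → o ++ v ∷ List.map (eval π σ (+ n ∷ [])) es) v₁))
             (p₁ ⨾ᴿ run ⇓write ⨾ᴿ p₂) , r₂ , c₂

    -- Arrays and output before round t, for both kinds of statement at once; a single loop argument
    -- then covers tabulation and emission.
    state : Arrays → Stmt → List ℤ → ℕ → Arrays × List ℤ
    state σ (tab a p e) o t = σ [ a ]≔ filled π σ a e t , o
    state σ (emit p es) o t = σ , o ++ emitted π σ es t

    state-start : ∀ c {σ m o} → Represents π σ m →
      Represents π (proj₁ (state σ c o 0)) m × proj₂ (state σ c o 0) ≡ o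
    state-start (tab a p e) {σ} r =
      represents-set (r .params) (λ j → r .arrays a j) (λ b j _ → r .arrays b j) , refl
    state-start (emit p es) {o = o} r = r , List.++-identityʳ o

    state-end : ∀ c σ o → state σ c o (lookup π (range c)) ≡ (arraysAfter π σ c , o ++ output π σ c)
    state-end (tab a p e) σ o = cong (_ ,_) (sym (List.++-identityʳ o))
    state-end (emit p es) σ o = refl

    simulateBody : ∀ c {σ m i o} t →
      let (σ₀ , o₀) = state σ c o t; (σ₁ , o₁) = state σ c o (suc t) in
      Represents π σ₀ m → m (slot 0) ≡ + t →
      ∃[ m′ ] Runs (body c) ⟨ m , i , o₀ ⟩ ⟨ m′ , i , o₁ ⟩ (timeBody c M)
            × Represents π σ₁ m′ × m′ (slot 0) ≡ + t
    simulateBody (tab a p e) {σ} {i = i} {o} t r c with simulate e {s = 1} {i = i} {o} r (located-counter c)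
    ... | m₁ , p₁ , v₁ , q₁ =
      _ , p₁ ⨾ᴿ run ⇓assign ,
      subst₂ (λ j v → Represents π (σ [ a ]≔ (filled π σ a e t [ + t ↦ v ])) (m₁ [ entry a j ↦ m₁ (slot 1) ]))
        (sym c₁) v₁ (represents-store (+ t) _ (represents-preserved q₁ r)) ,
      trans (≢-update m₁ _ (λ eq → slot≢entry {0} a (m₁ (slot 0)) (sym eq))) c₁
      where
      c₁ : m₁ (slot 0) ≡ + t
      c₁ = trans (preserves-slot q₁ ≤-refl) c
    simulateBody (emit p es) {σ} {m} {i} {o} t r c with simulateWrites es {i = i} {o ++ emitted π σ es t} r c
    ... | m₁ , p₁ , r₁ , c₁ =
      m₁ , subst (λ o′ → Runs (writeAll es) ⟨ m , i , o ++ emitted π σ es t ⟩ ⟨ m₁ , i , o′ ⟩ (timeAll es M))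
             (List.++-assoc o _ _) p₁ , r₁ , c₁

    simulateStmt : ∀ c {σ m i o} → Represents π σ m →
      ∃[ m′ ] Runs (compileStmt c) ⟨ m , i , o ⟩ ⟨ m′ , i , o ++ output π σ c ⟩ (timeStmt c M)
            × Represents π (arraysAfter π σ c) m′
    simulateStmt c {σ} {m} {i} {o} r = finish (loop (lookup π (range c)) step end _ start)
      where
      I : ℕ → State → Set
      I t ⟨ m′ , i′ , o′ ⟩ =
        i′ ≡ i × o′ ≡ proj₂ (state σ c o t) × Represents π (proj₁ (state σ c o t)) m′ × m′ (slot 0) ≡ + t

      open Loop (parᴱ (range c) ⊖ valᴱ 0) (body c ⨾ increment 0) (timeBody c M + 6) I

      step : ∀ t st → t < lookup π (range c) → I t st → Step t st
      step t ⟨ m₁ , _ , _ ⟩ t<p (refl , refl , r₁ , c₁) with simulateBody c {σ} {i = i} {o} t r₁ c₁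
      ... | m₂ , p₂ , r₂ , c₂ =
        subst (0ℤ ℤ.<_) (sym (cong₂ ℤ._-_ (r₁ .params (range c)) c₁)) (0<+n-+i t<p) ,
        _ , p₂ ⨾ᴿ run ⇓assign ,
        refl , refl ,
        represents-preserved {s = 0} (preserves-update _ ≤-refl preserves-refl) r₂ ,
        step-counter {m₂} {t} c₂

      end : ∀ st → I (lookup π (range c)) st → ⟦ parᴱ (range c) ⊖ valᴱ 0 ⟧ (State.memory st) ℤ.≤ 0ℤ
      end ⟨ m₁ , _ , _ ⟩ (_ , _ , r₁ , c₁) =
        subst (ℤ._≤ 0ℤ) (sym (cong₂ ℤ._-_ (r₁ .params (range c)) c₁)) (+n-+n≤0 (lookup π (range c)))

      start : I 0 ⟨ m [ slot 0 ↦ 0ℤ ] , i , o ⟩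
      start = refl , sym (proj₂ (state-start c r)) ,
        represents-preserved {s = 0} (preserves-update _ ≤-refl preserves-refl) (proj₁ (state-start c {o = o} r)) ,
        ≡-update m (slot 0) _

      finish : (∃[ st ] Runs _ _ st (6 + lookup π (range c) * (6 + (timeBody c M + 6))) × I (lookup π (range c)) st) → _
      finish (⟨ m₁ , _ , _ ⟩ , p₁ , refl , refl , r₁ , c₁) =
        m₁ , subst (λ o′ → Runs (compileStmt c) ⟨ m , i , o ⟩ ⟨ m₁ , i , o′ ⟩ (timeStmt c M))
               (cong proj₂ (state-end c σ o))
               (run ⇓assign ⨾ᴿ runs-mono (+-monoʳ-≤ 6 (*-monoˡ-≤ _ (π≤M (range c)))) p₁) ,
        subst (λ σ′ → Represents π σ′ m₁) (cong proj₁ (state-end c σ o)) r₁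

    simulateAll : ∀ cs {σ m i o} → Represents π σ m →
      ∃[ m′ ] Runs (compileAll cs) ⟨ m , i , o ⟩ ⟨ m′ , i , o ++ outputs π σ cs ⟩ (timeStmts cs M)
    simulateAll [] {m = m} {i} {o} r =
      m , subst (λ o′ → Runs skip ⟨ m , i , o ⟩ ⟨ m , i , o′ ⟩ 1) (sym (List.++-identityʳ o)) (run ⇓skip)
    simulateAll (c ∷ cs) {σ} {m} {i} {o} r with simulateStmt c {i = i} {o} r
    ... | m₁ , p₁ , r₁ with simulateAll cs {i = i} {o ++ output π σ c} r₁
    ... | m₂ , p₂ =
      m₂ , subst (λ o′ → Runs (compileAll (c ∷ cs)) ⟨ m , i , o ⟩ ⟨ m₂ , i , o′ ⟩ (timeStmts (c ∷ cs) M))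
             (List.++-assoc o _ _) (p₁ ⨾ᴿ p₂)

-- Reading the input and fixing the loop bounds

module Preamble where

  open Compiler
  open import Defs hiding (length)
  open import Data.Fin.Base as Fin using (Fin; zero; suc; toℕ)
  open import Data.Fin.Patterns
  open import Data.Integer.Base as ℤ using (ℤ; +_; 0ℤ; 1ℤ)
  open import Data.List.Base using (List; []; _∷_; length; concatMap; drop)
  open import Data.Nat.Base hiding (_/_)
  open import Data.Nat.Logarithm using (⌊log₂_⌋; ⌊log₂⌋-mono-≤; ⌊log₂[2^n]⌋≡n)
  open import Data.Vec.Base using (Vec; []; _∷_; lookup; _[_]≔_; replicate)
  open import Data.Vec.Relation.Unary.All using (All; []; _∷_)
  open import Data.Vec.Relation.Unary.All.Properties using (lookup⁺)
  open import Data.Vec.Properties using (lookup∘update; lookup∘update′; lookup-replicate)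
  open Represents

  -- A table written in increasing order never overwrites an earlier entry. The abstract form serves
  -- both the arrays that hold the input and those filled by `tab`.
  module Filling (g : ℕ → ℤ → ℤ) (v : ℕ → ℤ) (step : ∀ t → g (suc t) ≡ g t [ + t ↦ v t ]) where

    stable : ∀ {s} t r → s < t → g (r + t) (+ s) ≡ g t (+ s)
    stable t zero    s<t = refl
    stable t (suc r) s<t = trans (cong (λ f → f _) (step (r + t)))
      (trans (≢-update (g (r + t)) _ (λ eq → <⇒≢ (<-≤-trans s<t (m≤n+m t r)) (sym (ℤ.+-injective eq))))
        (stable t r s<t))

    stable-≤ : ∀ {s t n} → s < t → t ≤ n → g t (+ s) ≡ g n (+ s)
    stable-≤ {s} {t} {n} s<t t≤n = trans (sym (stable t (n ∸ t) s<t)) (cong (λ r → g r (+ s)) (m∸n+n≡m t≤n))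

    filled-at : ∀ {t n} → t < n → g n (+ t) ≡ v t
    filled-at {t} t<n = trans (sym (stable-≤ ≤-refl t<n))
      (trans (cong (λ f → f (+ t)) (step t)) (≡-update (g t) (+ t) (v t)))

  load : (ℕ → ℤ) → ℕ → ℤ → ℤ
  load f zero    = λ _ → 0ℤ
  load f (suc t) = load f t [ + t ↦ f t ]

  load-at : ∀ f {t n} → t < n → load f n (+ t) ≡ f t
  load-at f = Filling.filled-at (load f) f (λ _ → refl)

  nth : List (ℤ × ℤ) → ℕ → ℤ × ℤ
  nth []       _       = 0ℤ , 0ℤ
  nth (x ∷ xs) zero    = x
  nth (x ∷ xs) (suc i) = nth xs i

  drop-nth : ∀ xs {i} → i < length xs → drop i xs ≡ nth xs i ∷ drop (suc i) xs
  drop-nth (x ∷ xs) {zero}  _         = refl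
  drop-nth (x ∷ xs) {suc i} (s≤s i<n) = drop-nth xs i<n

  flatten : List (ℤ × ℤ) → List ℤ
  flatten = concatMap (λ (a , b) → a ∷ b ∷ [])

  absᴱ : ∀ {Γ} → Ex Γ → Ex Γ
  absᴱ e = bind e (ifpos (var 0F) (var 0F) (int 0ℤ ⊟ var 0F))

  eval-abs : ∀ {Γ} π σ (ρ : Vec ℤ Γ) e → eval π σ ρ (absᴱ e) ≡ + ℤ.∣ eval π σ ρ e ∣
  eval-abs π σ ρ e with eval π σ ρ e
  ... | + zero      = refl
  ... | + suc n     = refl
  ... | ℤ.-[1+ n ] = refl

  foldn-+ : ∀ n (f : ℕ → ℤ → ℤ) (g : ℕ → ℕ → ℕ) a → (∀ i b → i < n → f i (+ b) ≡ + g i b) →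
    foldn n f (+ a) ≡ + foldn n g a
  foldn-+ zero    f g a h = refl
  foldn-+ (suc n) f g a h =
    trans (cong (f n) (foldn-+ n f g a (λ i b i<n → h i b (m<n⇒m<1+n i<n)))) (h n _ ≤-refl)

  foldn-add : ∀ n c a → foldn n (λ _ acc → acc + c) a ≡ n * c + a
  foldn-add zero    c a = refl
  foldn-add (suc n) c a rewrite foldn-add n c a = lemma c (n * c) a
    where
    lemma : ∀ x y z → y + z + x ≡ x + y + z
    lemma = solve-∀

  magnitude : ℤ × ℤ → ℕ
  magnitude (a , b) = ℤ.∣ a ∣ + ℤ.∣ b ∣

  magnitudes : List (ℤ × ℤ) → ℕ → ℕ
  magnitudes xs n = foldn n (λ i acc → acc + magnitude (nth xs i)) 0

  magnitude≤magnitudes : ∀ xs {i n} → i < n → magnitude (nth xs i) ≤ magnitudes xs n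
  magnitude≤magnitudes xs {i} {suc n} (s≤s i≤n) with i ≟ n
  ... | yes refl = m≤n+m (magnitude (nth xs i)) (magnitudes xs i)
  ... | no i≢n   = ≤-trans (magnitude≤magnitudes xs (≤∧≢⇒< i≤n i≢n)) (m≤m+n (magnitudes xs n) (magnitude (nth xs n)))

  magnitudes-∷ : ∀ x xs n → magnitudes (x ∷ xs) (suc n) ≡ magnitude x + magnitudes xs n
  magnitudes-∷ x xs zero    = sym (+-identityʳ (magnitude x))
  magnitudes-∷ x xs (suc n) rewrite magnitudes-∷ x xs n = +-assoc (magnitude x) _ _

  n<2^bits : ∀ z → ℤ.∣ z ∣ < 2 ^ bits z
  n<2^bits z = ≰⇒> λ le → <⇒≱ (n<1+n ⌊log₂ ℤ.∣ z ∣ ⌋)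
    (subst (_≤ ⌊log₂ ℤ.∣ z ∣ ⌋) (⌊log₂[2^n]⌋≡n (bits z)) (⌊log₂⌋-mono-≤ le))

  -- A sum is below the product of the successors: a + b < (a + 1) (b + 1).
  +<2^ : ∀ {a b x y} → a < 2 ^ x → b < 2 ^ y → a + b < 2 ^ (x + y)
  +<2^ {a} {b} {x} {y} a<X b<Y rewrite ^-distribˡ-+-* 2 x y = begin-strict
    a + b                    ≤⟨ +-monoˡ-≤ b (m≤m*n a (suc b)) ⟩
    a * suc b + b            <⟨ +-monoʳ-< (a * suc b) (n<1+n b) ⟩
    a * suc b + suc b        ≡⟨ +-comm (a * suc b) (suc b) ⟩
    suc a * suc b            ≤⟨ *-mono-≤ a<X b<Y ⟩
    2 ^ x * 2 ^ y            ∎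
    where open ≤-Reasoning

  -- Every number is below 2 to the number of its bits, and adding numbers at most adds these
  -- exponents. Hence the exponent ℓ found by the measuring loop is at most the size of the input.
  magnitudes<2^size : ∀ xs → magnitudes xs (length xs) < 2 ^ size (flatten xs)
  magnitudes<2^size []             = s≤s z≤n
  magnitudes<2^size ((a , b) ∷ xs) = subst₂ (λ s e → s < 2 ^ e)
    (sym (magnitudes-∷ (a , b) xs (length xs))) (+-assoc (bits a) (bits b) (size (flatten xs)))
    (+<2^ {x = bits a + bits b} (+<2^ {x = bits a} (n<2^bits a) (n<2^bits b)) (magnitudes<2^size xs))

  length≤size : ∀ xs → length xs ≤ size (flatten xs)
  length≤size []             = z≤n
  length≤size ((a , b) ∷ xs) = s≤s (≤-trans (length≤size xs)
    (≤-trans (m≤n+m _ (bits b)) (m≤n+m _ ⌊log₂ ℤ.∣ a ∣ ⌋)))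

  -- ℓ is the number of rounds of the doubling loop: the last component says that the guard holds in
  -- every earlier round, the first that it fails after round ℓ.
  least-power : ∀ s b → s < 2 ^ b → ∃[ ℓ ] s < 2 ^ ℓ × ℓ ≤ b × (∀ i → i < ℓ → 2 ^ i ≤ s)
  least-power s zero    h = 0 , h , z≤n , λ _ ()
  least-power s (suc b) h with s <? 2 ^ b
  ... | yes s<2^b with least-power s b s<2^b
  ...   | ℓ , p , ℓ≤b , q = ℓ , p , m≤n⇒m≤1+n ℓ≤b , q
  least-power s (suc b) h | no s≮2^b =
    suc b , h , ≤-refl , λ i i<1+b → ≤-trans (^-monoʳ-≤ 2 (s≤s⁻¹ i<1+b)) (≮⇒≥ s≮2^b)

  -- The parameters are n, k, 2n, k - 1, ℓ, k n and B = 1 + ℓ + 2nℓ, where 2^ℓ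
  -- exceeds the sum of the absolute values of all numbers in the input.

  width : ℕ → ℕ → ℕ
  width n ℓ = (n + n) * ℓ + (1 + ℓ)

  parameters : ℕ → ℕ → ℕ → Params
  parameters n k ℓ = n ∷ k ∷ n + n ∷ k ∸ 1 ∷ ℓ ∷ k * n ∷ width n ℓ ∷ []

  inputArrays : List (ℤ × ℤ) → ℕ → Arrays
  inputArrays xs i = load (λ t → proj₁ (nth xs t)) i ∷ load (λ t → proj₂ (nth xs t)) i ∷ replicate 6 (λ _ → 0ℤ)

  sumᴱ productᴱ widthᴱ : Ex 0
  sumᴱ     = fold 2F (int 0ℤ) (var 1F ⊞ (absᴱ (get 0F (var 0F)) ⊞ absᴱ (get 1F (var 0F))))
  productᴱ = fold 1F (int 0ℤ) (var 1F ⊞ par 0F)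
  widthᴱ   = fold 2F (int 1ℤ ⊞ par 4F) (var 1F ⊞ par 4F)

  setPar : Fin 7 → Exp → Program
  setPar p e = lit (cell p) ≔ e

  -- The order is forced by the parameters: each compiled fold runs over a parameter that is already
  -- stored, and the width is computed only after doubling has produced ℓ in parameter 4.
  readPairs preamble : Program
  readPairs = while parᴱ 2F ⊖ valᴱ 0 >0do (read (entryᴱ 0F 0) ⨾ read (entryᴱ 1F 0) ⨾ increment 0)
  preamble =
    read (lit (cell 0F)) ⨾ read (lit (cell 1F)) ⨾
    setPar 2F (parᴱ 0F ⊕ parᴱ 0F) ⨾ setPar 3F (parᴱ 1F ⊖ lit 1ℤ) ⨾
    slotᴱ 0 ≔ lit 0ℤ ⨾ readPairs ⨾
    compile 0 [] sumᴱ ⨾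
    slotᴱ 1 ≔ lit 1ℤ ⨾
    (while valᴱ 0 ⊕ lit 1ℤ ⊖ valᴱ 1 >0do
      (slotᴱ 1 ≔ valᴱ 1 ⊕ valᴱ 1 ⨾ setPar 4F (parᴱ 4F ⊕ lit 1ℤ))) ⨾
    compile 0 [] productᴱ ⨾ setPar 5F (valᴱ 0) ⨾
    compile 0 [] widthᴱ ⨾ setPar 6F (valᴱ 0)

  preambleTime : ℕ → ℕ
  preambleTime M =
    2 + (2 + (7 + (6 + (3 + ((6 + M * (6 + (50 + (50 + 6)))) +
    (time sumᴱ M + (3 + ((8 + M * (8 + (7 + 6))) +
    (time productᴱ M + (4 + (time widthᴱ M + 4)))))))))))

  poly-preambleTime : PolyBounded preambleTime
  poly-preambleTime =
    k+ 2 (k+ 2 (k+ 7 (k+ 6 (k+ 3 (poly-+ (k+ 6 (poly-* poly-id (poly-const 112)))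
    (poly-+ (poly-time sumᴱ) (k+ 3 (poly-+ (k+ 8 (poly-* poly-id (poly-const 21)))
    (poly-+ (poly-time productᴱ) (k+ 4 (poly-+ (poly-time widthᴱ) (poly-const 4))))))))))))
    where
    k+ : ∀ c {f} → PolyBounded f → PolyBounded (λ n → c + f n)
    k+ c = poly-+ (poly-const c)

  cell≢cell : ∀ {p q} → q ≢ p → cell p ≢ cell q
  cell≢cell {p} {q} q≢p eq =
    q≢p (Fin.toℕ-injective (sym (ℤ.+-injective (proj₂ (address-injective {1} {1} {+ toℕ p} {+ toℕ q} (m≤m+n 2 14) (m≤m+n 2 14) eq)))))

  module _ {π : Params} where

    represents-setPar : ∀ {σ m} p {v z} → z ≡ + v → Represents π σ m →
      Represents (π [ p ]≔ v) σ (m [ cell p ↦ z ])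
    represents-setPar {m = m} p {v} refl r .params q with q Fin.≟ p
    ... | yes refl = trans (≡-update m (cell p) _) (cong +_ (sym (lookup∘update p π v)))
    ... | no q≢p   = trans (≢-update m _ (cell≢cell q≢p)) (trans (r .params q) (cong +_ (sym (lookup∘update′ q≢p π v))))
    represents-setPar {m = m} p refl r .arrays a j =
      trans (≢-update m _ (λ eq → address-1≢entry (sym eq))) (r .arrays a j)
      where
      address-1≢entry : entry a j ≢ cell p
      address-1≢entry eq with address-injective {2 + toℕ a} {1} {j} {+ toℕ p} (region<16 a) (m≤m+n 2 14) eq
      ... | ()

  slot≢setPar : ∀ m {s} p v → (m [ cell p ↦ v ]) (slot s) ≡ m (slot s)
  slot≢setPar m {s} p v = ≢-update m v (λ eq → slot≢cell {s} p (sym eq))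

  slot≢slot : ∀ {s u} → s ≢ u → slot s ≢ slot u
  slot≢slot {s} s≢u eq = s≢u (slot-injective {s} eq)

  located-[] : ∀ {s m} → Located s [] [] m
  located-[] = located λ ()

  module PreambleCorrect (xs : List (ℤ × ℤ)) (n k : ℕ) (n+n≡ : n + n ≡ length xs) (1≤k : 1 ≤ k) (k≤n : k ≤ n) where

    -- The square accounts for the two products k n and 2 n ℓ, whose factors are all at most s; the
    -- summand 1 + s covers the 1 + ℓ in the width.
    M s : ℕ
    s = size (flatten xs)
    M = 1 + s + s * s

    π₁ : ℕ → Params
    π₁ ℓ = n ∷ k ∷ n + n ∷ k ∸ 1 ∷ ℓ ∷ 0 ∷ 0 ∷ []

    σ : Arrays
    σ = inputArrays xs (n + n)

    n+n≤s : n + n ≤ s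
    n+n≤s = ≤-trans (≤-reflexive n+n≡) (length≤size xs)

    s≤M : s ≤ M
    s≤M = ≤-trans (n≤1+n s) (m≤m+n _ _)

    n≤s : n ≤ s
    n≤s = ≤-trans (m≤m+n n n) n+n≤s

    k≤s : k ≤ s
    k≤s = ≤-trans k≤n n≤s

    module _ {ℓ : ℕ} (ℓ≤s : ℓ ≤ s) where

      private
        q≤M : k * n ≤ M
        q≤M = ≤-trans (*-mono-≤ k≤s n≤s) (m≤n+m (s * s) _)

        bounds : ∀ {q b} → q ≤ M → b ≤ M → All (_≤ M) (n ∷ k ∷ n + n ∷ k ∸ 1 ∷ ℓ ∷ q ∷ b ∷ [])
        bounds q≤ b≤ = ≤-trans n≤s s≤M ∷ ≤-trans k≤s s≤M ∷ ≤-trans n+n≤s s≤M ∷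
          ≤-trans (m∸n≤m k 1) (≤-trans k≤s s≤M) ∷ ≤-trans ℓ≤s s≤M ∷ q≤ ∷ b≤ ∷ []

      bounded : ∀ p → lookup (parameters n k ℓ) p ≤ M
      bounded = lookup⁺ (bounds q≤M
        (≤-trans (+-mono-≤ (*-mono-≤ n+n≤s ℓ≤s) (s≤s ℓ≤s)) (≤-reflexive (+-comm (s * s) (1 + s)))))

      bounded₁ : ∀ p → lookup (π₁ ℓ) p ≤ M
      bounded₁ = lookup⁺ (bounds z≤n z≤n)

      bounded₂ : ∀ p → lookup (π₁ ℓ [ 5F ]≔ k * n) p ≤ M
      bounded₂ = lookup⁺ (bounds q≤M z≤n)

    sum-value : ∀ ℓ → eval (π₁ ℓ) σ [] sumᴱ ≡ + magnitudes xs (n + n)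
    sum-value ℓ = foldn-+ (n + n) _ _ 0 λ i b i<n → cong (λ z → + b ℤ.+ z) (cong₂ ℤ._+_
      (trans (eval-abs (π₁ ℓ) σ (+ i ∷ + b ∷ []) (get 0F (var 0F))) (cong (λ z → + ℤ.∣ z ∣) (load-at _ i<n)))
      (trans (eval-abs (π₁ ℓ) σ (+ i ∷ + b ∷ []) (get 1F (var 0F))) (cong (λ z → + ℤ.∣ z ∣) (load-at _ i<n))))

    product-value : ∀ ℓ → eval (π₁ ℓ) σ [] productᴱ ≡ + (k * n)
    product-value ℓ = trans (foldn-+ k _ (λ _ b → b + n) 0 (λ _ _ _ → refl))
      (cong +_ (trans (foldn-add k n 0) (+-identityʳ _)))

    width-value : ∀ ℓ → eval (π₁ ℓ [ 5F ]≔ k * n) σ [] widthᴱ ≡ + width n ℓ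
    width-value ℓ = trans (foldn-+ (n + n) _ (λ _ b → b + ℓ) (1 + ℓ) (λ _ _ _ → refl))
      (cong +_ (foldn-add (n + n) ℓ (1 + ℓ)))

    module Reading {m₀ : Memory} (r₀ : Represents (π₁ 0) (replicate 8 (λ _ → 0ℤ)) m₀) where

      I : ℕ → State → Set
      I t ⟨ m , i , o ⟩ = i ≡ flatten (drop t xs) × o ≡ [] × Represents (π₁ 0) (inputArrays xs t) m × m (slot 0) ≡ + t

      open Loop (parᴱ 2F ⊖ valᴱ 0) (read (entryᴱ 0F 0) ⨾ read (entryᴱ 1F 0) ⨾ increment 0) (50 + (50 + 6)) I
      open Simulation (π₁ 0) M (bounded₁ z≤n) using (represents-store; step-counter; represents-set)

      step : ∀ t st → t < n + n → I t st → Step t st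
      step t ⟨ m , _ , _ ⟩ t<n (refl , refl , r , c) =
        subst (0ℤ ℤ.<_) (sym (cong₂ ℤ._-_ (r .params 2F) c)) (0<+n-+i t<n) ,
        _ , subst (λ i → Runs _ ⟨ m , flatten i , [] ⟩ ⟨ m₃ , flatten (drop (suc t) xs) , [] ⟩ _)
              (sym (drop-nth xs (subst (t <_) n+n≡ t<n)))
              (run ⇓read ⨾ᴿ run ⇓read ⨾ᴿ run ⇓assign) ,
        refl , refl ,
        represents-preserved {s = 0} {m = m₂} (preserves-update {u = 0} {m′ = m₂} (m₂ (slot 0) ℤ.+ 1ℤ) ≤-refl preserves-refl) r₂ ,
        step-counter {m₂} {t} c₂
        where
        m₁ m₂ m₃ : Memory
        m₁ = m [ entry 0F (m (slot 0)) ↦ proj₁ (nth xs t) ]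
        m₂ = m₁ [ entry 1F (m₁ (slot 0)) ↦ proj₂ (nth xs t) ]
        m₃ = m₂ [ slot 0 ↦ m₂ (slot 0) ℤ.+ 1ℤ ]
        c₁ : m₁ (slot 0) ≡ + t
        c₁ = trans (≢-update m _ (λ eq → slot≢entry {0} 0F (m (slot 0)) (sym eq))) c
        c₂ : m₂ (slot 0) ≡ + t
        c₂ = trans (≢-update m₁ _ (λ eq → slot≢entry {0} 1F (m₁ (slot 0)) (sym eq))) c₁
        r₁ : Represents (π₁ 0) (inputArrays xs t [ 0F ]≔ load (λ t → proj₁ (nth xs t)) (suc t)) m₁
        r₁ = subst (λ j → Represents (π₁ 0) (inputArrays xs t [ 0F ]≔ load (λ t → proj₁ (nth xs t)) (suc t))
                            (m [ entry 0F j ↦ proj₁ (nth xs t) ])) (sym c)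
               (represents-store {inputArrays xs t} {a = 0F} (+ t) _ r)
        r₂ : Represents (π₁ 0) (inputArrays xs (suc t)) m₂
        r₂ = subst (λ j → Represents (π₁ 0) (inputArrays xs (suc t)) (m₁ [ entry 1F j ↦ proj₂ (nth xs t) ])) (sym c₁)
               (represents-store {inputArrays xs t [ 0F ]≔ load (λ t → proj₁ (nth xs t)) (suc t)} {a = 1F} (+ t) _ r₁)

      end : ∀ st → I (n + n) st → ⟦ parᴱ 2F ⊖ valᴱ 0 ⟧ (State.memory st) ℤ.≤ 0ℤ
      end ⟨ m , _ , _ ⟩ (_ , _ , r , c) =
        subst (ℤ._≤ 0ℤ) (sym (cong₂ ℤ._-_ (r .params 2F) c)) (+n-+n≤0 (n + n))

      reading : m₀ (slot 0) ≡ 0ℤ →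
        ∃[ m ] ∃[ i ] Runs readPairs ⟨ m₀ , flatten xs , [] ⟩ ⟨ m , i , [] ⟩ (6 + M * (6 + (50 + (50 + 6))))
             × Represents (π₁ 0) σ m
      reading c₀ with loop (n + n) step end ⟨ m₀ , flatten xs , [] ⟩ (refl , refl , r₀ , c₀)
      ... | ⟨ m , i , _ ⟩ , p , _ , refl , r , _ =
        m , i , runs-mono (+-monoʳ-≤ 6 (*-monoˡ-≤ _ (≤-trans n+n≤s s≤M))) p , r

    module Doubling {ℓ S : ℕ} (S<2^ℓ : S < 2 ^ ℓ) (ℓ≤s : ℓ ≤ s) (below : ∀ i → i < ℓ → 2 ^ i ≤ S) (inp : List ℤ) where

      P : Program
      P = slotᴱ 1 ≔ valᴱ 1 ⊕ valᴱ 1 ⨾ setPar 4F (parᴱ 4F ⊕ lit 1ℤ)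

      -- Slot 1 holds 2^t while parameter 4 counts the doublings, so the guard S + 1 - 2^t is
      -- positive exactly while 2^t ≤ S.
      I : ℕ → State → Set
      I t ⟨ m , i , o ⟩ = i ≡ inp × o ≡ [] × Represents (π₁ t) σ m × m (slot 0) ≡ + S × m (slot 1) ≡ + (2 ^ t)

      open Loop (valᴱ 0 ⊕ lit 1ℤ ⊖ valᴱ 1) P (7 + 6) I

      guard≡ : ∀ {m : Memory} {t} → m (slot 0) ≡ + S → m (slot 1) ≡ + (2 ^ t) →
        m (slot 0) ℤ.+ 1ℤ ℤ.- m (slot 1) ≡ + suc S ℤ.- + (2 ^ t)
      guard≡ a b = cong₂ ℤ._-_ (trans (cong (ℤ._+ 1ℤ) a) (cong +_ (+-comm S 1))) b

      step : ∀ t st → t < ℓ → I t st → Step t st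
      step t ⟨ m , _ , _ ⟩ t<ℓ (refl , refl , r , a , b) =
        subst (0ℤ ℤ.<_) (sym (guard≡ {m} {t} a b)) (0<+n-+i (s≤s (below t t<ℓ))) ,
        _ , run ⇓assign ⨾ᴿ run ⇓assign ,
        refl , refl ,
        represents-setPar 4F (trans (cong (ℤ._+ 1ℤ) (r₁ .params 4F)) (cong +_ (+-comm t 1))) r₁ ,
        trans (slot≢setPar m₁ {0} 4F (m₁ (cell 4F) ℤ.+ 1ℤ)) (trans (≢-update m (m (slot 1) ℤ.+ m (slot 1)) (slot≢slot {1} {0} (λ ()))) a) ,
        trans (slot≢setPar m₁ {1} 4F (m₁ (cell 4F) ℤ.+ 1ℤ)) (trans (≡-update m (slot 1) (m (slot 1) ℤ.+ m (slot 1)))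
          (trans (cong₂ ℤ._+_ b b) (cong +_ (cong (λ z → 2 ^ t + z) (sym (+-identityʳ (2 ^ t)))))))
        where
        m₁ : Memory
        m₁ = m [ slot 1 ↦ m (slot 1) ℤ.+ m (slot 1) ]
        r₁ : Represents (π₁ t) σ m₁
        r₁ = represents-preserved {s = 0} (preserves-update {u = 1} _ z≤n preserves-refl) r

      end : ∀ st → I ℓ st → ⟦ valᴱ 0 ⊕ lit 1ℤ ⊖ valᴱ 1 ⟧ (State.memory st) ℤ.≤ 0ℤ
      end ⟨ m , _ , _ ⟩ (_ , _ , _ , a , b) = subst (ℤ._≤ 0ℤ) (sym (guard≡ {m} {ℓ} a b))
        (ℤ.≤-trans (ℤ.+-monoˡ-≤ (ℤ.- (+ (2 ^ ℓ))) (ℤ.+≤+ S<2^ℓ)) (+n-+n≤0 (2 ^ ℓ)))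

      doubling : ∀ {m₀} → Represents (π₁ 0) σ m₀ → m₀ (slot 0) ≡ + S → m₀ (slot 1) ≡ 1ℤ →
        ∃[ m ] Runs (while valᴱ 0 ⊕ lit 1ℤ ⊖ valᴱ 1 >0do P) ⟨ m₀ , inp , [] ⟩ ⟨ m , inp , [] ⟩ (8 + M * (8 + (7 + 6)))
             × Represents (π₁ ℓ) σ m
      doubling {m₀} r a b with loop ℓ step end ⟨ m₀ , inp , [] ⟩ (refl , refl , r , a , b)
      ... | ⟨ m , _ , _ ⟩ , p , refl , refl , r′ , _ =
        m , runs-mono (+-monoʳ-≤ 8 (*-monoˡ-≤ _ (≤-trans ℓ≤s s≤M))) p , r′

    zeros : Represents (replicate 7 0) (replicate 8 (λ _ → 0ℤ)) (λ _ → 0ℤ)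
    zeros .params p   = cong +_ (sym (lookup-replicate p 0))
    zeros .arrays a j = sym (cong (λ f → f j) (lookup-replicate a (λ _ → 0ℤ)))

    preamble-correct : ∃[ ℓ ] ∃[ m ] ∃[ i ]
      Runs preamble ⟨ (λ _ → 0ℤ) , + n ∷ + k ∷ flatten xs , [] ⟩ ⟨ m , i , [] ⟩ (preambleTime M)
      × Represents (parameters n k ℓ) σ m × magnitudes xs (n + n) < 2 ^ ℓ × (∀ p → lookup (parameters n k ℓ) p ≤ M)
    preamble-correct with least-power (magnitudes xs (n + n)) s
      (subst (λ l → magnitudes xs l < 2 ^ s) (sym n+n≡) (magnitudes<2^size xs))
    ... | ℓ , S<2^ℓ , ℓ≤s , below = main
      where
      m₁ m₂ m₃ m₄ m₅ : Memory
      m₁ = (λ _ → 0ℤ) [ cell 0F ↦ + n ]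
      m₂ = m₁ [ cell 1F ↦ + k ]
      m₃ = m₂ [ cell 2F ↦ m₂ (cell 0F) ℤ.+ m₂ (cell 0F) ]
      m₄ = m₃ [ cell 3F ↦ m₃ (cell 1F) ℤ.- 1ℤ ]
      m₅ = m₄ [ slot 0 ↦ 0ℤ ]

      k-1 : + k ℤ.- 1ℤ ≡ + (k ∸ 1)
      k-1 = trans (ℤ.m-n≡m⊖n k 1) (ℤ.⊖-≥ 1≤k)

      r₂ : Represents (n ∷ k ∷ 0 ∷ 0 ∷ 0 ∷ 0 ∷ 0 ∷ []) (replicate 8 (λ _ → 0ℤ)) m₂
      r₂ = represents-setPar 1F refl (represents-setPar 0F refl zeros)
      r₃ : Represents (n ∷ k ∷ n + n ∷ 0 ∷ 0 ∷ 0 ∷ 0 ∷ []) (replicate 8 (λ _ → 0ℤ)) m₃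
      r₃ = represents-setPar 2F (cong₂ ℤ._+_ (r₂ .params 0F) (r₂ .params 0F)) r₂
      r₅ : Represents (π₁ 0) (replicate 8 (λ _ → 0ℤ)) m₅
      r₅ = represents-preserved {s = 0} {m = m₄} (preserves-update {u = 0} _ z≤n preserves-refl)
             (represents-setPar 3F (trans (cong (ℤ._- 1ℤ) (r₃ .params 1F)) k-1) r₃)

      main : _
      main with Reading.reading r₅ (≡-update m₄ (slot 0) 0ℤ)
      ... | m₆ , inp , p₆ , r₆
        with Simulation.simulate (π₁ 0) M (bounded₁ z≤n) sumᴱ {s = 0} {i = inp} {[]} r₆ located-[]
      ... | m₇ , p₇ , v₇ , q₇
        with Doubling.doubling S<2^ℓ ℓ≤s below inp {m₇ [ slot 1 ↦ 1ℤ ]}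
               (represents-preserved {s = 0} (preserves-update {u = 1} 1ℤ z≤n q₇) r₆)
               (trans (≢-update m₇ 1ℤ (slot≢slot {1} {0} (λ ()))) (trans v₇ (sum-value 0)))
               (≡-update m₇ (slot 1) 1ℤ)
      ... | m₈ , p₈ , r₈
        with Simulation.simulate (π₁ ℓ) M (bounded₁ ℓ≤s) productᴱ {s = 0} {i = inp} {[]} r₈ located-[]
      ... | m₉ , p₉ , v₉ , q₉
        with represents-setPar 5F (trans v₉ (product-value ℓ)) (represents-preserved q₉ r₈)
      ... | r₁₀
        with Simulation.simulate (π₁ ℓ [ 5F ]≔ k * n) M (bounded₂ ℓ≤s) widthᴱ {s = 0} {i = inp} {[]} r₁₀ located-[]
      ... | m₁₁ , p₁₁ , v₁₁ , q₁₁ =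
        ℓ , m₁₁ [ cell 6F ↦ m₁₁ (slot 0) ] , inp ,
        (run ⇓read ⨾ᴿ run ⇓read ⨾ᴿ run ⇓assign ⨾ᴿ run ⇓assign ⨾ᴿ run ⇓assign ⨾ᴿ p₆ ⨾ᴿ p₇ ⨾ᴿ
          run ⇓assign ⨾ᴿ p₈ ⨾ᴿ p₉ ⨾ᴿ run ⇓assign ⨾ᴿ p₁₁ ⨾ᴿ run ⇓assign) ,
        represents-setPar 6F (trans v₁₁ (width-value ℓ)) (represents-preserved q₁₁ r₁₀) ,
        S<2^ℓ , bounded ℓ≤s

-- Tours of a doubled tree

module Walks where

  open import Defs using (Graph; Adjacent; Connected; vertices; edges)
  open import Data.Fin.Base using (Fin)
  import Data.Fin.Subset as Subset
  open import Data.List.Base as List using (List; []; _∷_; _++_; length)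
  open import Data.List.Membership.Propositional using (_∈_)
  open import Data.List.Membership.Propositional.Properties using (∈-++⁺ˡ; ∈-++⁺ʳ)
  open import Data.List.Properties using (length-++)
  open import Data.List.Relation.Binary.Subset.Propositional using (_⊆_)
  open import Data.List.Relation.Unary.All as All using (All; []; _∷_)
  open import Data.List.Relation.Unary.AllPairs using ([]; _∷_)
  open import Data.List.Relation.Unary.Any using (here; there; any?)
  open import Data.List.Relation.Unary.Linked using (Linked; []; _∷_)
  open import Data.List.Relation.Unary.Unique.Propositional using (Unique)
  open import Data.Nat.Base
  open import Data.Nat.ListAction using (sum)
  open import Relation.Binary.Construct.Closure.ReflexiveTransitive using (Star; ε; _◅_)

  module Paths {A : Set} (d : A → A → ℕ) where

    pathFrom : A → List A → ℕ
    pathFrom x []       = 0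
    pathFrom x (y ∷ ys) = d x y + pathFrom y ys

  -- A closed walk is extended by detours i , j , i along edges that leave it.

  module Tour {n} (d : Fin n → Fin n → ℕ) (d-sym : ∀ i j → d i j ≡ d j i) where

    open Paths d

    Edge : Set
    Edge = Fin n × Fin n

    weight : List Edge → ℕ
    weight es = sum (List.map (λ (i , j) → d i j) es)

    Touches : List (Fin n) → Edge → Set
    Touches ws (i , j) = i ∈ ws ⊎ j ∈ ws

    touches? : ∀ ws e → Dec (Touches ws e)
    touches? ws (i , j) = any? (i Fin.≟_) ws ⊎-dec any? (j Fin.≟_) ws

    -- The edges not yet traversed form a list whose length is the fuel of `grow`. Their order is
    -- irrelevant, so only inclusion, length and total weight are tracked when one is taken out.
    pick : ∀ ws es →
      (Σ[ e ∈ Edge ] Σ[ es′ ∈ List Edge ] Touches ws e × weight es ≡ weight (e ∷ es′)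
         × length es ≡ suc (length es′) × es ⊆ e ∷ es′)
      ⊎ (∀ e → e ∈ es → ¬ Touches ws e)
    pick ws [] = inj₂ λ _ ()
    pick ws (e ∷ es) with touches? ws e
    ... | yes t = inj₁ (e , es , t , refl , refl , λ x → x)
    ... | no ¬t with pick ws es
    ...   | inj₂ h = inj₂ λ { _ (here refl) → ¬t ; f (there f∈) → h f f∈ }
    ...   | inj₁ (f@(i , j) , es′ , t , w , l , s) =
      inj₁ (f , e ∷ es′ , t , trans (cong (_ +_) w) (swap _ (d i j) (weight es′)) , cong suc l ,
        λ { (here refl) → there (here refl) ; (there x) → move (s x) })
      where
      swap : ∀ a b c → a + (b + c) ≡ b + (a + c)
      swap = solve-∀
      move : ∀ {x} → x ∈ f ∷ es′ → x ∈ f ∷ e ∷ es′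
      move (here eq)  = here eq
      move (there x∈) = there (there x∈)

    -- After an occurrence of i the vertices j, i are inserted. The walk continues from i as before,
    -- and everything already visited stays on it.
    detour : ∀ {i j} x ys → i ∈ x ∷ ys →
      ∃[ ys′ ] x ∷ ys ⊆ x ∷ ys′ × j ∈ x ∷ ys′ × pathFrom x ys′ ≡ pathFrom x ys + 2 * d i j
    detour {j = j} x ys (here refl) =
      j ∷ x ∷ ys , (λ { (here eq) → here eq ; (there y∈) → there (there (there y∈)) }) , there (here refl) ,
      trans (cong (λ z → d x j + (z + pathFrom x ys)) (d-sym j x)) (lemma (d x j) (pathFrom x ys))
      where
      lemma : ∀ a b → a + (a + b) ≡ b + 2 * a
      lemma = solve-∀
    detour {i} {j} x (y ∷ ys) (there i∈) with detour {i} {j} y ys i∈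
    ... | ys′ , s , j∈ , eq =
      y ∷ ys′ , (λ { (here eq) → here eq ; (there z∈) → there (s z∈) }) , there j∈ ,
      trans (cong (d x y +_) eq) (sym (+-assoc (d x y) _ _))

    module _ (G : Graph n) where

      -- The quantity that stays bounded is the length of the walk plus twice the weight of the
      -- untraversed edges: a detour moves 2 d i j from the second term to the first. Since every
      -- edge is traversed or still listed, a walk that no listed edge touches is closed under
      -- adjacency.
      grow : ∀ fuel r ws es → length es ≤ fuel →
        (∀ {i j} → (i , j) ∈ edges G → (i ∈ r ∷ ws × j ∈ r ∷ ws) ⊎ (i , j) ∈ es) →
        pathFrom r ws + 2 * weight es ≤ 2 * weight (edges G) →
        ∃[ ws′ ] (∀ {i j} → i ∈ r ∷ ws′ → Adjacent G i j → j ∈ r ∷ ws′)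
               × pathFrom r ws′ ≤ 2 * weight (edges G)
      grow fuel r ws es l cov bound with pick (r ∷ ws) es
      ... | inj₂ none = ws , closed , m+n≤o⇒m≤o _ bound
        where
        closed : ∀ {i j} → i ∈ r ∷ ws → Adjacent G i j → j ∈ r ∷ ws
        closed i∈ (inj₁ e) with cov e
        ... | inj₁ (_ , j∈) = j∈
        ... | inj₂ e∈       = contradiction (inj₁ i∈) (none _ e∈)
        closed i∈ (inj₂ e) with cov e
        ... | inj₁ (j∈ , _) = j∈
        ... | inj₂ e∈       = contradiction (inj₂ i∈) (none _ e∈)
      grow zero r ws es l cov bound | inj₁ (e , es′ , t , w , l′ , s) = contradiction (subst (_≤ 0) l′ l) λ ()
      grow (suc fuel) r ws es l cov bound | inj₁ (e@(i , j) , es′ , t , w , l′ , s) with enter t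
        where
        enter : Touches (r ∷ ws) e → ∃[ ws′ ] r ∷ ws ⊆ r ∷ ws′ × (i ∈ r ∷ ws′ × j ∈ r ∷ ws′)
          × pathFrom r ws′ ≡ pathFrom r ws + 2 * d i j
        enter (inj₁ i∈) with detour r ws i∈
        ... | ws′ , sub , j∈ , eq = ws′ , sub , (sub i∈ , j∈) , eq
        enter (inj₂ j∈) with detour r ws j∈
        ... | ws′ , sub , i∈ , eq =
          ws′ , sub , (i∈ , sub j∈) , trans eq (cong (λ z → pathFrom r ws + 2 * z) (d-sym j i))
      ... | ws′ , sub , ends , eq = grow fuel r ws′ es′ (s≤s⁻¹ (subst (_≤ suc fuel) l′ l)) cov′
        (≤-trans (≤-reflexive (trans (cong (_+ 2 * weight es′) eq) (trans (lemma (pathFrom r ws) (d i j) (weight es′))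
          (cong (λ z → pathFrom r ws + 2 * z) (sym w))))) bound)
        where
        lemma : ∀ a b c → a + 2 * b + 2 * c ≡ a + 2 * (b + c)
        lemma = solve-∀
        cov′ : ∀ {i′ j′} → (i′ , j′) ∈ edges G → (i′ ∈ r ∷ ws′ × j′ ∈ r ∷ ws′) ⊎ (i′ , j′) ∈ es′
        cov′ e∈ with cov e∈
        ... | inj₁ (p , q) = inj₁ (sub p , sub q)
        ... | inj₂ e∈es with s e∈es
        ...   | here refl = inj₁ ends
        ...   | there e∈′ = inj₂ e∈′

      tour : Connected G → ∀ r → r Subset.∈ vertices G →
        ∃[ ws ] (∀ v → v Subset.∈ vertices G → v ∈ r ∷ ws) × pathFrom r ws ≤ 2 * weight (edges G)
      tour conn r r∈ with grow (length (edges G)) r [] (edges G) ≤-refl inj₂ ≤-refl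
      ... | ws , closed , bound = ws , (λ v v∈ → follow (here refl) (conn r v r∈ v∈)) , bound
        where
        follow : ∀ {i j} → i ∈ r ∷ ws → Star (Adjacent G) i j → j ∈ r ∷ ws
        follow i∈ ε        = i∈
        follow i∈ (a ◅ as) = follow (closed i∈ a) as

  remove : ∀ {A : Set} {x : A} xs → x ∈ xs →
    ∃[ ys ] length xs ≡ suc (length ys) × (∀ {y} → y ∈ xs → y ≢ x → y ∈ ys)
  remove (x ∷ xs) (here refl) = xs , refl , λ { (here refl) y≢x → contradiction refl y≢x ; (there y∈) _ → y∈ }
  remove (z ∷ xs) (there x∈) with remove xs x∈
  ... | ys , l , h = z ∷ ys , cong suc l , λ { (here refl) _ → here refl ; (there y∈) y≢x → there (h y∈ y≢x) }

  unique-⊆⇒length≤ : ∀ {A : Set} {xs ys : List A} → Unique xs → xs ⊆ ys → length xs ≤ length ys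
  unique-⊆⇒length≤ {xs = []}     u s = z≤n
  unique-⊆⇒length≤ {xs = x ∷ xs} {ys} (x∉ ∷ u) s with remove ys (s (here refl))
  ... | zs , l , h = subst (suc (length xs) ≤_) (sym l)
    (s≤s (unique-⊆⇒length≤ u λ y∈ → h (s (there y∈)) (≢-sym (All.lookup x∉ y∈))))

  -- A hierarchy of partitions of a metric space.  Level t consists of cells of
  -- diameter less than 2 · 2^t numbered by key t, each ball of radius 2^t meets
  -- at most nine of them, and the numbering is refined from level to level.

  record Hierarchy (A : Set) : Set where
    field
      d           : A → A → ℕ
      d-refl      : ∀ a → d a a ≡ 0
      d-sym       : ∀ a b → d a b ≡ d b a
      d-triangle  : ∀ a b c → d a c ≤ d a b + d b c
      key         : ℕ → A → ℕ
      key-mono    : ∀ t {a b} → key 0 a ≤ key 0 b → key t a ≤ key t b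
      key-close   : ∀ t {a b} → key t a ≡ key t b → d a b + 2 ≤ 2 * 2 ^ t
      ball        : ℕ → A → List ℕ
      ball-size   : ∀ t a → length (ball t a) ≡ 9
      ball-covers : ∀ t {a b} → d a b < 2 ^ t → key t b ∈ ball t a

  -- The length of a sorted path, level by level

  module SortedPaths {A : Set} (H : Hierarchy A) where

    open Hierarchy H
    open Paths d

    -- Each time the walk has moved by 2^t from its anchor, the anchor is reset.

    cells : ∀ t a r u ws → d a u ≤ r → r < 2 ^ t →
      ∃[ ks ] ball t a ⊆ ks × (∀ {v} → v ∈ u ∷ ws → key t v ∈ ks) × length ks * 2 ^ t ≤ 9 * (2 ^ t + (r + pathFrom u ws))
    cells t a r u [] near r< =
      ball t a , (λ z → z) , (λ { (here refl) → ball-covers t (≤-<-trans near r<) }) ,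
      subst (λ l → l * 2 ^ t ≤ _) (sym (ball-size t a)) (*-monoʳ-≤ 9 (m≤m+n (2 ^ t) _))
    cells t a r u (w ∷ ws) near r< with r + d u w <? 2 ^ t
    ... | yes r′< with cells t a (r + d u w) w ws (≤-trans (d-triangle a u w) (+-monoˡ-≤ (d u w) near)) r′<
    ...   | ks , sub , cov , bound =
      ks , sub , (λ { (here refl) → sub (ball-covers t (≤-<-trans near r<)) ; (there v∈) → cov v∈ }) ,
      subst (λ z → length ks * 2 ^ t ≤ 9 * (2 ^ t + z)) (+-assoc r (d u w) _) bound
    cells t a r u (w ∷ ws) near r< | no r′≮
      with cells t w 0 w ws (≤-reflexive (d-refl w)) (m^n>0 2 t)
    ... | ks , _ , cov , bound =
      ball t a ++ ks , ∈-++⁺ˡ ,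
      (λ { (here refl) → ∈-++⁺ˡ (ball-covers t (≤-<-trans near r<)) ; (there v∈) → ∈-++⁺ʳ (ball t a) (cov v∈) }) ,
      (begin
        length (ball t a ++ ks) * 2 ^ t                          ≡⟨ cong (_* 2 ^ t) (length-++ (ball t a)) ⟩
        (length (ball t a) + length ks) * 2 ^ t                  ≡⟨ cong (λ l → (l + length ks) * 2 ^ t) (ball-size t a) ⟩
        (9 + length ks) * 2 ^ t                                  ≡⟨ *-distribʳ-+ (2 ^ t) 9 (length ks) ⟩
        9 * 2 ^ t + length ks * 2 ^ t                            ≤⟨ +-monoʳ-≤ (9 * 2 ^ t) bound ⟩
        -- The walk since the old anchor has length at least 2^t, which pays for the nine keys of
        -- the old ball.
        9 * 2 ^ t + 9 * (2 ^ t + pathFrom w ws)                  ≤⟨ +-monoˡ-≤ _ (*-monoʳ-≤ 9 (≮⇒≥ r′≮)) ⟩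
        9 * (r + d u w) + 9 * (2 ^ t + pathFrom w ws)            ≡⟨ lemma r (d u w) (2 ^ t) (pathFrom w ws) ⟩
        9 * (2 ^ t + (r + (d u w + pathFrom w ws)))              ∎)
      where
      open ≤-Reasoning
      lemma : ∀ r x s p → 9 * (r + x) + 9 * (s + p) ≡ 9 * (s + (r + (x + p)))
      lemma = solve-∀

    -- A number instead of a proposition, so that departures from cells of level t can be summed
    -- along a path.
    δ : ℕ → A → A → ℕ
    δ t x y = if does (key t x ≟ key t y) then 0 else 1

    δ-≡ : ∀ {t x y} → key t x ≡ key t y → δ t x y ≡ 0
    δ-≡ {t} {x} {y} eq rewrite dec-true (key t x ≟ key t y) eq = refl

    δ-≢ : ∀ {t x y} → key t x ≢ key t y → δ t x y ≡ 1
    δ-≢ {t} {x} {y} neq rewrite dec-false (key t x ≟ key t y) neq = refl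

    changes : ℕ → A → List A → ℕ
    changes t x []       = 0
    changes t x (y ∷ ys) = δ t x y + changes t y ys

    Sorted : List A → Set
    Sorted = Linked (λ a b → key 0 a ≤ key 0 b)

    -- Along a sorted path the keys of every level are nondecreasing, so each change of key meets a
    -- key not seen before. This is the interval property of the cells: a path never comes back to
    -- one it has left.
    distinct-keys : ∀ t x ys → Sorted (x ∷ ys) →
      ∃[ ks ] Unique ks × All (key t x ≤_) ks × length ks ≡ suc (changes t x ys)
            × (∀ {k} → k ∈ ks → ∃[ a ] a ∈ x ∷ ys × k ≡ key t a)
    distinct-keys t x [] _ =
      key t x ∷ [] , [] ∷ [] , ≤-refl ∷ [] , refl , λ { (here refl) → x , here refl , refl }
    distinct-keys t x (y ∷ ys) (x≤y ∷ s) with distinct-keys t y ys s | key t x ≟ key t y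
    ... | ks , u , lo , l , src | yes eq =
      ks , u , All.map (≤-trans (≤-reflexive eq)) lo , trans l (cong (λ z → suc (z + changes t y ys)) (sym (δ-≡ {t} eq))) , λ k∈ → let a , a∈ , e = src k∈ in a , there a∈ , e
    ... | ks , u , lo , l , src | no neq =
      key t x ∷ ks , All.map (<⇒≢ ∘ <-≤-trans lt) lo ∷ u , ≤-refl ∷ All.map (≤-trans (<⇒≤ lt)) lo ,
      cong suc (trans l (cong (_+ changes t y ys) (sym (δ-≢ {t} neq)))) ,
      λ { (here refl) → x , here refl , refl ; (there k∈) → let a , a∈ , e = src k∈ in a , there a∈ , e }
      where
      lt : key t x < key t y
      lt = ≤∧≢⇒< (key-mono t x≤y) neq

    -- A sum over the levels t from a to a + m - 1. The weight 4 · 2^t bounds the diameter of a cell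
    -- of level t + 1, hence the length of a step for which t is the largest level at which it
    -- changes cells.
    weighted : ℕ → ℕ → (ℕ → ℕ) → ℕ
    weighted a zero    f = 0
    weighted a (suc m) f = weighted a m f + 4 * 2 ^ (a + m) * f (a + m)

    weighted-+ : ∀ a m f g → weighted a m (λ t → f t + g t) ≡ weighted a m f + weighted a m g
    weighted-+ a zero    f g = refl
    weighted-+ a (suc m) f g rewrite weighted-+ a m f g =
      lemma (weighted a m f) (weighted a m g) (4 * 2 ^ (a + m)) (f (a + m)) (g (a + m))
      where
      lemma : ∀ u v c x y → u + v + c * (x + y) ≡ u + c * x + (v + c * y)
      lemma = solve-∀

    -- The diameter bound of `key-close`. Subtracting 2 makes it vanish at level 0, where all points
    -- of a cell are at distance 0.
    base : ℕ → ℕ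
    base a = 2 * 2 ^ a ∸ 2

    -- Descending from a common cell, either some level is the largest one separating the points,
    -- and its weight pays for the distance, or the points still share a cell of level a.
    same-cell : ∀ a m {x y} → key (a + m) x ≡ key (a + m) y → d x y ≤ base a + weighted a m (λ t → δ t x y)
    same-cell a zero {x} {y} eq rewrite +-identityʳ a =
      ≤-trans (m+n≤o⇒m≤o∸n (d x y) (key-close a eq)) (m≤m+n (base a) 0)
    same-cell a (suc m) {x} {y} eq with key (a + m) x ≟ key (a + m) y
    ... | yes eq′ = ≤-trans (same-cell a m eq′) (+-monoʳ-≤ (base a) (m≤m+n _ _))
    ... | no neq  = begin
      d x y                       ≤⟨ m+n≤o⇒m≤o (d x y) (key-close (a + suc m) eq) ⟩
      2 * 2 ^ (a + suc m)         ≡⟨ cong (λ z → 2 * 2 ^ z) (+-suc a m) ⟩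
      2 * (2 * 2 ^ (a + m))       ≡⟨ lemma (2 ^ (a + m)) ⟩
      4 * 2 ^ (a + m) * 1         ≡⟨ cong (4 * 2 ^ (a + m) *_) (δ-≢ {a + m} neq) ⟨
      4 * 2 ^ (a + m) * δ (a + m) x y   ≤⟨ m≤n+m _ (weighted a m (λ t → δ t x y)) ⟩
      weighted a m (λ t → δ t x y) + 4 * 2 ^ (a + m) * δ (a + m) x y   ≤⟨ m≤n+m _ (base a) ⟩
      base a + (weighted a m (λ t → δ t x y) + 4 * 2 ^ (a + m) * δ (a + m) x y)   ∎
      where
      open ≤-Reasoning
      lemma : ∀ z → 2 * (2 * z) ≡ 4 * z * 1
      lemma = solve-∀

    -- A step that leaves even its cell of the top level a + m is charged the crude bound W. Such
    -- steps are few, since the top cells will be about as large as the whole walk.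
    step-bound : ∀ a m W {x y} → d x y ≤ W →
      d x y ≤ base a + weighted a m (λ t → δ t x y) + W * δ (a + m) x y
    step-bound a m W {x} {y} d≤W with key (a + m) x ≟ key (a + m) y
    ... | yes eq = ≤-trans (same-cell a m eq) (m≤m+n _ _)
    ... | no neq = ≤-trans d≤W (≤-trans (≤-reflexive (sym (trans (cong (W *_) (δ-≢ {a + m} neq)) (*-identityʳ W)))) (m≤n+m _ _))

    path-bound : ∀ a m W x ys → (∀ {u v} → u ∈ x ∷ ys → v ∈ x ∷ ys → d u v ≤ W) →
      pathFrom x ys ≤ length ys * base a + weighted a m (λ t → changes t x ys) + W * changes (a + m) x ys
    path-bound a m W x []       near = z≤n
    path-bound a m W x (y ∷ ys) near = begin
      d x y + pathFrom y ys
        ≤⟨ +-mono-≤ (step-bound a m W (near (here refl) (there (here refl))))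
                    (path-bound a m W y ys (λ u∈ v∈ → near (there u∈) (there v∈))) ⟩
      base a + weighted a m (λ t → δ t x y) + W * δ (a + m) x y
        + (length ys * base a + weighted a m (λ t → changes t y ys) + W * changes (a + m) y ys)
        ≡⟨ lemma (base a) (weighted a m (λ t → δ t x y)) W (δ (a + m) x y) (length ys * base a) _ _ ⟩
      base a + length ys * base a + (weighted a m (λ t → δ t x y) + weighted a m (λ t → changes t y ys))
        + W * (δ (a + m) x y + changes (a + m) y ys)
        ≡⟨ cong (λ z → base a + length ys * base a + z + W * (δ (a + m) x y + changes (a + m) y ys))
             (weighted-+ a m (λ t → δ t x y) (λ t → changes t y ys)) ⟨
      length (y ∷ ys) * base a + weighted a m (λ t → changes t x (y ∷ ys)) + W * changes (a + m) x (y ∷ ys) ∎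
      where
      open ≤-Reasoning
      lemma : ∀ b p W e l q c → b + p + W * e + (l + q + W * c) ≡ b + l + (p + q) + W * (e + c)
      lemma = solve-∀

    from-start : ∀ {v} u us → v ∈ u ∷ us → d u v ≤ pathFrom u us
    from-start u us       (here refl) = ≤-trans (≤-reflexive (d-refl u)) z≤n
    from-start u (w ∷ us) (there v∈)  = ≤-trans (d-triangle u w _) (+-monoʳ-≤ (d u w) (from-start w us v∈))

    on-walk : ∀ u us {v w} → v ∈ u ∷ us → w ∈ u ∷ us → d v w ≤ pathFrom u us
    on-walk u us       (here refl) w∈          = from-start u us w∈
    on-walk u us       v∈@(there _) (here refl) = ≤-trans (≤-reflexive (d-sym _ u)) (from-start u us v∈)
    on-walk u (x ∷ us) (there v∈)  (there w∈)  = ≤-trans (on-walk x us v∈ w∈) (m≤n+m _ (d u x))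

    -- Supplies the top level p of the hierarchy, with W ≤ 2^p ≤ 2 W for the length W of the walk.
    power-near : ∀ n → ∃[ l ] suc n ≤ 2 ^ l × 2 ^ l ≤ 2 * suc n
    power-near zero = 0 , ≤-refl , s≤s z≤n
    power-near (suc n) with power-near n
    ... | l , lo , hi with suc (suc n) ≤? 2 ^ l
    ...   | yes lo′ = l , lo′ , ≤-trans hi (*-monoʳ-≤ 2 (n≤1+n (suc n)))
    ...   | no lo′≰ = suc l , ≤-trans (+-mono-≤ (s≤s (z≤n {n})) lo) (≤-trans (+-monoˡ-≤ _ lo) (≤-reflexive (cong (2 ^ l +_) (sym (+-identityʳ (2 ^ l)))))) ,
      *-monoʳ-≤ 2 (<⇒≤ (≰⇒> lo′≰))

    module Bound (u : A) (us : List A) where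

      W : ℕ
      W = pathFrom u us

      -- The path has one more distinct key than it has changes, and all these keys occur on the
      -- walk, which meets at most 9 (1 + W / 2^t) cells. Cancelling one 2^t leaves 8 · 2^t + 9 W,
      -- which is at most 25 W because 2^t ≤ 2 W.
      changes-bound : ∀ t x ys → Sorted (x ∷ ys) → x ∷ ys ⊆ u ∷ us → 2 ^ t ≤ 2 * W →
        2 ^ t * changes t x ys ≤ 25 * W
      changes-bound t x ys sorted sub s≤2W
        with distinct-keys t x ys sorted | cells t u 0 u us (≤-reflexive (d-refl u)) (m^n>0 2 t)
      ... | ks , uniq , _ , l , src | ks′ , _ , cov , bound = +-cancelˡ-≤ (2 ^ t) _ _ (begin
        2 ^ t + 2 ^ t * changes t x ys     ≡⟨ lemma (2 ^ t) (changes t x ys) ⟩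
        suc (changes t x ys) * 2 ^ t       ≡⟨ cong (_* 2 ^ t) l ⟨
        length ks * 2 ^ t                  ≤⟨ *-monoˡ-≤ (2 ^ t) (unique-⊆⇒length≤ uniq ks⊆ks′) ⟩
        length ks′ * 2 ^ t                 ≤⟨ bound ⟩
        9 * (2 ^ t + W)                    ≡⟨ lemma₂ (2 ^ t) W ⟩
        2 ^ t + (8 * 2 ^ t + 9 * W)        ≤⟨ +-monoʳ-≤ (2 ^ t) (+-monoˡ-≤ (9 * W) (*-monoʳ-≤ 8 s≤2W)) ⟩
        2 ^ t + (8 * (2 * W) + 9 * W)      ≡⟨ cong (2 ^ t +_) (lemma₃ W) ⟩
        2 ^ t + 25 * W                     ∎)
        where
        open ≤-Reasoning
        lemma : ∀ s c → s + s * c ≡ suc c * s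
        lemma = solve-∀
        lemma₂ : ∀ s w → 9 * (s + w) ≡ s + (8 * s + 9 * w)
        lemma₂ = solve-∀
        lemma₃ : ∀ w → 8 * (2 * w) + 9 * w ≡ 25 * w
        lemma₃ = solve-∀
        ks⊆ks′ : ks ⊆ ks′
        ks⊆ks′ k∈ with src k∈
        ... | a , a∈ , refl = cov (sub a∈)

      -- Each level contributes at most 4 · 25 W: the factor 4 of its weight times the bound on its
      -- changes.
      weighted-bound : ∀ a m x ys → Sorted (x ∷ ys) → x ∷ ys ⊆ u ∷ us → 2 ^ (a + m) ≤ 2 * W →
        weighted a m (λ t → changes t x ys) ≤ 100 * m * W
      weighted-bound a zero    x ys sorted sub s≤ = z≤n
      weighted-bound a (suc m) x ys sorted sub s≤ = begin
        weighted a m (λ t → changes t x ys) + 4 * 2 ^ (a + m) * changes (a + m) x ys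
          ≤⟨ +-mono-≤ (weighted-bound a m x ys sorted sub s≤′)
               (≤-trans (≤-reflexive (*-assoc 4 (2 ^ (a + m)) _)) (*-monoʳ-≤ 4 (changes-bound (a + m) x ys sorted sub s≤′))) ⟩
        100 * m * W + 4 * (25 * W)                     ≡⟨ lemma m W ⟩
        100 * suc m * W                                ∎
        where
        open ≤-Reasoning
        lemma : ∀ m w → 100 * m * w + 4 * (25 * w) ≡ 100 * suc m * w
        lemma = solve-∀
        s≤′ : 2 ^ (a + m) ≤ 2 * W
        s≤′ = ≤-trans (^-monoʳ-≤ 2 (+-monoʳ-≤ a (n≤1+n m))) s≤

      -- The lowest level is p - m, cut off at 0. If p ≤ m, the steps inside its cells cost nothing
      -- because `base 0` is 0. Otherwise at most 2^m steps of length at most 2 · 2^(p - m) cost 2 ·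
      -- 2^p ≤ 4 L together.
      levels : ∀ {m p L} n → n ≤ 2 ^ m → 2 ^ p ≤ 2 * L → ∃[ a ] ∃[ q ] a + q ≡ p × q ≤ m × n * base a ≤ 4 * L
      levels {m} {p} {L} n n≤ p≤ with ≤-total p m
      ... | inj₁ p≤m = 0 , p , refl , p≤m , ≤-trans (≤-reflexive (*-zeroʳ n)) z≤n
      ... | inj₂ m≤p = p ∸ m , m , m∸n+n≡m m≤p , ≤-refl , (begin
        n * base (p ∸ m)                 ≤⟨ *-mono-≤ n≤ (m∸n≤m _ 2) ⟩
        2 ^ m * (2 * 2 ^ (p ∸ m))        ≡⟨ lemma (2 ^ m) (2 ^ (p ∸ m)) ⟩
        2 * (2 ^ m * 2 ^ (p ∸ m))        ≡⟨ cong (2 *_) (^-distribˡ-+-* 2 m (p ∸ m)) ⟨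
        2 * 2 ^ (m + (p ∸ m))            ≡⟨ cong (λ z → 2 * 2 ^ z) (m+[n∸m]≡n m≤p) ⟩
        2 * 2 ^ p                        ≤⟨ *-monoʳ-≤ 2 p≤ ⟩
        2 * (2 * L)                      ≡⟨ *-assoc 2 2 L ⟨
        4 * L                            ∎)
        where
        open ≤-Reasoning
        lemma : ∀ a b → a * (2 * b) ≡ 2 * (a * b)
        lemma = solve-∀

      -- Steps inside the smallest cells contribute 4 W, each of at most m intermediate levels 100
      -- W, and the top level 25 W because there W ≤ 2^p. Hence 29 + 100 m.
      sorted-path-bound : ∀ m x ys → Sorted (x ∷ ys) → x ∷ ys ⊆ u ∷ us → length ys ≤ 2 ^ m →
        pathFrom x ys ≤ (29 + 100 * m) * W
      sorted-path-bound m x ys sorted sub n≤ with W in eqW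
      -- For W = 0 no level satisfies 2^p ≤ 2 W. All distances on the path are 0 then, and level 0
      -- alone gives the bound 0.
      ... | zero  = ≤-trans (path-bound 0 0 0 x ys (λ p q → subst (_ ≤_) eqW (on-walk u us (sub p) (sub q))))
                      (≤-reflexive (lemma (length ys) (29 + 100 * m)))
        where
        lemma : ∀ l c → l * 0 + 0 + 0 ≡ c * 0
        lemma = solve-∀
      ... | suc w with power-near w
      ...   | p , lo , hi with levels {m} {p} {suc w} (length ys) n≤ hi
      ...     | a , q , refl , q≤m , small = begin
        pathFrom x ys
          ≤⟨ path-bound a q W x ys (λ p q → on-walk u us (sub p) (sub q)) ⟩
        length ys * base a + weighted a q (λ t → changes t x ys) + W * changes (a + q) x ys
          ≤⟨ +-mono-≤ (+-mono-≤ (subst (λ z → length ys * base a ≤ 4 * z) (sym eqW) small)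
                                (weighted-bound a q x ys sorted sub hi′))
               (≤-trans (*-monoˡ-≤ (changes (a + q) x ys) (subst (_≤ 2 ^ (a + q)) (sym eqW) lo))
                        (changes-bound (a + q) x ys sorted sub hi′)) ⟩
        4 * W + 100 * q * W + 25 * W
          ≤⟨ +-monoˡ-≤ (25 * W) (+-monoʳ-≤ (4 * W) (*-monoˡ-≤ W (*-monoʳ-≤ 100 q≤m))) ⟩
        4 * W + 100 * m * W + 25 * W
          ≡⟨ lemma m W ⟩
        (29 + 100 * m) * W
          ≡⟨ cong ((29 + 100 * m) *_) eqW ⟩
        (29 + 100 * m) * suc w ∎
        where
        open ≤-Reasoning
        hi′ : 2 ^ (a + q) ≤ 2 * W
        hi′ = subst (λ z → 2 ^ (a + q) ≤ 2 * z) (sym eqW) hi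
        lemma : ∀ m w → 4 * w + 100 * m * w + 25 * w ≡ (29 + 100 * m) * w
        lemma = solve-∀

-- Z-order cells as a hierarchy of partitions

module Morton where

  open Walks using (Hierarchy)
  open import Data.List.Base using (List; []; _∷_; cartesianProductWith)
  open import Data.List.Membership.Propositional using (_∈_)
  open import Data.List.Membership.Propositional.Properties using (∈-cartesianProductWith⁺)
  open import Data.List.Relation.Unary.Any using (here; there)
  open import Data.Nat.Base

  odd : ℕ → ℕ
  odd zero          = 0
  odd (suc zero)    = 1
  odd (suc (suc n)) = odd n

  odd≤1 : ∀ n → odd n ≤ 1
  odd≤1 zero          = z≤n
  odd≤1 (suc zero)    = ≤-refl
  odd≤1 (suc (suc n)) = odd≤1 n

  odd+2half : ∀ n → n ≡ odd n + 2 * ⌊ n /2⌋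
  odd+2half zero          = refl
  odd+2half (suc zero)    = refl
  odd+2half (suc (suc n)) = trans (cong (2 +_) (odd+2half n)) (lemma (odd n) ⌊ n /2⌋)
    where
    lemma : ∀ a h → 2 + (a + 2 * h) ≡ a + 2 * suc h
    lemma = solve-∀

  -- Quotient and remainder of y by 2^t. Defining them through halving and parity exposes one bit
  -- per level, both in the recursion of the code and in the loops of the program.
  hi lo : ℕ → ℕ → ℕ
  hi zero    y = y
  hi (suc t) y = ⌊ hi t y /2⌋
  lo zero    y = 0
  lo (suc t) y = lo t y + 2 ^ t * odd (hi t y)

  hi-step : ∀ t y → hi t y ≡ odd (hi t y) + 2 * hi (suc t) y
  hi-step t y = odd+2half (hi t y)

  lo+hi : ∀ t y → y ≡ lo t y + 2 ^ t * hi t y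
  lo+hi zero    y = sym (+-identityʳ y)
  lo+hi (suc t) y = trans (lo+hi t y) (trans (cong (λ h → lo t y + 2 ^ t * h) (hi-step t y))
    (lemma (lo t y) (2 ^ t) (odd (hi t y)) (hi (suc t) y)))
    where
    lemma : ∀ l p a h → l + p * (a + 2 * h) ≡ l + p * a + 2 * p * h
    lemma = solve-∀

  lo<2^ : ∀ t y → lo t y < 2 ^ t
  lo<2^ zero    y = s≤s z≤n
  lo<2^ (suc t) y = +-mono-<-≤ (lo<2^ t y)
    (≤-trans (*-monoʳ-≤ (2 ^ t) (odd≤1 (hi t y))) (≤-reflexive (*-comm (2 ^ t) 1)))

  hi-upper : ∀ t y → 2 ^ t * hi t y ≤ y
  hi-upper t y = ≤-trans (m≤n+m _ (lo t y)) (≤-reflexive (sym (lo+hi t y)))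

  hi-lower : ∀ t y → y < 2 ^ t * suc (hi t y)
  hi-lower t y = begin-strict
    y                             ≡⟨ lo+hi t y ⟩
    lo t y + 2 ^ t * hi t y       <⟨ +-monoˡ-< _ (lo<2^ t y) ⟩
    2 ^ t + 2 ^ t * hi t y        ≡⟨ *-suc (2 ^ t) (hi t y) ⟨
    2 ^ t * suc (hi t y)          ∎
    where open ≤-Reasoning

  hi-bound : ∀ {B} t y → y < 2 ^ B → hi t y < 2 ^ (B ∸ t)
  hi-bound {B} t y y< = *-cancelˡ-< (2 ^ t) _ _ (begin-strict
    2 ^ t * hi t y           ≤⟨ hi-upper t y ⟩
    y                        <⟨ y< ⟩
    2 ^ B                    ≤⟨ ^-monoʳ-≤ 2 (m≤n+m∸n B t) ⟩
    2 ^ (t + (B ∸ t))        ≡⟨ ^-distribˡ-+-* 2 t (B ∸ t) ⟩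
    2 ^ t * 2 ^ (B ∸ t)      ∎)
    where open ≤-Reasoning

  lo-full : ∀ {B} y → y < 2 ^ B → lo B y ≡ y
  lo-full {B} y y< = sym (trans (lo+hi B y) (trans (cong (λ h → lo B y + 2 ^ B * h) hi≡0)
    (trans (cong (lo B y +_) (*-zeroʳ (2 ^ B))) (+-identityʳ _))))
    where
    hi≡0 : hi B y ≡ 0
    hi≡0 = n<1⇒n≡0 (subst (λ z → hi B y < 2 ^ z) (n∸n≡0 B) (hi-bound B y y<))

  -- Morton code (Z-order) of the f lowest bits of x and y.

  morton : ℕ → ℕ → ℕ → ℕ
  morton zero    x y = 0
  morton (suc f) x y = 4 * morton f ⌊ x /2⌋ ⌊ y /2⌋ + (2 * odd x + odd y)

  digit<4 : ∀ x y → 2 * odd x + odd y < 4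
  digit<4 x y = s≤s (+-mono-≤ (*-monoʳ-≤ 2 (odd≤1 x)) (odd≤1 y))

  -- A last digit below b cannot make up for a smaller leading part. Used in base 4 for codes of
  -- successive levels and in base n for labels.
  quotient-≤ : ∀ b {p q d e} → e < b → b * p + d ≤ b * q + e → p ≤ q
  quotient-≤ b {p} {q} {d} {e} e<b le = ≮⇒≥ λ q<p → <-irrefl refl (begin-strict
    b * q + e      <⟨ +-monoʳ-< (b * q) e<b ⟩
    b * q + b      ≡⟨ trans (+-comm (b * q) b) (sym (*-suc b q)) ⟩
    b * suc q      ≤⟨ *-monoʳ-≤ b q<p ⟩
    b * p          ≤⟨ m≤m+n (b * p) d ⟩
    b * p + d      ≤⟨ le ⟩
    b * q + e      ∎)
    where open ≤-Reasoning

  quotient-remainder : ∀ b {p q d e} → d < b → e < b → b * p + d ≡ b * q + e → p ≡ q × d ≡ e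
  quotient-remainder b {p} {q} {d} {e} d<b e<b eq
    with ≤-antisym (quotient-≤ b {d = d} e<b (≤-reflexive eq)) (quotient-≤ b {d = e} d<b (≤-reflexive (sym eq)))
  ... | refl = refl , +-cancelˡ-≡ (b * p) d e eq

  morton-injective : ∀ f {x y x′ y′} → x < 2 ^ f → y < 2 ^ f → x′ < 2 ^ f → y′ < 2 ^ f →
    morton f x y ≡ morton f x′ y′ → x ≡ x′ × y ≡ y′
  morton-injective zero    (s≤s z≤n) (s≤s z≤n) (s≤s z≤n) (s≤s z≤n) eq = refl , refl
  morton-injective (suc f) {x} {y} {x′} {y′} x< y< x′< y′< eq
    with quotient-remainder 4 (digit<4 x y) (digit<4 x′ y′) eq
  ... | eq₁ , eq₂
    with morton-injective f (half< x<) (half< y<) (half< x′<) (half< y′<) eq₁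
       | quotient-remainder 2 {odd x} {odd x′} (s≤s (odd≤1 y)) (s≤s (odd≤1 y′)) eq₂
    where
    half< : ∀ {z} → z < 2 ^ suc f → ⌊ z /2⌋ < 2 ^ f
    half< {z} z< = *-cancelˡ-< 2 _ _ (≤-<-trans (≤-trans (m≤n+m _ (odd z)) (≤-reflexive (sym (odd+2half z)))) z<)
  ... | hx , hy | ox , oy =
    trans (odd+2half x) (trans (cong₂ (λ a b → a + 2 * b) ox hx) (sym (odd+2half x′))) ,
    trans (odd+2half y) (trans (cong₂ (λ a b → a + 2 * b) oy hy) (sym (odd+2half y′)))

  diff<2^ : ∀ t {x y} → hi t x ≡ hi t y → ∣ x - y ∣ < 2 ^ t
  diff<2^ t {x} {y} eq = subst (_< 2 ^ t)
    (trans (sym (∣m+n-m+o∣≡∣n-o∣ (2 ^ t * hi t x) (lo t x) (lo t y))) (cong₂ ∣_-_∣ (split x refl) (split y eq)))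
    (≤-<-trans (∣m-n∣≤m⊔n (lo t x) (lo t y)) (⊔-lub (lo<2^ t x) (lo<2^ t y)))
    where
    split : ∀ z → hi t x ≡ hi t z → 2 ^ t * hi t x + lo t z ≡ z
    split z e = trans (+-comm _ (lo t z)) (trans (cong (λ h → lo t z + 2 ^ t * h) e) (sym (lo+hi t z)))

  -- A move by less than 2^t crosses at most one multiple of 2^t upwards.
  adjacent-hi : ∀ t {x y} → ∣ x - y ∣ < 2 ^ t → hi t y ≤ suc (hi t x)
  adjacent-hi t {x} {y} near = s≤s⁻¹ (*-cancelˡ-< (2 ^ t) _ _ (begin-strict
    2 ^ t * hi t y                     ≤⟨ hi-upper t y ⟩
    y                                  ≤⟨ m≤n+∣m-n∣ y x ⟩
    x + ∣ y - x ∣                      ≡⟨ cong (x +_) (∣-∣-comm y x) ⟩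
    x + ∣ x - y ∣                      <⟨ +-mono-< (hi-lower t x) near ⟩
    2 ^ t * suc (hi t x) + 2 ^ t       ≡⟨ trans (+-comm _ (2 ^ t)) (sym (*-suc (2 ^ t) _)) ⟩
    2 ^ t * suc (suc (hi t x))         ∎))
    where open ≤-Reasoning

  -- For h = 0 the truncated entry h ∸ 1 repeats 0. The repetition is harmless and keeps the length
  -- at three, so that every ball lists exactly nine keys.
  neighbours : ℕ → List ℕ
  neighbours h = (h ∸ 1) ∷ h ∷ suc h ∷ []

  ∈-neighbours : ∀ {h k} → k ≤ suc h → h ≤ suc k → k ∈ neighbours h
  ∈-neighbours {h} {k} k≤ h≤ with k ≟ h | k ≟ suc h
  ... | yes refl | _        = there (here refl)
  ... | no _     | yes refl = there (there (here refl))
  ... | no k≢h   | no k≢1+h = here (≤-antisym (m+n≤o⇒m≤o∸n k (subst (_≤ h) (+-comm 1 k) (≤∧≢⇒< (s≤s⁻¹ (≤∧≢⇒< k≤ k≢1+h)) k≢h)))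
                                (∸-monoˡ-≤ 1 h≤))

  suc-∸ : ∀ {t B} → t < B → suc (B ∸ suc t) ≡ B ∸ t
  suc-∸ {zero}  {suc B} _         = refl
  suc-∸ {suc t} {suc B} (s≤s t<B) = suc-∸ t<B

  module _ {A : Set} (X Y : A → ℕ) (B : ℕ) (X< : ∀ a → X a < 2 ^ B) (Y< : ∀ a → Y a < 2 ^ B) where

    private
      -- Dropping the t lowest bits of both coordinates drops the last t base-4 digits of the
      -- Z-order code, so each cell is an interval of the curve.
      key : ℕ → A → ℕ
      key t a = morton (B ∸ t) (hi t (X a)) (hi t (Y a))

      d : A → A → ℕ
      d a b = ∣ X a - X b ∣ + ∣ Y a - Y b ∣

      -- Below level B the code of level t is four times that of level `suc t` plus a digit, and
      -- comparing such numbers compares their quotients. From level B on, the next code is 0.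
      key-refines : ∀ t {a b} → key t a ≤ key t b → key (suc t) a ≤ key (suc t) b
      key-refines t {a} {b} le with t <? B
      ... | no t≮B rewrite m≤n⇒m∸n≡0 (m≤n⇒m≤1+n (≮⇒≥ t≮B)) = z≤n
      ... | yes t<B rewrite sym (suc-∸ t<B) = quotient-≤ 4 (digit<4 (hi t (X b)) (hi t (Y b))) le

      key-mono : ∀ t {a b} → key 0 a ≤ key 0 b → key t a ≤ key t b
      key-mono zero    le = le
      key-mono (suc t) le = key-refines t (key-mono t le)

      -- Coordinates are below 2^B, so equal codes mean equal high parts. Each coordinate then
      -- differs by less than 2^t, and the two strict inequalities provide the summand 2.
      key-close : ∀ t {a b} → key t a ≡ key t b → d a b + 2 ≤ 2 * 2 ^ t
      key-close t {a} {b} eq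
        with morton-injective (B ∸ t) (hi-bound t _ (X< a)) (hi-bound t _ (Y< a)) (hi-bound t _ (X< b)) (hi-bound t _ (Y< b)) eq
      ... | ex , ey = subst₂ _≤_ (lemma ∣ X a - X b ∣ ∣ Y a - Y b ∣) (cong (2 ^ t +_) (sym (+-identityʳ (2 ^ t))))
        (+-mono-≤ (diff<2^ t ex) (diff<2^ t ey))
        where
        lemma : ∀ x y → suc x + suc y ≡ x + y + 2
        lemma = solve-∀

      ball : ℕ → A → List ℕ
      ball t a = cartesianProductWith (morton (B ∸ t)) (neighbours (hi t (X a))) (neighbours (hi t (Y a)))

      ∈-neighbours-hi : ∀ t {x y} → ∣ x - y ∣ < 2 ^ t → hi t y ∈ neighbours (hi t x)
      ∈-neighbours-hi t {x} {y} near =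
        ∈-neighbours (adjacent-hi t near) (adjacent-hi t (subst (_< 2 ^ t) (∣-∣-comm x y) near))

      ball-covers : ∀ t {a b} → d a b < 2 ^ t → key t b ∈ ball t a
      ball-covers t {a} {b} near = ∈-cartesianProductWith⁺ (morton (B ∸ t))
        (∈-neighbours-hi t (≤-<-trans (m≤m+n _ _) near))
        (∈-neighbours-hi t (≤-<-trans (m≤n+m _ _) near))

      d-triangle : ∀ a b c → d a c ≤ d a b + d b c
      d-triangle a b c = ≤-trans
        (+-mono-≤ (∣-∣-triangle (X a) (X b) (X c)) (∣-∣-triangle (Y a) (Y b) (Y c)))
        (≤-reflexive (lemma ∣ X a - X b ∣ ∣ X b - X c ∣ ∣ Y a - Y b ∣ ∣ Y b - Y c ∣))
        where
        lemma : ∀ p q r s → p + q + (r + s) ≡ p + r + (q + s)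
        lemma = solve-∀

    mortonHierarchy : Hierarchy A
    mortonHierarchy = record
      { d           = d
      ; d-refl      = λ a → cong₂ _+_ (∣n-n∣≡0 (X a)) (∣n-n∣≡0 (Y a))
      ; d-sym       = λ a b → cong₂ _+_ (∣-∣-comm (X a) (X b)) (∣-∣-comm (Y a) (Y b))
      ; d-triangle  = d-triangle
      ; key         = key
      ; key-mono    = key-mono
      ; key-close   = key-close
      ; ball        = ball
      ; ball-size   = λ _ _ → refl
      ; ball-covers = ball-covers
      }

-- Dynamic programming for cheapest paths

module PathTree where

  open Compiler using (foldn)
  open Walks
  open Morton using (suc-∸)
  open import Defs using (Graph; Adjacent; HasCycle; IsTree; vertices; edges)
  open import Data.Fin.Base as Fin using (Fin; toℕ)
  open import Data.Fin.Subset as Subset using (Subset; ∣_∣)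
  open import Data.Fin.Subset.Properties using (x∈p⇒∣p-x∣<∣p∣; x∈p∧x≢y⇒x∈p-y)
  open import Data.List.Base using (List; []; _∷_; _∷ʳ_; length)
  open import Data.List.Membership.Propositional using (_∈_)
  open import Data.List.Membership.Propositional.Properties using (∈-++⁺ˡ; ∈-++⁺ʳ; ∈-++⁻)
  open import Data.List.Relation.Unary.All as All using (All; []; _∷_)
  import Data.List.Relation.Unary.All.Properties as All
  open import Data.List.Relation.Unary.AllPairs using ([]; _∷_)
  open import Data.List.Relation.Unary.Any using (here)
  open import Data.List.Relation.Unary.Linked using (Linked; []; _∷_)
  open import Data.List.Relation.Unary.Unique.Propositional using (Unique)
  import Data.List.Relation.Unary.Unique.Propositional.Properties as Unique
  open import Data.Nat.Base
  open import Data.Vec.Base using (tabulate)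
  open import Data.Vec.Properties using (lookup∘tabulate; lookup⇒[]=; []=⇒lookup)
  open import Relation.Binary.Construct.Closure.ReflexiveTransitive using (Star; ε; _◅_; _◅◅_)

  sumTo : (ℕ → ℕ) → ℕ → ℕ
  sumTo f n = foldn n (λ s acc → acc + f s) 0

  sumTo-cong : ∀ {f g} n → (∀ s → s < n → f s ≡ g s) → sumTo f n ≡ sumTo g n
  sumTo-cong zero    h = refl
  sumTo-cong (suc n) h = cong₂ _+_ (sumTo-cong n (λ s s<n → h s (m<n⇒m<1+n s<n))) (h n ≤-refl)

  term≤sumTo : ∀ f {s} n → s < n → f s ≤ sumTo f n
  term≤sumTo f {s} (suc n) (s≤s s≤n) with s ≟ n
  ... | yes refl = m≤n+m (f s) (sumTo f s)
  ... | no s≢n   = ≤-trans (term≤sumTo f n (≤∧≢⇒< s≤n s≢n)) (m≤m+n (sumTo f n) (f n))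

  -- Written as the fold that the program executes, with the same strict comparison, so that ties
  -- are resolved identically. Its default on an empty range is 0.
  argmin : (ℕ → ℕ) → ℕ → ℕ
  argmin f n = foldn n (λ j b → if f j <ᵇ f b then j else b) 0

  argmin-≤ : ∀ (f : ℕ → ℕ) n {j} → j < n → f (argmin f n) ≤ f j
  argmin-≤ f (suc n) {j} (s≤s j≤n) with f n <ᵇ f (argmin f n) in eq | j ≟ n
  ... | true  | yes refl = ≤-refl
  ... | true  | no j≢n   = ≤-trans (<⇒≤ (<ᵇ⇒< (f n) (f (argmin f n)) (subst T (sym eq) _))) (argmin-≤ f n (≤∧≢⇒< j≤n j≢n))
  ... | false | yes refl = ≮⇒≥ λ lt → subst T eq (<⇒<ᵇ lt)
  ... | false | no j≢n   = argmin-≤ f n (≤∧≢⇒< j≤n j≢n)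

  argmin-≤n : ∀ (f : ℕ → ℕ) n → argmin f (suc n) ≤ n
  argmin-≤n f zero    with f 0 <ᵇ f 0
  ... | true  = ≤-refl
  ... | false = ≤-refl
  argmin-≤n f (suc n) with f (suc n) <ᵇ f (argmin f (suc n))
  ... | true  = ≤-refl
  ... | false = m≤n⇒m≤1+n (argmin-≤n f n)

  argmin-< : ∀ (f : ℕ → ℕ) {n} → 0 < n → argmin f n < n
  argmin-< f {suc n} _ = s≤s (argmin-≤n f n)

  module Cheapest (w : ℕ → ℕ → ℕ) (n m : ℕ) (0<n : 0 < n) where

    open Paths w

    -- The cheapest cost of a path with c edges that ends in i; `back c i` is the last vertex but
    -- one of such a path with `suc c` edges. Defining the cost through its minimiser ties the value
    -- to the path reconstructed from it.
    cost : ℕ → ℕ → ℕ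
    via  : ℕ → ℕ → ℕ → ℕ
    back : ℕ → ℕ → ℕ
    cost zero    i = 0
    cost (suc c) i = via c i (back c i)
    via  c i j     = cost c j + w j i
    back c i       = argmin (via c i) n

    -- Predecessors are followed from the end: entry 0 is the last vertex of the path and entry m
    -- the first, which is why labels will decrease along it.
    trace : ℕ → ℕ
    trace zero    = argmin (cost m) n
    trace (suc s) = back (m ∸ suc s) (trace s)

    trace-< : ∀ s → trace s < n
    trace-< zero    = argmin-< (cost m) 0<n
    trace-< (suc s) = argmin-< (via (m ∸ suc s) (trace s)) 0<n

    last : ℕ → List ℕ → ℕ
    last x []       = x
    last x (y ∷ ys) = last y ys

    -- Letting x already stand at the end of c edges allows the path to be consumed from the front,
    -- one minimisation per edge.
    cost-≤-path : ∀ c x ys → All (_< n) (x ∷ ys) → cost (length ys + c) (last x ys) ≤ cost c x + pathFrom x ys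
    cost-≤-path c x []       _             = m≤m+n _ 0
    cost-≤-path c x (y ∷ ys) (x<n ∷ ys<n) = begin
      cost (suc (length ys + c)) (last y ys)        ≡⟨ cong (λ l → cost l (last y ys)) (+-suc (length ys) c) ⟨
      cost (length ys + suc c) (last y ys)          ≤⟨ cost-≤-path (suc c) y ys ys<n ⟩
      cost (suc c) y + pathFrom y ys                ≤⟨ +-monoˡ-≤ _ (argmin-≤ (via c y) n x<n) ⟩
      cost c x + w x y + pathFrom y ys              ≡⟨ +-assoc (cost c x) _ _ ⟩
      cost c x + (w x y + pathFrom y ys)            ∎
      where open ≤-Reasoning

    last-All : ∀ {P : ℕ → Set} x ys → All P (x ∷ ys) → P (last x ys)
    last-All x []       (p ∷ _)  = p
    last-All x (y ∷ ys) (_ ∷ ps) = last-All y ys ps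

    -- The sum telescopes: a traced edge weighs exactly what `cost` loses in passing to the
    -- predecessor.
    trace-cost : ∀ s → s ≤ m →
      cost (m ∸ s) (trace s) + sumTo (λ u → w (trace (suc u)) (trace u)) s ≡ cost m (trace 0)
    trace-cost zero    _   = +-identityʳ _
    trace-cost (suc s) s<m = trans (lemma (cost (m ∸ suc s) (trace (suc s))) _ _)
      (trans (cong (λ c → cost c (trace s) + sumTo (λ u → w (trace (suc u)) (trace u)) s) (suc-∸ s<m))
        (trace-cost s (<⇒≤ s<m)))
      where
      lemma : ∀ a b c → a + (b + c) ≡ a + c + b
      lemma = solve-∀

    trace-optimal : ∀ x ys → length ys ≡ m → All (_< n) (x ∷ ys) →
      sumTo (λ u → w (trace (suc u)) (trace u)) m ≤ pathFrom x ys
    trace-optimal x ys refl inside = begin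
      sumTo (λ u → w (trace (suc u)) (trace u)) m
        ≡⟨ cong (λ c → cost c (trace m) + sumTo (λ u → w (trace (suc u)) (trace u)) m) (n∸n≡0 m) ⟨
      cost (m ∸ m) (trace m) + sumTo (λ u → w (trace (suc u)) (trace u)) m
        ≡⟨ trace-cost m ≤-refl ⟩
      cost m (argmin (cost m) n)
        ≤⟨ argmin-≤ (cost m) n (last-All x ys inside) ⟩
      cost m (last x ys)
        ≡⟨ cong (λ l → cost l (last x ys)) (+-identityʳ m) ⟨
      cost (m + 0) (last x ys)
        ≤⟨ cost-≤-path 0 x ys inside ⟩
      pathFrom x ys ∎
      where open ≤-Reasoning

  -- If j → i is allowed only for increasing labels, and otherwise costs more
  -- than some admissible path does in total, then the cheapest path is increasing.

  module Increasing (label : ℕ → ℕ) (d : ℕ → ℕ → ℕ) (inf : ℕ) (n m : ℕ) (0<n : 0 < n) where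

    w : ℕ → ℕ → ℕ
    w j i = if label j <ᵇ label i then d j i else inf

    open Cheapest w n m 0<n public

    w-< : ∀ {j i} → label j < label i → w j i ≡ d j i
    w-< {j} {i} lt with label j <ᵇ label i | <⇒<ᵇ lt
    ... | true | _ = refl

    w-small : ∀ {j i} → w j i < inf → label j < label i
    w-small {j} {i} small with label j <ᵇ label i in eq
    ... | true  = <ᵇ⇒< (label j) (label i) (subst T (sym eq) _)
    ... | false = contradiction small (<-irrefl refl)

    path-w : ∀ x ys → Linked (λ a b → label a < label b) (x ∷ ys) → Paths.pathFrom w x ys ≡ Paths.pathFrom d x ys
    path-w x []       _          = refl
    path-w x (y ∷ ys) (lt ∷ lts) = cong₂ _+_ (w-< lt) (path-w y ys lts)

    module _ (x : ℕ) (ys : List ℕ) (len : length ys ≡ m) (inside : All (_< n) (x ∷ ys))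
             (inc : Linked (λ a b → label a < label b) (x ∷ ys)) (cheap : Paths.pathFrom d x ys < inf) where

      total≤ : sumTo (λ u → w (trace (suc u)) (trace u)) m ≤ Paths.pathFrom d x ys
      total≤ = ≤-trans (trace-optimal x ys len inside) (≤-reflexive (path-w x ys inc))

      trace-decreasing : ∀ s → s < m → label (trace (suc s)) < label (trace s)
      trace-decreasing s s<m = w-small (≤-<-trans (≤-trans (term≤sumTo _ m s<m) total≤) cheap)

      trace-length : sumTo (λ u → d (trace (suc u)) (trace u)) m ≤ Paths.pathFrom d x ys
      trace-length = ≤-trans (≤-reflexive (sumTo-cong m (λ s s<m → sym (w-< (trace-decreasing s s<m))))) total≤

      trace-strict : ∀ {s t} → s < t → t ≤ m → label (trace t) < label (trace s)
      trace-strict {s} {suc t} (s≤s s≤t) t<m with s ≟ t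
      ... | yes refl = trace-decreasing s t<m
      ... | no s≢t   = <-trans (trace-decreasing t t<m) (trace-strict (≤∧≢⇒< s≤t s≢t) (<⇒≤ t<m))

      trace-injective : ∀ s t → s ≤ m → t ≤ m → trace s ≡ trace t → s ≡ t
      trace-injective s t s≤m t≤m eq with <-cmp s t
      ... | tri< s<t _ _ = contradiction (cong label (sym eq)) (<⇒≢ (trace-strict s<t t≤m))
      ... | tri≈ _ s≡t _ = s≡t
      ... | tri> _ _ t<s = contradiction (cong label eq) (<⇒≢ (trace-strict t<s s≤m))

  -- The traced path as a tree

  injective⇒≤∣p∣ : ∀ {n} (p : Subset n) k (f : ℕ → Fin n) → (∀ s → s < k → f s Subset.∈ p) →
    (∀ s t → s < k → t < k → f s ≡ f t → s ≡ t) → k ≤ ∣ p ∣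
  injective⇒≤∣p∣ p zero    f f∈ inj = z≤n
  injective⇒≤∣p∣ p (suc k) f f∈ inj = ≤-<-trans
    (injective⇒≤∣p∣ (p Subset.- f k) k f
      (λ s s<k → x∈p∧x≢y⇒x∈p-y (f∈ s (m<n⇒m<1+n s<k)) (λ eq → <⇒≢ s<k (inj s k (m<n⇒m<1+n s<k) ≤-refl eq)))
      (λ s t s<k t<k → inj s t (m<n⇒m<1+n s<k) (m<n⇒m<1+n t<k)))
    (x∈p⇒∣p-x∣<∣p∣ (f∈ k ≤-refl))

  module PathGraph {n} (τ : ℕ → Fin n) (m : ℕ) (τ-injective : ∀ s t → s ≤ m → t ≤ m → τ s ≡ τ t → s ≡ t) where

    visited : ℕ → Fin n → Bool
    visited k i = foldn k (λ s b → if does (toℕ (τ s) ≟ toℕ i) then true else b) false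

    visited-τ : ∀ k s → s < k → visited k (τ s) ≡ true
    visited-τ (suc k) s (s≤s s≤k) with toℕ (τ k) ≟ toℕ (τ s)
    ... | yes e rewrite dec-true (toℕ (τ k) ≟ toℕ (τ s)) e = refl
    ... | no ne rewrite dec-false (toℕ (τ k) ≟ toℕ (τ s)) ne =
      visited-τ k s (≤∧≢⇒< s≤k (λ { refl → ne refl }))

    visited⁻ : ∀ k i → visited k i ≡ true → ∃[ s ] s < k × τ s ≡ i
    visited⁻ (suc k) i v with toℕ (τ k) ≟ toℕ i
    ... | yes e = k , ≤-refl , Fin.toℕ-injective e
    ... | no ne with visited⁻ k i (trans (cong (λ b → if b then true else visited k i) (sym (dec-false (toℕ (τ k) ≟ toℕ i) ne))) v)
    ...   | s , s<k , eq = s , m<n⇒m<1+n s<k , eq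

    edge : ℕ → Fin n × Fin n
    edge s = if toℕ (τ (suc s)) <ᵇ toℕ (τ s) then (τ (suc s) , τ s) else (τ s , τ (suc s))

    edgesTo : ℕ → List (Fin n × Fin n)
    edgesTo zero    = []
    edgesTo (suc s) = edgesTo s ∷ʳ edge s

    -- A view of `edge s`: matching on it replaces case analysis on the Boolean comparison that
    -- sorts the two ends.
    data Orientation (s : ℕ) : Fin n × Fin n → Set where
      descending : toℕ (τ (suc s)) < toℕ (τ s) → Orientation s (τ (suc s) , τ s)
      ascending  : toℕ (τ s) ≤ toℕ (τ (suc s)) → Orientation s (τ s , τ (suc s))

    orientation : ∀ s → Orientation s (edge s)
    orientation s with toℕ (τ (suc s)) <ᵇ toℕ (τ s) in eq
    ... | true  = descending (<ᵇ⇒< (toℕ (τ (suc s))) (toℕ (τ s)) (subst T (sym eq) _))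
    ... | false = ascending (≮⇒≥ λ lt → subst T eq (<⇒<ᵇ lt))

    edge-<⁺ : ∀ s → s < m → proj₁ (edge s) Fin.< proj₂ (edge s)
    edge-<⁺ s s<m with edge s | orientation s
    ... | _ | descending lt = lt
    ... | _ | ascending le  = ≤∧≢⇒< le λ eq →
      1+n≢n (sym (τ-injective s (suc s) (<⇒≤ s<m) s<m (Fin.toℕ-injective eq)))

    ∈-edgesTo⁻ : ∀ l {e} → e ∈ edgesTo l → ∃[ s ] s < l × e ≡ edge s
    ∈-edgesTo⁻ (suc l) e∈ with ∈-++⁻ (edgesTo l) e∈
    ... | inj₂ (here eq) = l , ≤-refl , eq
    ... | inj₁ e∈′ with ∈-edgesTo⁻ l e∈′
    ...   | s , s<l , eq = s , m<n⇒m<1+n s<l , eq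

    ∈-edgesTo⁺ : ∀ l {s} → s < l → edge s ∈ edgesTo l
    ∈-edgesTo⁺ (suc l) {s} (s≤s s≤l) with s ≟ l
    ... | yes refl = ∈-++⁺ʳ (edgesTo l) (here refl)
    ... | no s≢l   = ∈-++⁺ˡ (∈-edgesTo⁺ l (≤∧≢⇒< s≤l s≢l))

    -- Equal pairs of the same orientation share the vertex of index s. Opposite orientations would
    -- require both s + 1 = t and s = t + 1.
    edge-injective : ∀ s t → s < m → t < m → edge s ≡ edge t → s ≡ t
    edge-injective s t s<m t<m eq with edge s | orientation s | edge t | orientation t
    edge-injective s t s<m t<m eq | _ | descending _ | _ | descending _ =
      τ-injective s t (<⇒≤ s<m) (<⇒≤ t<m) (cong proj₂ eq)
    edge-injective s t s<m t<m eq | _ | ascending _  | _ | ascending _  =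
      τ-injective s t (<⇒≤ s<m) (<⇒≤ t<m) (cong proj₁ eq)
    edge-injective s t s<m t<m eq | _ | descending _ | _ | ascending _
      with τ-injective (suc s) t s<m (<⇒≤ t<m) (cong proj₁ eq)
    ... | refl = contradiction (τ-injective s (suc (suc s)) (<⇒≤ s<m) t<m (cong proj₂ eq)) (<⇒≢ (m≤n+m (suc s) 1))
    edge-injective s t s<m t<m eq | _ | ascending _ | _ | descending _
      with τ-injective s (suc t) (<⇒≤ s<m) t<m (cong proj₁ eq)
    ... | refl = contradiction (τ-injective (suc (suc t)) t s<m (<⇒≤ t<m) (cong proj₂ eq)) (≢-sym (<⇒≢ (m≤n+m (suc t) 1)))

    edgesTo-unique : ∀ l → l ≤ m → Unique (edgesTo l)
    edgesTo-unique zero    _   = []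
    edgesTo-unique (suc l) l<m = Unique.++⁺ (edgesTo-unique l (<⇒≤ l<m)) ([] ∷ []) λ where
      (e∈ , here refl) → let s , s<l , eq = ∈-edgesTo⁻ l e∈ in
        <⇒≢ s<l (sym (edge-injective l s l<m (<-trans s<l l<m) eq))

    visitedSet : Subset n
    visitedSet = tabulate (visited (suc m))

    τ∈vertices : ∀ s → s ≤ m → τ s Subset.∈ visitedSet
    τ∈vertices s s≤m = lookup⇒[]= (τ s) _ (trans (lookup∘tabulate (visited (suc m)) (τ s)) (visited-τ (suc m) s (s≤s s≤m)))

    edge-ends : ∀ s → s < m → proj₁ (edge s) Subset.∈ visitedSet × proj₂ (edge s) Subset.∈ visitedSet
    edge-ends s s<m with edge s | orientation s
    ... | _ | descending _ = τ∈vertices (suc s) s<m , τ∈vertices s (<⇒≤ s<m)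
    ... | _ | ascending _  = τ∈vertices s (<⇒≤ s<m) , τ∈vertices (suc s) s<m

    edgesTo-All : ∀ (P : Fin n × Fin n → Set) → (∀ s → s < m → P (edge s)) → All P (edgesTo m)
    edgesTo-All P h = All.tabulate λ e∈ → let s , s<m , eq = ∈-edgesTo⁻ m e∈ in subst P (sym eq) (h s s<m)

    pathGraph : Graph n
    pathGraph = record
      { vertices = visitedSet
      ; edges    = edgesTo m
      ; ordered  = edgesTo-All _ edge-<⁺
      ; incident = edgesTo-All _ edge-ends
      ; unique   = edgesTo-unique m ≤-refl
      }

    ∈vertices⁻ : ∀ {i} → i Subset.∈ vertices pathGraph → ∃[ s ] s ≤ m × τ s ≡ i
    ∈vertices⁻ {i} i∈ with visited⁻ (suc m) i (trans (sym (lookup∘tabulate (visited (suc m)) i)) ([]=⇒lookup i∈))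
    ... | s , s≤s s≤m , eq = s , s≤m , eq

    suc-m≤∣vertices∣ : suc m ≤ ∣ vertices pathGraph ∣
    suc-m≤∣vertices∣ = injective⇒≤∣p∣ _ (suc m) τ (λ s s<m → τ∈vertices s (s≤s⁻¹ s<m))
      (λ s t s< t< → τ-injective s t (s≤s⁻¹ s<) (s≤s⁻¹ t<))

    Adj : Fin n → Fin n → Set
    Adj = Adjacent pathGraph

    adjacent : ∀ s → s < m → Adj (τ s) (τ (suc s)) × Adj (τ (suc s)) (τ s)
    adjacent s s<m with edge s | orientation s | ∈-edgesTo⁺ m s<m
    ... | _ | descending _ | e∈ = inj₂ e∈ , inj₁ e∈
    ... | _ | ascending _  | e∈ = inj₁ e∈ , inj₂ e∈

    adjacent⁻ : ∀ {i j} → Adj i j → ∃[ s ] s < m × ((i ≡ τ s × j ≡ τ (suc s)) ⊎ (i ≡ τ (suc s) × j ≡ τ s))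
    adjacent⁻ (inj₁ e∈) with ∈-edgesTo⁻ m e∈
    ... | s , s<m , eq with edge s | orientation s
    adjacent⁻ (inj₁ e∈) | s , s<m , refl | _ | descending _ = s , s<m , inj₂ (refl , refl)
    adjacent⁻ (inj₁ e∈) | s , s<m , refl | _ | ascending _  = s , s<m , inj₁ (refl , refl)
    adjacent⁻ (inj₂ e∈) with ∈-edgesTo⁻ m e∈
    ... | s , s<m , eq with edge s | orientation s
    adjacent⁻ (inj₂ e∈) | s , s<m , refl | _ | descending _ = s , s<m , inj₁ (refl , refl)
    adjacent⁻ (inj₂ e∈) | s , s<m , refl | _ | ascending _  = s , s<m , inj₂ (refl , refl)

    neighbour : ∀ {s j} → s ≤ m → Adj (τ s) j → (suc s ≤ m × j ≡ τ (suc s)) ⊎ (∃[ r ] s ≡ suc r × j ≡ τ r)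
    neighbour {s} s≤m a with adjacent⁻ a
    ... | r , r<m , inj₁ (eq , refl) with τ-injective s r s≤m (<⇒≤ r<m) eq
    ...   | refl = inj₁ (r<m , refl)
    neighbour {s} s≤m a | r , r<m , inj₂ (eq , refl) with τ-injective s (suc r) s≤m r<m eq
    ...   | refl = inj₂ (r , refl , refl)

    to-start : ∀ s → s ≤ m → Star Adj (τ s) (τ 0)
    to-start zero    _   = ε
    to-start (suc s) s<m = proj₂ (adjacent s s<m) ◅ to-start s (<⇒≤ s<m)

    from-start : ∀ s → s ≤ m → Star Adj (τ 0) (τ s)
    from-start zero    _   = ε
    from-start (suc s) s<m = from-start s (<⇒≤ s<m) ◅◅ (proj₁ (adjacent s s<m) ◅ ε)

    -- A cycle that starts in one direction along the path can never turn back.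

    no-return-up : ∀ {p s} ws → p < s → suc s ≤ m → Unique (τ s ∷ τ (suc s) ∷ ws) →
      ¬ Linked Adj (τ (suc s) ∷ ws ∷ʳ τ p)
    no-return-up {p} {s} [] p<s s<m u (a ∷ _) with neighbour s<m a
    ... | inj₁ (2+s≤m , eq) = <⇒≢ (≤-trans p<s (m≤n+m s 2)) (τ-injective p (suc (suc s)) (≤-trans (<⇒≤ p<s) (<⇒≤ s<m)) 2+s≤m eq)
    ... | inj₂ (r , refl , eq) = <⇒≢ p<s (τ-injective p r (≤-trans (<⇒≤ p<s) (<⇒≤ s<m)) (<⇒≤ s<m) eq)
    no-return-up {p} {s} (w ∷ ws) p<s s<m ((_ ∷ s≢w ∷ _) ∷ u) (a ∷ l) with neighbour s<m a
    ... | inj₁ (2+s≤m , refl)    = no-return-up ws (m<n⇒m<1+n p<s) 2+s≤m u l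
    ... | inj₂ (r , refl , refl) = s≢w refl

    no-return-down : ∀ {p s} ws → suc s < p → p ≤ m → Unique (τ (suc s) ∷ τ s ∷ ws) →
      ¬ Linked Adj (τ s ∷ ws ∷ʳ τ p)
    no-return-down {p} {s} [] s<p p≤m u (a ∷ _) with neighbour (≤-trans (<⇒≤ (<⇒≤ s<p)) p≤m) a
    ... | inj₁ (1+s≤m , eq)    = <⇒≢ s<p (sym (τ-injective p (suc s) p≤m 1+s≤m eq))
    ... | inj₂ (r , refl , eq) = <⇒≢ (≤-trans (m≤n+m (suc r) 2) s<p) (sym (τ-injective p r p≤m (≤-trans (≤-trans (m≤n+m r 3) s<p) p≤m) eq))
    no-return-down {p} {s} (w ∷ ws) s<p p≤m ((_ ∷ s≢w ∷ _) ∷ u) (a ∷ l) with neighbour (≤-trans (<⇒≤ (<⇒≤ s<p)) p≤m) a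
    ... | inj₁ (1+s≤m , refl)    = s≢w refl
    ... | inj₂ (r , refl , refl) = no-return-down ws (<⇒≤ s<p) p≤m u l

    -- The first edge of a cycle fixes a direction along the path. The second cannot step back,
    -- since the first and third vertices differ, so the walk is already moving away from its start.
    acyclic : ¬ HasCycle pathGraph
    acyclic (_ , _ , _ , ws , ((_ ∷ u≢w ∷ _) ∷ un) , a ∷ b ∷ l) with adjacent⁻ a
    ... | s , s<m , inj₁ (refl , refl) with neighbour s<m b
    ...   | inj₁ (2+s≤m , refl)    = no-return-up ws ≤-refl 2+s≤m un l
    ...   | inj₂ (r , refl , refl) = u≢w refl
    acyclic (_ , _ , _ , ws , ((_ ∷ u≢w ∷ _) ∷ un) , a ∷ b ∷ l) | s , s<m , inj₂ (refl , refl)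
      with neighbour (<⇒≤ s<m) b
    ...   | inj₁ (_ , refl)        = u≢w refl
    ...   | inj₂ (r , refl , refl) = no-return-down ws ≤-refl s<m un l

    isTree : IsTree pathGraph
    isTree = record
      { nonempty  = τ 0 , τ∈vertices 0 z≤n
      ; connected = λ i j i∈ j∈ → connect (∈vertices⁻ i∈) (∈vertices⁻ j∈)
      ; acyclic   = acyclic
      }
      where
      connect : ∀ {i j} → (∃[ s ] s ≤ m × τ s ≡ i) → (∃[ s ] s ≤ m × τ s ≡ j) → Star Adj i j
      connect (s , s≤m , refl) (t , t≤m , refl) = to-start s s≤m ◅◅ from-start t t≤m

-- From a tree on k points to a short increasing path

module Optimum where

  open Compiler using (^-distribʳ-*)
  open Walks
  open import Defs using (Graph; Connected; vertices; edges)
  open import Data.Fin.Base as Fin using (Fin; zero; suc)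
  open import Data.Fin.Subset as Subset using (Subset; ∣_∣; Nonempty)
  open import Data.List.Base using (List; []; _∷_; length; map)
  open import Data.List.Membership.Propositional using (_∈_)
  open import Data.List.Membership.Propositional.Properties using (∈-map⁻)
  open import Data.List.Properties using (length-map)
  open import Data.List.Relation.Binary.Subset.Propositional using (_⊆_)
  open import Data.List.Relation.Unary.All as All using (All; []; _∷_)
  open import Data.List.Relation.Unary.AllPairs using (AllPairs; []; _∷_)
  open import Data.List.Relation.Unary.Any using (here; there)
  open import Data.List.Relation.Unary.Linked as Linked using (Linked)
  open import Data.List.Relation.Unary.Linked.Properties using (AllPairs⇒Linked)
  open import Data.List.Relation.Unary.Unique.Propositional using (Unique)
  import Data.List.Relation.Unary.Unique.Propositional.Properties as Unique
  open import Data.Nat.Base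
  open import Data.Vec.Base using ([]; _∷_)
  open import Data.Vec.Base using (here; there)

  elements : ∀ {n} → Subset n → List (Fin n)
  elements []          = []
  elements (true ∷ p)  = zero ∷ map suc (elements p)
  elements (false ∷ p) = map suc (elements p)

  length-elements : ∀ {n} (p : Subset n) → length (elements p) ≡ ∣ p ∣
  length-elements []          = refl
  length-elements (true ∷ p)  = cong suc (trans (length-map suc (elements p)) (length-elements p))
  length-elements (false ∷ p) = trans (length-map suc (elements p)) (length-elements p)

  ∈-elements⁻ : ∀ {n} (p : Subset n) {i} → i ∈ elements p → i Subset.∈ p
  ∈-elements⁻ (true ∷ p)  (here refl) = here
  ∈-elements⁻ (true ∷ p)  (there i∈) with ∈-map⁻ suc i∈
  ... | j , j∈ , refl = there (∈-elements⁻ p j∈)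
  ∈-elements⁻ (false ∷ p) i∈ with ∈-map⁻ suc i∈
  ... | j , j∈ , refl = there (∈-elements⁻ p j∈)

  elements-unique : ∀ {n} (p : Subset n) → Unique (elements p)
  elements-unique []          = []
  elements-unique (true ∷ p)  =
    All.tabulate (λ i∈ eq → zero≢suc (∈-map⁻ suc i∈) eq) ∷ Unique.map⁺ Fin.suc-injective (elements-unique p)
    where
    zero≢suc : ∀ {i} → (∃[ j ] j ∈ elements p × i ≡ suc j) → zero ≢ i
    zero≢suc (_ , _ , refl) ()
  elements-unique (false ∷ p) = Unique.map⁺ Fin.suc-injective (elements-unique p)

  module Sort {A : Set} (label : A → ℕ) (label-injective : ∀ {a b} → label a ≡ label b → a ≡ b) where

    Ascending : List A → Set
    Ascending = AllPairs (λ a b → label a < label b)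

    insert : A → List A → List A
    insert x []       = x ∷ []
    insert x (y ∷ ys) with label x <? label y
    ... | yes _ = x ∷ y ∷ ys
    ... | no _  = y ∷ insert x ys

    length-insert : ∀ x ys → length (insert x ys) ≡ suc (length ys)
    length-insert x []       = refl
    length-insert x (y ∷ ys) with label x <? label y
    ... | yes _ = refl
    ... | no _  = cong suc (length-insert x ys)

    insert-⊆ : ∀ x ys → insert x ys ⊆ x ∷ ys
    insert-⊆ x []       i∈ = i∈
    insert-⊆ x (y ∷ ys) i∈ with label x <? label y
    insert-⊆ x (y ∷ ys) i∈           | yes _ = i∈
    insert-⊆ x (y ∷ ys) (here refl)  | no _  = there (here refl)
    insert-⊆ x (y ∷ ys) (there i∈)   | no _  with insert-⊆ x ys i∈
    ... | here eq  = here eq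
    ... | there j∈ = there (there j∈)

    insert-ascending : ∀ x ys → All (x ≢_) ys → Ascending ys → Ascending (insert x ys)
    insert-ascending x []       _           _         = [] ∷ []
    insert-ascending x (y ∷ ys) (x≢y ∷ x∉) (y< ∷ asc) with label x <? label y
    ... | yes x<y = (x<y ∷ All.map (<-trans x<y) y<) ∷ y< ∷ asc
    ... | no x≮y  = All.tabulate (λ i∈ → below (insert-⊆ x ys i∈)) ∷ insert-ascending x ys x∉ asc
      where
      below : ∀ {z} → z ∈ x ∷ ys → label y < label z
      below (here refl) = ≤∧≢⇒< (≮⇒≥ x≮y) (λ eq → x≢y (sym (label-injective eq)))
      below (there z∈)  = All.lookup y< z∈

    sort : List A → List A
    sort []       = []
    sort (x ∷ xs) = insert x (sort xs)

    length-sort : ∀ xs → length (sort xs) ≡ length xs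
    length-sort []       = refl
    length-sort (x ∷ xs) = trans (length-insert x (sort xs)) (cong suc (length-sort xs))

    sort-⊆ : ∀ xs → sort xs ⊆ xs
    sort-⊆ (x ∷ xs) i∈ with insert-⊆ x (sort xs) i∈
    ... | here eq  = here eq
    ... | there j∈ = there (sort-⊆ xs j∈)

    sort-ascending : ∀ xs → Unique xs → Ascending (sort xs)
    sort-ascending []       _         = []
    sort-ascending (x ∷ xs) (x∉ ∷ u) =
      insert-ascending x (sort xs) (All.tabulate λ i∈ → All.lookup x∉ (sort-⊆ xs i∈)) (sort-ascending xs u)

  n<2^n : ∀ n → n < 2 ^ n
  n<2^n zero    = s≤s z≤n
  n<2^n (suc n) = begin-strict
    suc n               <⟨ s≤s (n<2^n n) ⟩
    1 + 2 ^ n           ≤⟨ +-monoˡ-≤ (2 ^ n) (m^n>0 2 n) ⟩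
    2 ^ n + 2 ^ n       ≡⟨ cong (λ z → 2 ^ n + z) (+-identityʳ (2 ^ n)) ⟨
    2 ^ suc n           ∎
    where open ≤-Reasoning

  -- A substitute for the fourth root of `suc k`: it lies between 2^r and 2^(r+1). When
  -- `suc (suc k)` outgrows the upper bound, the old upper bound becomes the new lower one.
  power16-near : ∀ k → ∃[ r ] suc k ≤ 2 ^ (4 * suc r) × (2 ^ r) ^ 4 ≤ suc k
  power16-near zero = 0 , m≤m+n 1 15 , ≤-refl
  power16-near (suc k) with power16-near k
  ... | r , hi , lo with suc (suc k) ≤? 2 ^ (4 * suc r)
  ...   | yes hi′ = r , hi′ , m≤n⇒m≤1+n lo
  ...   | no hi′≰ = suc r , bound , (begin
        (2 ^ suc r) ^ 4                ≡⟨ ^-*-assoc 2 (suc r) 4 ⟩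
        2 ^ (suc r * 4)                ≡⟨ cong (2 ^_) (*-comm (suc r) 4) ⟩
        2 ^ (4 * suc r)                ≤⟨ <⇒≤ (≰⇒> hi′≰) ⟩
        suc (suc k)                    ∎)
    where
    open ≤-Reasoning
    bound : suc (suc k) ≤ 2 ^ (4 * suc (suc r))
    bound = begin
      suc (suc k)                           ≤⟨ s≤s hi ⟩
      1 + 2 ^ (4 * suc r)                   ≤⟨ +-monoˡ-≤ _ (m^n>0 2 (4 * suc r)) ⟩
      2 ^ (4 * suc r) + 2 ^ (4 * suc r)     ≡⟨ cong (λ z → 2 ^ (4 * suc r) + z) (+-identityʳ _) ⟨
      2 ^ suc (4 * suc r)                   ≤⟨ ^-monoʳ-≤ 2 (≤-trans (m≤n+m (suc (4 * suc r)) 3) (≤-reflexive (sym (*-suc 4 (suc r))))) ⟩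
      2 ^ (4 * suc (suc r))                 ∎

  linear-bound : ∀ a b n → 1 ≤ n → (a + b * (4 * n)) * 2 ≤ (a + b * 4) * 2 * n
  linear-bound a b n@(suc _) _ = begin
    (a + b * (4 * n)) * 2          ≤⟨ *-monoˡ-≤ 2 (+-monoˡ-≤ (b * (4 * n)) (m≤m*n a n)) ⟩
    (a * n + b * (4 * n)) * 2      ≡⟨ lemma a b n ⟩
    (a + b * 4) * 2 * n            ∎
    where
    open ≤-Reasoning
    lemma : ∀ a b n → (a * n + b * (4 * n)) * 2 ≡ (a + b * 4) * 2 * n
    lemma = solve-∀

  module Factor (a b : ℕ) where

    ratio : ℕ
    ratio = (a + b * 4) * 2

    -- With m = 4 (r + 1) and r + 1 ≤ 2^r, any linear function of m is at most a constant times 2^r,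
    -- and the fourth power of 2^r is at most `suc k`.
    factor : ∀ k → ∃[ m ] suc k ≤ 2 ^ m × ((a + b * m) * 2) ^ 4 ≤ ratio ^ 4 * suc k
    factor k with power16-near k
    ... | r , hi , lo = 4 * suc r , hi , (begin
      ((a + b * (4 * suc r)) * 2) ^ 4        ≤⟨ ^-monoˡ-≤ 4 (≤-trans (linear-bound a b (suc r) (s≤s z≤n))
                                                                     (*-monoʳ-≤ ratio (n<2^n r))) ⟩
      (ratio * 2 ^ r) ^ 4                    ≡⟨ lemma ratio (2 ^ r) ⟩
      ratio ^ 4 * (2 ^ r) ^ 4                ≤⟨ *-monoʳ-≤ (ratio ^ 4) lo ⟩
      ratio ^ 4 * suc k                      ∎)
      where
      open ≤-Reasoning
      lemma : ∀ x y → (x * y) ^ 4 ≡ x ^ 4 * y ^ 4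
      lemma x y = ^-distribʳ-* 4 x y

  module _ {n} (H : Hierarchy (Fin n)) (label : Fin n → ℕ)
    (label-injective : ∀ {a b} → label a ≡ label b → a ≡ b)
    (label-refines : ∀ {a b} → label a ≤ label b → Hierarchy.key H 0 a ≤ Hierarchy.key H 0 b)
    where

    open Hierarchy H
    open Paths d
    open Sort label label-injective
    open Tour d d-sym using (weight; tour)

    -- The tour is a walk through all vertices of length at most twice the weight of the graph, so
    -- the bound for sorted paths applies to the vertices listed by label.
    ascending-path : ∀ (G : Graph n) k m → Connected G → Nonempty (vertices G) → ∣ vertices G ∣ ≡ suc k → suc k ≤ 2 ^ m →
      ∃[ x ] ∃[ ys ] length ys ≡ k × Linked (λ a b → label a < label b) (x ∷ ys)
        × pathFrom x ys ≤ (29 + 100 * m) * 2 * weight (edges G)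
    ascending-path G k m conn (r , r∈) size k≤ with tour G conn r r∈ | sort (elements (vertices G))
         | length-sort (elements (vertices G)) | sort-⊆ (elements (vertices G)) | sort-ascending _ (elements-unique (vertices G))
    ... | us , cov , bound | [] | len | _ | _ = contradiction (trans len (trans (length-elements (vertices G)) size)) λ ()
    ... | us , cov , bound | x ∷ ys | len | sub | asc = x , ys , len′ , linked ,
      (begin
        pathFrom x ys                                    ≤⟨ SortedPaths.Bound.sorted-path-bound H r us m x ys
                                                              (Linked.map (λ lt → label-refines (<⇒≤ lt)) linked)
                                                              (λ i∈ → cov _ (∈-elements⁻ (vertices G) (sub i∈)))
                                                              (≤-trans (≤-trans (n≤1+n _) (≤-reflexive (cong suc len′))) k≤) ⟩
        (29 + 100 * m) * pathFrom r us                   ≤⟨ *-monoʳ-≤ (29 + 100 * m) bound ⟩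
        (29 + 100 * m) * (2 * weight (edges G))          ≡⟨ *-assoc (29 + 100 * m) 2 (weight (edges G)) ⟨
        (29 + 100 * m) * 2 * weight (edges G)            ∎)
      where
      open ≤-Reasoning
      len′ : length ys ≡ k
      len′ = suc-injective (trans len (trans (length-elements (vertices G)) size))
      linked : Linked (λ a b → label a < label b) (x ∷ ys)
      linked = AllPairs⇒Linked asc

-- The program

module Algorithm where

  open Compiler
  open Preamble using (absᴱ; eval-abs; foldn-add; foldn-+)
  open Morton using (odd; odd≤1; hi; lo; hi-step; lo-full; lo<2^; hi-bound; morton; suc-∸)
  open PathTree using (argmin; argmin-<; module Cheapest)
  open import Data.Fin.Base using (Fin; zero; suc)
  open import Data.Fin.Patterns
  open import Data.Integer.Base as ℤ using (ℤ; +_; 0ℤ; 1ℤ)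
  open import Data.List.Base using (List; []; _∷_)
  open import Data.Nat.Base hiding (_/_)
  open import Data.Vec.Base using (Vec; []; _∷_; lookup)

  -- Here v s is a closed form for the accumulator before round s; most loops of the program are
  -- evaluated by exhibiting one.
  foldn-invariant : ∀ {A : Set} (v : ℕ → A) {n f a} → a ≡ v 0 → (∀ s → s < n → f s (v s) ≡ v (suc s)) →
    foldn n f a ≡ v n
  foldn-invariant v {zero}          start step = start
  foldn-invariant v {suc n} {f = f} start step =
    trans (cong (f n) (foldn-invariant v {n} start (λ s s<n → step s (m<n⇒m<1+n s<n)))) (step n ≤-refl)

  pos?-⊖ : ∀ a b → pos? (a ℤ.⊖ b) ≡ (b <ᵇ a)
  pos?-⊖ zero    zero    = refl
  pos?-⊖ zero    (suc b) = refl
  pos?-⊖ (suc a) zero    = refl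
  pos?-⊖ (suc a) (suc b) = trans (cong pos? (ℤ.[1+m]⊖[1+n]≡m⊖n a b)) (pos?-⊖ a b)

  pos?-minus : ∀ {x y} a b → x ≡ + a → y ≡ + b → pos? (x ℤ.- y) ≡ (b <ᵇ a)
  pos?-minus a b refl refl = trans (cong pos? (ℤ.m-n≡m⊖n a b)) (pos?-⊖ a b)

  <ᵇ-true : ∀ {a b} → a < b → (a <ᵇ b) ≡ true
  <ᵇ-true {a} {b} a<b with a <ᵇ b | <⇒<ᵇ a<b
  ... | true | _ = refl

  <ᵇ-false : ∀ {a b} → b ≤ a → (a <ᵇ b) ≡ false
  <ᵇ-false {a} {b} b≤a with a <ᵇ b in eq
  ... | true  = contradiction (<ᵇ⇒< a b (subst T (sym eq) _)) (≤⇒≯ b≤a)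
  ... | false = refl

  if-true : ∀ {A : Set} {b} {x y : A} → b ≡ true → (if b then x else y) ≡ x
  if-true refl = refl

  if-false : ∀ {A : Set} {b} {x y : A} → b ≡ false → (if b then x else y) ≡ y
  if-false refl = refl

  if-cong : ∀ {A : Set} {b c} {x y x′ y′ : A} → b ≡ c → x ≡ x′ → y ≡ y′ →
    (if b then x else y) ≡ (if c then x′ else y′)
  if-cong refl refl refl = refl

  +-minus : ∀ {x y} a b → b ≤ a → x ≡ + a → y ≡ + b → x ℤ.- y ≡ + (a ∸ b)
  +-minus a b b≤a refl refl = trans (ℤ.m-n≡m⊖n a b) (ℤ.⊖-≥ b≤a)

  ∣+-+∣ : ∀ a b → ℤ.∣ + a ℤ.- + b ∣ ≡ ∣ a - b ∣
  ∣+-+∣ a b = trans (cong ℤ.∣_∣ (ℤ.m-n≡m⊖n a b)) (lemma a b)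
    where
    lemma : ∀ a b → ℤ.∣ a ℤ.⊖ b ∣ ≡ ∣ a - b ∣
    lemma zero    zero    = refl
    lemma zero    (suc b) = refl
    lemma (suc a) zero    = refl
    lemma (suc a) (suc b) = trans (cong ℤ.∣_∣ (ℤ.[1+m]⊖[1+n]≡m⊖n a b)) (lemma a b)

  if-+ : ∀ b {x y : ℕ} → (if b then + x else + y) ≡ + (if b then x else y)
  if-+ true  = refl
  if-+ false = refl

  -- The arrays are: 0 numerators, 1 denominators, 2 powers of two, 3 scaled
  -- coordinates, 4 labels, 5 costs, 6 predecessors, 7 the path.

  -- In the body of a fold over parameter 6, the bit positions run downwards.

  positionᴱ : ∀ {Γ} → Fin Γ → Ex Γ
  positionᴱ i = par 6F ⊟ int 1ℤ ⊟ var i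

  -- Bits are found without division: subtracting, from the top, each power 2^u with u > j that fits
  -- leaves y modulo 2^(j+1), and bit j is set if 2^j still fits. The product is Horner's rule over
  -- the bits of y, with the sign of x carried along.
  remainderᴱ bitᴱ productᴱ : ∀ {Γ} → Fin Γ → Fin Γ → Ex Γ
  remainderᴱ j y = fold 6F (var y) (bind (positionᴱ 0F)
    (ifpos (var 0F ⊟ var (suc (suc (suc j))))
      (ifpos (get 2F (var 0F) ⊟ var 2F) (var 2F) (var 2F ⊟ get 2F (var 0F)))
      (var 2F)))
  bitᴱ j y = ifpos (get 2F (var j) ⊟ remainderᴱ j y) (int 0ℤ) (int 1ℤ)
  productᴱ x y = fold 6F (int 0ℤ) (bind (positionᴱ 0F)
    (var 2F ⊞ var 2F ⊞ ifpos (bitᴱ 0F (suc (suc (suc y)))) (var (suc (suc (suc x)))) (int 0ℤ)))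

  -- A shifted coordinate is below twice the offset, so a distance is at most four offsets. The
  -- penalty, k such distances and 1 more, exceeds the length of every path with k - 1 edges.
  offsetᴱ infinityᴱ : ∀ {Γ} → Ex Γ
  offsetᴱ   = get 2F (par 6F ⊟ int 1ℤ)
  infinityᴱ = int 1ℤ ⊞ fold 1F (int 0ℤ) (var 1F ⊞ (offsetᴱ ⊞ offsetᴱ ⊞ (offsetᴱ ⊞ offsetᴱ)))

  powersᴱ scaledᴱ labelᴱ : Ex 1
  powersᴱ = fold 6F (int 1ℤ) (ifpos (var 2F ⊟ var 0F) (var 1F ⊞ var 1F) (var 1F))
  scaledᴱ = fold 2F (get 0F (var 0F))
      -- Both strict comparisons fail only at the coordinate's own index. Its numerator times all
      -- other denominators is the coordinate times the product of all denominators.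
      (ifpos (var 0F ⊟ var 2F) times (ifpos (var 2F ⊟ var 0F) times (var 1F)))
    ⊞ offsetᴱ
    where
    times : Ex 3
    times = bind (get 1F (var 0F)) (productᴱ 2F 0F)
  labelᴱ =
    bind (get 3F (var 0F ⊞ var 0F)) (bind (get 3F (var 1F ⊞ var 1F ⊞ int 1ℤ))
    (bind (fold 6F (int 0ℤ) (bind (positionᴱ 0F)
        (var 2F ⊞ var 2F ⊞ (var 2F ⊞ var 2F) ⊞ (bitᴱ 0F 4F ⊞ bitᴱ 0F 4F ⊞ bitᴱ 0F 3F))))
    -- Adding the code n times to the index gives n · code + i. As i < n, this keeps the order of
    -- the codes and separates even coincident points.
    (fold 0F (var 3F) (var 1F ⊞ var 2F))))

  distanceᴱ stepᴱ : ∀ {Γ} → Fin Γ → Fin Γ → Ex Γ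
  distanceᴱ j i =
    absᴱ (get 3F (var j ⊞ var j) ⊟ get 3F (var i ⊞ var i)) ⊞
    absᴱ (get 3F (var j ⊞ var j ⊞ int 1ℤ) ⊟ get 3F (var i ⊞ var i ⊞ int 1ℤ))
  stepᴱ j i = ifpos (get 4F (var i) ⊟ get 4F (var j)) (distanceᴱ j i) infinityᴱ

  -- Entry c n + i of arrays 5 and 6 belongs to the paths with c edges that end
  -- at point i.

  columnᴱ : ∀ {Γ} → Fin Γ → Ex Γ
  columnᴱ t = fold 1F (var t) (ifpos (par 0F ⊟ var 1F) (var 1F) (var 1F ⊟ par 0F))

  -- For t = (c + 1) n + i, the position t - i - n + j is entry j of the preceding row, already
  -- complete when entry t is computed.
  viaᴱ : ∀ {Γ} → Fin Γ → Fin Γ → Fin Γ → Ex Γ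
  viaᴱ t i j = get 5F (var t ⊟ var i ⊟ par 0F ⊞ var j) ⊞ stepᴱ j i

  bestᴱ : ∀ {Γ} → Fin Γ → Fin Γ → Ex Γ
  bestᴱ t i = fold 0F (int 0ℤ)
    (ifpos (viaᴱ (suc (suc t)) (suc (suc i)) 1F ⊟ viaᴱ (suc (suc t)) (suc (suc i)) 0F) (var 0F) (var 1F))

  costᴱ backᴱ traceᴱ markᴱ minᴱ maxᴱ : Ex 1
  costᴱ  = ifpos (par 0F ⊟ var 0F) (int 0ℤ) (bind (columnᴱ 0F) (bind (bestᴱ 1F 0F) (viaᴱ 2F 1F 0F)))
  backᴱ  = bind (columnᴱ 0F) (bestᴱ 1F 0F)
  traceᴱ = ifpos (var 0F)
    -- Subtracting n in the rounds below t takes k n to (k - t) n, the start of the row of paths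
    -- with k - t edges; the vertex traced last is the end of such a path.
    (get 6F (fold 1F (par 5F) (ifpos (var 2F ⊟ var 0F) (var 1F ⊟ par 0F) (var 1F)) ⊞ get 7F (var 0F ⊟ int 1ℤ)))
    (fold 0F (int 0ℤ)
      (ifpos (get 5F (par 5F ⊟ par 0F ⊞ var 1F) ⊟ get 5F (par 5F ⊟ par 0F ⊞ var 0F)) (var 0F) (var 1F)))
  markᴱ  = fold 1F (int 0ℤ) (bind (get 7F (var 0F))
    (ifpos (var 0F ⊟ var 3F) (var 2F) (ifpos (var 3F ⊟ var 0F) (var 2F) (int 1ℤ))))
  minᴱ   = ifpos (get 7F (var 0F) ⊟ get 7F (var 0F ⊞ int 1ℤ)) (get 7F (var 0F ⊞ int 1ℤ)) (get 7F (var 0F))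
  maxᴱ   = ifpos (get 7F (var 0F) ⊟ get 7F (var 0F ⊞ int 1ℤ)) (get 7F (var 0F)) (get 7F (var 0F ⊞ int 1ℤ))

  statements : List Stmt
  statements =
    tab 2F 6F powersᴱ ∷ tab 3F 2F scaledᴱ ∷ tab 4F 0F labelᴱ ∷ tab 5F 5F costᴱ ∷ tab 6F 5F backᴱ ∷
    tab 7F 1F traceᴱ ∷ emit 0F (markᴱ ∷ []) ∷ emit 3F (minᴱ ∷ maxᴱ ∷ []) ∷ []

  others : (ℕ → ℕ) → ℕ → ℕ → ℕ
  others den c m = foldn m (λ d acc → if does (d ≟ c) then acc else acc * den d) 1

  infinity : ℕ → ℕ → ℕ
  infinity k off = 1 + (k * (off + off + (off + off)) + 0)

  -- The values of the program's expressions

  module Evaluation (π : Params) (σ : Arrays) where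

    B : ℕ
    B = lookup π 6F

    ⟪_⟫ : ∀ {Γ} → Ex Γ → Vec ℤ Γ → ℤ
    ⟪ e ⟫ ρ = eval π σ ρ e

    powers-value : ∀ x → x < B → ⟪ powersᴱ ⟫ (+ x ∷ []) ≡ + (2 ^ x)
    powers-value x x<B = trans
      -- The minimum reflects that the loop always runs B rounds but doubles only in the first x of
      -- them.
      (foldn-invariant (λ s → + (2 ^ (s ⊓ x))) {B} refl step)
      (cong (λ z → + (2 ^ z)) (m≥n⇒m⊓n≡n (<⇒≤ x<B)))
      where
      step : ∀ s → s < B → (if pos? (+ x ℤ.- + s) then + (2 ^ (s ⊓ x)) ℤ.+ + (2 ^ (s ⊓ x)) else + (2 ^ (s ⊓ x))) ≡ + (2 ^ (suc s ⊓ x))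
      step s _ with s <? x
      ... | yes s<x rewrite m≤n⇒m⊓n≡m s<x | m≤n⇒m⊓n≡m (<⇒≤ s<x) =
        trans (if-true (trans (pos?-minus x s refl refl) (<ᵇ-true s<x)))
          (cong (λ z → + (2 ^ s + z)) (sym (+-identityʳ (2 ^ s))))
      ... | no s≮x rewrite m≥n⇒m⊓n≡n (≮⇒≥ s≮x) | m≥n⇒m⊓n≡n (m≤n⇒m≤1+n (≮⇒≥ s≮x)) =
        if-false (trans (pos?-minus x s refl refl) (<ᵇ-false (≮⇒≥ s≮x)))

    position-value : ∀ s → s < B → + B ℤ.- 1ℤ ℤ.- + s ≡ + (B ∸ suc s)
    position-value s s<B = trans (+-minus (B ∸ 1) s (s≤s⁻¹ (≤-trans s<B (m≤n+m∸n B 1))) (+-minus B 1 (≤-trans (s≤s z≤n) s<B) refl refl) refl)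
      (cong +_ (∸-+-assoc B 1 s))

    module Bits (powers : ∀ j → j < B → lookup σ 2F (+ j) ≡ + (2 ^ j)) where

      reduce : ℤ → ℤ → ℤ → ℤ
      reduce u j a =
        if pos? (u ℤ.- j) then (if pos? (lookup σ 2F u ℤ.- a) then a else (a ℤ.- lookup σ 2F u)) else a

      -- Before the round for position u the accumulator holds the bits of y up to position max(u,
      -- j). If u > j, comparison with 2^u reveals bit u, because the bits below it sum to less than
      -- 2^u.
      remainder-step : ∀ u y j → u < B → reduce (+ u) (+ j) (+ lo (suc u ⊔ suc j) y) ≡ + lo (u ⊔ suc j) y
      remainder-step u y j u<B with j <? u
      ... | no j≮u = trans (if-false (trans (pos?-minus u j refl refl) (<ᵇ-false (≮⇒≥ j≮u))))
        (cong (λ z → + lo z y) (trans (m≤n⇒m⊔n≡n (s≤s (≮⇒≥ j≮u))) (sym (m≤n⇒m⊔n≡n (m≤n⇒m≤1+n (≮⇒≥ j≮u))))))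
      ... | yes j<u rewrite m≥n⇒m⊔n≡m (<⇒≤ j<u) | m≥n⇒m⊔n≡m j<u | powers u u<B =
        trans (if-true (trans (pos?-minus u j refl refl) (<ᵇ-true j<u))) (lemma (odd (hi u y)) refl (odd≤1 (hi u y)))
        where
        lemma : ∀ b → odd (hi u y) ≡ b → b ≤ 1 →
          (if pos? (+ (2 ^ u) ℤ.- + lo (suc u) y) then + lo (suc u) y else (+ lo (suc u) y ℤ.- + (2 ^ u))) ≡ + lo u y
        lemma zero eq _ rewrite eq | *-zeroʳ (2 ^ u) | +-identityʳ (lo u y) =
          if-true (trans (pos?-minus (2 ^ u) (lo u y) refl refl) (<ᵇ-true (lo<2^ u y)))
        lemma (suc zero) eq _ rewrite eq | *-identityʳ (2 ^ u) =
          trans (if-false (trans (pos?-minus (2 ^ u) (lo u y + 2 ^ u) refl refl) (<ᵇ-false (m≤n+m (2 ^ u) (lo u y)))))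
            (trans (+-minus (lo u y + 2 ^ u) (2 ^ u) (m≤n+m (2 ^ u) (lo u y)) refl refl) (cong +_ (m+n∸n≡m (lo u y) (2 ^ u))))
        lemma (suc (suc _)) eq (s≤s ())

      suc-position : ∀ {s} → s < B → B ∸ s ≡ suc (B ∸ suc s)
      suc-position s<B = sym (suc-∸ s<B)

      position<B : ∀ {s} → s < B → B ∸ suc s < B
      position<B {s} s<B = ≤-trans (≤-reflexive (sym (suc-position s<B))) (m∸n≤m B s)

      module _ {Γ} (ρ : Vec ℤ Γ) (jv yv : Fin Γ) {j y : ℕ} (j≡ : lookup ρ jv ≡ + j) (y≡ : lookup ρ yv ≡ + y)
               (j<B : j < B) (y< : y < 2 ^ B) where

        remainder-value : ⟪ remainderᴱ jv yv ⟫ ρ ≡ + lo (suc j) y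
        remainder-value = trans (foldn-invariant (λ s → + lo ((B ∸ s) ⊔ suc j) y) {B} start step) end
          where
          start : lookup ρ yv ≡ + lo (B ⊔ suc j) y
          start = trans y≡ (cong +_ (sym (trans (cong (λ z → lo z y) (m≥n⇒m⊔n≡m j<B)) (lo-full {B} y y<))))
          end : + lo ((B ∸ B) ⊔ suc j) y ≡ + lo (suc j) y
          end = cong (λ z → + lo (z ⊔ suc j) y) (n∸n≡0 B)
          step : ∀ s → s < B →
            reduce (+ B ℤ.- 1ℤ ℤ.- + s) (lookup ρ jv) (+ lo ((B ∸ s) ⊔ suc j) y) ≡ + lo ((B ∸ suc s) ⊔ suc j) y
          step s s<B rewrite j≡ | position-value s s<B | suc-position s<B =
            remainder-step (B ∸ suc s) y j (position<B s<B)

        bit-value : ⟪ bitᴱ jv yv ⟫ ρ ≡ + odd (hi j y)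
        bit-value rewrite remainder-value | j≡ | powers j j<B = lemma (odd (hi j y)) refl (odd≤1 (hi j y))
          where
          lemma : ∀ b → odd (hi j y) ≡ b → b ≤ 1 →
            (if pos? (+ (2 ^ j) ℤ.- + lo (suc j) y) then + 0 else + 1) ≡ + odd (hi j y)
          lemma zero eq _ rewrite eq | *-zeroʳ (2 ^ j) | +-identityʳ (lo j y) =
            if-true (trans (pos?-minus (2 ^ j) (lo j y) refl refl) (<ᵇ-true (lo<2^ j y)))
          lemma (suc zero) eq _ rewrite eq | *-identityʳ (2 ^ j) =
            if-false (trans (pos?-minus (2 ^ j) (lo j y + 2 ^ j) refl refl) (<ᵇ-false (m≤n+m (2 ^ j) (lo j y))))
          lemma (suc (suc _)) eq (s≤s ())

      -- Before round s the accumulator is x times the number formed by the s leading of the B bits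
      -- of y.
      product-value : ∀ {Γ} (ρ : Vec ℤ Γ) (xv yv : Fin Γ) {y : ℕ} → lookup ρ yv ≡ + y → y < 2 ^ B →
        ⟪ productᴱ xv yv ⟫ ρ ≡ lookup ρ xv ℤ.* + y
      product-value ρ xv yv {y} y≡ y< = trans (foldn-invariant (λ s → x ℤ.* + hi (B ∸ s) y) {B} start step) end
        where
        x : ℤ
        x = lookup ρ xv
        start : + 0 ≡ x ℤ.* + hi B y
        start = sym (trans (cong (λ z → x ℤ.* + z) (n<1⇒n≡0 (subst (λ z → hi B y < 2 ^ z) (n∸n≡0 B) (hi-bound B y y<)))) (ℤ.*-zeroʳ x))
        end : x ℤ.* + hi (B ∸ B) y ≡ x ℤ.* + y
        end = cong (λ z → x ℤ.* + hi z y) (n∸n≡0 B)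
        next : ℕ → ℤ → ℤ → ℤ
        next s u a = a ℤ.+ a ℤ.+ (if pos? (⟪ bitᴱ 0F (suc (suc (suc yv))) ⟫ (u ∷ + s ∷ a ∷ ρ)) then x else 0ℤ)
        step : ∀ s → s < B → next s (+ B ℤ.- 1ℤ ℤ.- + s) (x ℤ.* + hi (B ∸ s) y) ≡ x ℤ.* + hi (B ∸ suc s) y
        step s s<B rewrite position-value s s<B | suc-position s<B
          | bit-value (+ (B ∸ suc s) ∷ + s ∷ (x ℤ.* + hi (suc (B ∸ suc s)) y) ∷ ρ) 0F (suc (suc (suc yv))) refl y≡ (position<B s<B) y< =
          lemma (B ∸ suc s) (odd (hi (B ∸ suc s) y)) refl (odd≤1 (hi (B ∸ suc s) y))
          where
          lemma : ∀ u b → odd (hi u y) ≡ b → b ≤ 1 →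
            x ℤ.* + hi (suc u) y ℤ.+ x ℤ.* + hi (suc u) y ℤ.+ (if pos? (+ odd (hi u y)) then x else 0ℤ) ≡ x ℤ.* + hi u y
          lemma u b eq b≤1 = trans (split b eq b≤1) (trans (ring x (+ hi (suc u) y) (+ b)) (cong (x ℤ.*_) (sym whole)))
            where
            ring : ∀ x h b → x ℤ.* h ℤ.+ x ℤ.* h ℤ.+ x ℤ.* b ≡ x ℤ.* (b ℤ.+ (h ℤ.+ h))
            ring = ℤ-Solver.solve-∀
            whole : + hi u y ≡ + b ℤ.+ (+ hi (suc u) y ℤ.+ + hi (suc u) y)
            whole = cong +_ (trans (hi-step u y) (cong₂ (λ p q → p + (hi (suc u) y + q)) eq (+-identityʳ (hi (suc u) y))))
            split : ∀ b → odd (hi u y) ≡ b → b ≤ 1 →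
              x ℤ.* + hi (suc u) y ℤ.+ x ℤ.* + hi (suc u) y ℤ.+ (if pos? (+ odd (hi u y)) then x else 0ℤ)
              ≡ x ℤ.* + hi (suc u) y ℤ.+ x ℤ.* + hi (suc u) y ℤ.+ x ℤ.* + b
            split zero       eq _ rewrite eq | ℤ.*-zeroʳ x = refl
            split (suc zero) eq _ rewrite eq | ℤ.*-identityʳ x = refl
            split (suc (suc _)) eq (s≤s ())

      module _ (0<B : 0 < B) where

        offset-value : ∀ {Γ} (ρ : Vec ℤ Γ) → ⟪ offsetᴱ ⟫ ρ ≡ + (2 ^ (B ∸ 1))
        offset-value ρ = trans (cong (lookup σ 2F) (+-minus B 1 0<B refl refl)) (powers (B ∸ 1) (position<B 0<B))

        infinity-value : ∀ {Γ} (ρ : Vec ℤ Γ) → ⟪ infinityᴱ ⟫ ρ ≡ + infinity (lookup π 1F) (2 ^ (B ∸ 1))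
        infinity-value ρ = cong (λ z → 1ℤ ℤ.+ z)
          (trans (foldn-+ (lookup π 1F) _ (λ _ acc → acc + (o + o + (o + o))) 0 (λ i b _ → cong (λ z → + b ℤ.+ z)
              (cong₂ ℤ._+_ (cong₂ ℤ._+_ (offset-value []) (offset-value [])) (cong₂ ℤ._+_ (offset-value []) (offset-value [])))))
            (cong +_ (foldn-add (lookup π 1F) (o + o + (o + o)) 0)))
          where
          o : ℕ
          o = 2 ^ (B ∸ 1)

        module _ (num : ℕ → ℤ) (den : ℕ → ℕ)
          (num≡ : ∀ c → c < lookup π 2F → lookup σ 0F (+ c) ≡ num c)
          (den≡ : ∀ c → c < lookup π 2F → lookup σ 1F (+ c) ≡ + den c)
          (den< : ∀ c → c < lookup π 2F → den c < 2 ^ B) where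

          scaled-value : ∀ c → c < lookup π 2F →
            ⟪ scaledᴱ ⟫ (+ c ∷ []) ≡ num c ℤ.* + others den c (lookup π 2F) ℤ.+ + (2 ^ (B ∸ 1))
          scaled-value c c<N = cong₂ ℤ._+_
            (foldn-invariant (λ s → num c ℤ.* + others den c s) {lookup π 2F}
              (trans (num≡ c c<N) (sym (ℤ.*-identityʳ (num c)))) step)
            (offset-value (+ c ∷ []))
            where
            times : ℕ → ℤ → ℤ
            times d a = ⟪ productᴱ 2F 0F ⟫ (lookup σ 1F (+ d) ∷ + d ∷ a ∷ + c ∷ [])
            next : ℕ → ℤ → ℤ
            next d a = if pos? (+ d ℤ.- + c) then times d a else (if pos? (+ c ℤ.- + d) then times d a else a)
            times-value : ∀ d → d < lookup π 2F → times d (num c ℤ.* + others den c d) ≡ num c ℤ.* + (others den c d * den d)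
            times-value d d<N =
              trans (product-value (lookup σ 1F (+ d) ∷ + d ∷ (num c ℤ.* + others den c d) ∷ + c ∷ []) 2F 0F (den≡ d d<N) (den< d d<N))
                (trans (ℤ.*-assoc (num c) _ _) (cong (λ z → num c ℤ.* z) (sym (ℤ.pos-* (others den c d) (den d)))))
            step : ∀ d → d < lookup π 2F → next d (num c ℤ.* + others den c d) ≡ num c ℤ.* + others den c (suc d)
            step d d<N with <-cmp d c
            ... | tri> _ d≢c c<d = trans (if-true (trans (pos?-minus d c refl refl) (<ᵇ-true c<d)))
              (trans (times-value d d<N) (cong (λ z → num c ℤ.* + z) (sym (if-false (dec-false (d ≟ c) d≢c)))))
            ... | tri≈ _ refl _ = trans (if-false (trans (pos?-minus d d refl refl) (<ᵇ-false {d} ≤-refl)))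
              (trans (if-false (trans (pos?-minus d d refl refl) (<ᵇ-false {d} ≤-refl)))
                (cong (λ z → num c ℤ.* + z) (sym (if-true (dec-true (d ≟ c) refl)))))
            ... | tri< d<c d≢c _ = trans (if-false (trans (pos?-minus d c refl refl) (<ᵇ-false (<⇒≤ d<c))))
              (trans (if-true (trans (pos?-minus c d refl refl) (<ᵇ-true d<c)))
                (trans (times-value d d<N) (cong (λ z → num c ℤ.* + z) (sym (if-false (dec-false (d ≟ c) d≢c))))))

      -- After s rounds the accumulator is the code of the s leading bits of both coordinates; the
      -- next round shifts it by one base-4 digit.
      label-value : ∀ i x y → lookup σ 3F (+ (i + i)) ≡ + x → lookup σ 3F (+ (i + i + 1)) ≡ + y →
        x < 2 ^ B → y < 2 ^ B → ⟪ labelᴱ ⟫ (+ i ∷ []) ≡ + (lookup π 0F * morton B x y + i)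
      label-value i x y x≡ y≡ x< y< = trans
        (cong (λ z → foldn (lookup π 0F) (λ _ acc → acc ℤ.+ z) (+ i)) code)
        (trans (foldn-+ (lookup π 0F) _ (λ _ acc → acc + morton B x y) i (λ _ _ _ → refl))
          (cong +_ (foldn-add (lookup π 0F) (morton B x y) i)))
        where
        ρ : Vec ℤ 3
        ρ = lookup σ 3F (+ (i + i + 1)) ∷ lookup σ 3F (+ (i + i)) ∷ + i ∷ []
        v : ℕ → ℕ
        v s = morton s (hi (B ∸ s) x) (hi (B ∸ s) y)
        next : ℕ → ℤ → ℤ → ℤ
        next s u a = a ℤ.+ a ℤ.+ (a ℤ.+ a) ℤ.+ (⟪ bitᴱ 0F 4F ⟫ ρ′ ℤ.+ ⟪ bitᴱ 0F 4F ⟫ ρ′ ℤ.+ ⟪ bitᴱ 0F 3F ⟫ ρ′)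
          where
          ρ′ : Vec ℤ 6
          ρ′ = u ∷ + s ∷ a ∷ ρ
        ring : ∀ m a b → m + m + (m + m) + (a + a + b) ≡ 4 * m + (2 * a + b)
        ring = solve-∀
        step : ∀ s → s < B → next s (+ B ℤ.- 1ℤ ℤ.- + s) (+ v s) ≡ + v (suc s)
        step s s<B rewrite position-value s s<B | suc-position s<B
          | bit-value (+ (B ∸ suc s) ∷ + s ∷ + morton s (hi (suc (B ∸ suc s)) x) (hi (suc (B ∸ suc s)) y) ∷ ρ) 0F 4F refl x≡ (position<B s<B) x<
          | bit-value (+ (B ∸ suc s) ∷ + s ∷ + morton s (hi (suc (B ∸ suc s)) x) (hi (suc (B ∸ suc s)) y) ∷ ρ) 0F 3F refl y≡ (position<B s<B) y<
          = cong +_ (ring (morton s (hi (suc (B ∸ suc s)) x) (hi (suc (B ∸ suc s)) y)) (odd (hi (B ∸ suc s) x)) (odd (hi (B ∸ suc s) y)))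
        code : foldn B (λ s acc → next s (+ B ℤ.- 1ℤ ℤ.- + s) acc) 0ℤ ≡ + morton B x y
        code = trans (foldn-invariant (λ s → + v s) {B} refl step)
          (cong (λ z → + morton B (hi z x) (hi z y)) (n∸n≡0 B))

    distance-value : ∀ {Γ} (ρ : Vec ℤ Γ) (X Y : ℕ → ℕ) (jv iv : Fin Γ) {j i} → lookup ρ jv ≡ + j → lookup ρ iv ≡ + i →
      (∀ u → u < lookup π 0F → lookup σ 3F (+ (u + u)) ≡ + X u) →
      (∀ u → u < lookup π 0F → lookup σ 3F (+ (u + u + 1)) ≡ + Y u) →
      j < lookup π 0F → i < lookup π 0F →
      ⟪ distanceᴱ jv iv ⟫ ρ ≡ + (∣ X j - X i ∣ + ∣ Y j - Y i ∣)
    distance-value ρ X Y jv iv {j} {i} j≡ i≡ X≡ Y≡ j<n i<n = cong₂ ℤ._+_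
      (trans (eval-abs π σ ρ (get 3F (var jv ⊞ var jv) ⊟ get 3F (var iv ⊞ var iv)))
        (cong +_ (trans (cong ℤ.∣_∣ (cong₂ ℤ._-_ (at-X jv j≡ j<n) (at-X iv i≡ i<n))) (∣+-+∣ (X j) (X i)))))
      (trans (eval-abs π σ ρ (get 3F (var jv ⊞ var jv ⊞ int 1ℤ) ⊟ get 3F (var iv ⊞ var iv ⊞ int 1ℤ)))
        (cong +_ (trans (cong ℤ.∣_∣ (cong₂ ℤ._-_ (at-Y jv j≡ j<n) (at-Y iv i≡ i<n))) (∣+-+∣ (Y j) (Y i)))))
      where
      at-X : ∀ v {u} → lookup ρ v ≡ + u → u < lookup π 0F → ⟪ get 3F (var v ⊞ var v) ⟫ ρ ≡ + X u
      at-X v {u} eq u<n = trans (cong (λ z → lookup σ 3F (z ℤ.+ z)) eq) (X≡ u u<n)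
      at-Y : ∀ v {u} → lookup ρ v ≡ + u → u < lookup π 0F → ⟪ get 3F (var v ⊞ var v ⊞ int 1ℤ) ⟫ ρ ≡ + Y u
      at-Y v {u} eq u<n = trans (cong (λ z → lookup σ 3F (z ℤ.+ z ℤ.+ 1ℤ)) eq) (Y≡ u u<n)

    argmin-fold : (g h : ℕ → ℤ → ℤ) (f : ℕ → ℕ) → 0 < lookup π 0F →
      (∀ i b → b < lookup π 0F → g i (+ b) ≡ + f b) → (∀ i b → i < lookup π 0F → h i (+ b) ≡ + f i) →
      foldn (lookup π 0F) (λ i acc → if pos? (g i acc ℤ.- h i acc) then + i else acc) 0ℤ ≡ + argmin f (lookup π 0F)
    argmin-fold g h f 0<n g≡ h≡ = foldn-invariant (λ s → + argmin f s) {lookup π 0F} refl step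
      where
      below : ∀ s → s < lookup π 0F → argmin f s < lookup π 0F
      below zero    _   = 0<n
      below (suc s) s<n = <-trans (argmin-< f (s≤s z≤n)) s<n
      step : ∀ s → s < lookup π 0F →
        (if pos? (g s (+ argmin f s) ℤ.- h s (+ argmin f s)) then + s else + argmin f s) ≡ + argmin f (suc s)
      step s s<n = trans (if-cong (pos?-minus (f (argmin f s)) (f s) (g≡ s _ (below s s<n)) (h≡ s _ s<n)) refl refl)
        (if-+ (f s <ᵇ f (argmin f s)))

    -- `w≡` ranges over all contexts because `stepᴱ` is evaluated at different depths: inside the
    -- fold of `bestᴱ` and below the binders of `costᴱ`.
    module Costs (w : ℕ → ℕ → ℕ) (m : ℕ) (0<n : 0 < lookup π 0F) (k≡ : lookup π 1F ≡ suc m)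
      (w≡ : ∀ {Γ} (ρ : Vec ℤ Γ) (jv iv : Fin Γ) j i → lookup ρ jv ≡ + j → lookup ρ iv ≡ + i →
              j < lookup π 0F → i < lookup π 0F → ⟪ stepᴱ jv iv ⟫ ρ ≡ + w j i) where

      n : ℕ
      n = lookup π 0F

      open Cheapest w n m 0<n

      -- After c subtractions of n the value is below n and stays fixed. As c ≤ m < k, the k rounds
      -- of the loop suffice.
      column-value : ∀ {Γ} (ρ : Vec ℤ Γ) (tv : Fin Γ) c i → lookup ρ tv ≡ + (c * n + i) → c ≤ m → i < n →
        ⟪ columnᴱ tv ⟫ ρ ≡ + i
      column-value ρ tv c i t≡ c≤m i<n = trans
        (foldn-invariant v {lookup π 1F} t≡ (λ s _ → step (c ∸ s) (sym (pred[m∸n]≡m∸[1+n] c s))))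
        (cong (λ z → + (z * n + i)) (m≤n⇒m∸n≡0 (subst (c ≤_) (sym k≡) (m≤n⇒m≤1+n c≤m))))
        where
        v : ℕ → ℤ
        v s = + ((c ∸ s) * n + i)
        step : ∀ r {r′} → r′ ≡ pred r →
          (if pos? (+ n ℤ.- + (r * n + i)) then + (r * n + i) else (+ (r * n + i) ℤ.- + n)) ≡ + (r′ * n + i)
        step zero    refl = if-true (trans (pos?-minus n i refl refl) (<ᵇ-true i<n))
        step (suc r) refl = trans
          (if-false (trans (pos?-minus n (suc r * n + i) refl refl) (<ᵇ-false (≤-trans (m≤m+n n (r * n)) (m≤m+n _ i)))))
          (trans (+-minus (suc r * n + i) n (≤-trans (m≤m+n n (r * n)) (m≤m+n _ i)) refl refl)
            (cong +_ (trans (cong (_∸ n) (+-assoc n (r * n) i)) (m+n∸m≡n n (r * n + i)))))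

      module _ (c : ℕ) (row : ∀ j → j < n → lookup σ 5F (+ (c * n + j)) ≡ + cost c j) {i : ℕ} (i<n : i < n) where

        via-value : ∀ {Γ} (ρ : Vec ℤ Γ) (tv iv jv : Fin Γ) j → lookup ρ tv ≡ + (suc c * n + i) → lookup ρ iv ≡ + i →
          lookup ρ jv ≡ + j → j < n → ⟪ viaᴱ tv iv jv ⟫ ρ ≡ + via c i j
        via-value ρ tv iv jv j t≡ i≡ j≡ j<n = cong₂ ℤ._+_
          (trans (cong (lookup σ 5F) (trans (cong₂ (λ a b → a ℤ.- b ℤ.- + n ℤ.+ lookup ρ jv) t≡ i≡)
              (trans (cong (λ z → + (suc c * n + i) ℤ.- + i ℤ.- + n ℤ.+ z) j≡) position)))
            (row j j<n))
          (w≡ ρ jv iv j i j≡ i≡ j<n i<n)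
          where
          ring : ∀ c n i j → n ℤ.+ c ℤ.+ i ℤ.- i ℤ.- n ℤ.+ j ≡ c ℤ.+ j
          ring = ℤ-Solver.solve-∀
          position : + (suc c * n + i) ℤ.- + i ℤ.- + n ℤ.+ + j ≡ + (c * n + j)
          position = ring (+ (c * n)) (+ n) (+ i) (+ j)

        best-value : ∀ {Γ} (ρ : Vec ℤ Γ) (tv iv : Fin Γ) → lookup ρ tv ≡ + (suc c * n + i) → lookup ρ iv ≡ + i →
          ⟪ bestᴱ tv iv ⟫ ρ ≡ + back c i
        best-value ρ tv iv t≡ i≡ = argmin-fold
          (λ s acc → ⟪ viaᴱ (suc (suc tv)) (suc (suc iv)) 1F ⟫ (+ s ∷ acc ∷ ρ))
          (λ s acc → ⟪ viaᴱ (suc (suc tv)) (suc (suc iv)) 0F ⟫ (+ s ∷ acc ∷ ρ)) (via c i) 0<n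
          (λ s b → via-value (+ s ∷ + b ∷ ρ) (suc (suc tv)) (suc (suc iv)) 1F b t≡ i≡ refl)
          (λ s b → via-value (+ s ∷ + b ∷ ρ) (suc (suc tv)) (suc (suc iv)) 0F s t≡ i≡ refl)

        module _ (c<m : c < m) where

          back-value : ⟪ backᴱ ⟫ (+ (suc c * n + i) ∷ []) ≡ + back c i
          back-value = best-value (⟪ columnᴱ 0F ⟫ (+ (suc c * n + i) ∷ []) ∷ + (suc c * n + i) ∷ []) 1F 0F refl
            (column-value (+ (suc c * n + i) ∷ []) 0F (suc c) i refl c<m i<n)

          cost-suc-value : ⟪ costᴱ ⟫ (+ (suc c * n + i) ∷ []) ≡ + cost (suc c) i
          cost-suc-value = trans
            (if-false (trans (pos?-minus n (suc c * n + i) refl refl) (<ᵇ-false (≤-trans (m≤m+n n (c * n)) (m≤m+n _ i)))))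
            (via-value (⟪ backᴱ ⟫ (+ (suc c * n + i) ∷ []) ∷ ⟪ columnᴱ 0F ⟫ (+ (suc c * n + i) ∷ []) ∷ + (suc c * n + i) ∷ [])
              2F 1F 0F (back c i) refl (column-value (+ (suc c * n + i) ∷ []) 0F (suc c) i refl c<m i<n)
              back-value (argmin-< (via c i) 0<n))

      cost-zero-value : ∀ i → i < n → ⟪ costᴱ ⟫ (+ i ∷ []) ≡ + cost 0 i
      cost-zero-value i i<n = if-true (trans (pos?-minus n i refl refl) (<ᵇ-true i<n))

      module _ (q≡ : lookup π 5F ≡ suc m * n) where

        trace-zero-value : (∀ j → j < n → lookup σ 5F (+ (m * n + j)) ≡ + cost m j) →
          ⟪ traceᴱ ⟫ (+ 0 ∷ []) ≡ + trace 0
        trace-zero-value row = argmin-fold (λ _ → last-row) (λ i _ → last-row (+ i)) (cost m) 0<n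
          (λ _ → last-row-value) (λ i _ → last-row-value i)
          where
          last-row : ℤ → ℤ
          last-row z = lookup σ 5F (+ lookup π 5F ℤ.- + n ℤ.+ z)
          last-row-value : ∀ j → j < n → last-row (+ j) ≡ + cost m j
          last-row-value j j<n = trans
            (cong (λ z → lookup σ 5F (z ℤ.+ + j)) (+-minus (lookup π 5F) n (subst (n ≤_) (sym q≡) (m≤m+n n (m * n))) refl refl))
            (trans (cong (λ z → lookup σ 5F (+ (z + j))) (trans (cong (_∸ n) q≡) (m+n∸m≡n n (m * n)))) (row j j<n))

        trace-suc-value : ∀ s → s < m → lookup σ 7F (+ s) ≡ + trace s →
          (∀ i → i < n → lookup σ 6F (+ (suc (m ∸ suc s) * n + i)) ≡ + back (m ∸ suc s) i) →
          ⟪ traceᴱ ⟫ (+ suc s ∷ []) ≡ + trace (suc s)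
        trace-suc-value s s<m prev backs = trans
          (cong (lookup σ 6F) (cong₂ ℤ._+_ (trans base (cong (λ z → + (z * n)) (sym (suc-∸ s<m)))) prev))
          (backs (trace s) (trace-< s))
          where
          v : ℕ → ℤ
          v u = + ((suc m ∸ (u ⊓ suc s)) * n)
          step : ∀ u → u < lookup π 1F → (if pos? (+ suc s ℤ.- + u) then (v u ℤ.- + n) else v u) ≡ v (suc u)
          step u u<k with u <? suc s
          ... | no u≮s rewrite m≥n⇒m⊓n≡n (≮⇒≥ u≮s) | m≥n⇒m⊓n≡n (<⇒≤ (≮⇒≥ u≮s)) =
            if-false (trans (pos?-minus (suc s) u refl refl) (<ᵇ-false (≮⇒≥ u≮s)))
          ... | yes u<s rewrite m≤n⇒m⊓n≡m (s≤s⁻¹ u<s) | m≤n⇒m⊓n≡m (<⇒≤ u<s) | sym (suc-∸ (subst (u <_) k≡ u<k)) =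
            trans (if-true (trans (pos?-minus (suc s) u refl refl) (<ᵇ-true u<s)))
              (trans (+-minus (n + (m ∸ u) * n) n (m≤m+n n _) refl refl) (cong +_ (m+n∸m≡n n ((m ∸ u) * n))))
          base : foldn (lookup π 1F) (λ u acc → if pos? (+ suc s ℤ.- + u) then (acc ℤ.- + n) else acc) (+ lookup π 5F) ≡ + ((m ∸ s) * n)
          base = trans (foldn-invariant v {lookup π 1F} (cong +_ q≡) step)
            (cong (λ z → + ((suc m ∸ z) * n)) (m≥n⇒m⊓n≡n (subst (suc s ≤_) (sym k≡) (s≤s (<⇒≤ s<m)))))

    module Output (t : ℕ → ℕ) (t≡ : ∀ s → s < lookup π 1F → lookup σ 7F (+ s) ≡ + t s) where

      marked : ℕ → ℕ → Bool
      marked k i = foldn k (λ s b → if does (t s ≟ i) then true else b) false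

      mark-value : ∀ i → ⟪ markᴱ ⟫ (+ i ∷ []) ≡ (if marked (lookup π 1F) i then 1ℤ else 0ℤ)
      mark-value i = foldn-invariant v {lookup π 1F} refl step
        where
        v : ℕ → ℤ
        v s = if marked s i then 1ℤ else 0ℤ
        step : ∀ s → s < lookup π 1F →
          (if pos? (lookup σ 7F (+ s) ℤ.- + i) then v s else (if pos? (+ i ℤ.- lookup σ 7F (+ s)) then v s else 1ℤ)) ≡ v (suc s)
        step s s<k with <-cmp (t s) i
        ... | tri> _ ne i<t = trans (if-true (trans (pos?-minus (t s) i (t≡ s s<k) refl) (<ᵇ-true i<t)))
          (cong (λ b → if b then 1ℤ else 0ℤ) (sym (if-false (dec-false (t s ≟ i) ne))))
        ... | tri≈ _ eq _ = trans (if-false (trans (pos?-minus (t s) i (t≡ s s<k) refl) (<ᵇ-false (≤-reflexive eq))))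
          (trans (if-false (trans (pos?-minus i (t s) refl (t≡ s s<k)) (<ᵇ-false (≤-reflexive (sym eq)))))
            (cong (λ b → if b then 1ℤ else 0ℤ) (sym (if-true (dec-true (t s ≟ i) eq)))))
        ... | tri< t<i ne _ = trans (if-false (trans (pos?-minus (t s) i (t≡ s s<k) refl) (<ᵇ-false (<⇒≤ t<i))))
          (trans (if-true (trans (pos?-minus i (t s) refl (t≡ s s<k)) (<ᵇ-true t<i)))
            (cong (λ b → if b then 1ℤ else 0ℤ) (sym (if-false (dec-false (t s ≟ i) ne)))))

      module _ (s : ℕ) (s<k : suc s < lookup π 1F) where

        private
          here : lookup σ 7F (+ s) ≡ + t s
          here = t≡ s (<-trans (n<1+n s) s<k)
          there : lookup σ 7F (+ s ℤ.+ 1ℤ) ≡ + t (suc s)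
          there = trans (cong (λ z → lookup σ 7F (+ z)) (+-comm s 1)) (t≡ (suc s) s<k)

        min-value : ⟪ minᴱ ⟫ (+ s ∷ []) ≡ + (if t (suc s) <ᵇ t s then t (suc s) else t s)
        min-value = trans (if-cong (pos?-minus (t s) (t (suc s)) here there) there here) (if-+ (t (suc s) <ᵇ t s))

        max-value : ⟪ maxᴱ ⟫ (+ s ∷ []) ≡ + (if t (suc s) <ᵇ t s then t s else t (suc s))
        max-value = trans (if-cong (pos?-minus (t s) (t (suc s)) here there) here there) (if-+ (t (suc s) <ᵇ t s))

-- Clearing denominators and transferring the ratio

module Scale where

  open import Defs using (_^ℚ_)
  open Compiler using (foldn; ^-distribʳ-*)
  open Algorithm using (others; if-true; if-false; ∣+-+∣)
  open import Data.Integer.Base as ℤ using (ℤ; +_; 1ℤ)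
  open import Data.Nat.Base hiding (_/_)
  open import Data.Rational.Base as ℚ using (ℚ; ↥_; ↧_; ↧ₙ_; toℚᵘ)
  import Data.Rational.Properties as ℚ
  open import Data.Rational.Unnormalised.Base as ℚᵘ using (ℚᵘ; mkℚᵘ; *≡*; *≤*)
  import Data.Rational.Unnormalised.Properties as ℚᵘ

  ι : ℤ → ℚ
  ι z = z ℚ./ 1

  toℚᵘ-ι : ∀ z → toℚᵘ (ι z) ℚᵘ.≃ mkℚᵘ z 0
  toℚᵘ-ι z = ℚ.toℚᵘ-fromℚᵘ (mkℚᵘ z 0)

  ι-+ : ∀ a b → ι (a ℤ.+ b) ≡ ι a ℚ.+ ι b
  ι-+ a b = ℚ.toℚᵘ-injective (ℚᵘ.≃-trans (toℚᵘ-ι (a ℤ.+ b)) (ℚᵘ.≃-trans (*≡* (ring a b))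
    (ℚᵘ.≃-sym (ℚᵘ.≃-trans (ℚ.toℚᵘ-homo-+ (ι a) (ι b)) (ℚᵘ.+-cong (toℚᵘ-ι a) (toℚᵘ-ι b))))))
    where
    ring : ∀ a b → (a ℤ.+ b) ℤ.* 1ℤ ≡ (a ℤ.* 1ℤ ℤ.+ b ℤ.* 1ℤ) ℤ.* 1ℤ
    ring = ℤ-Solver.solve-∀

  ι-* : ∀ a b → ι (a ℤ.* b) ≡ ι a ℚ.* ι b
  ι-* a b = ℚ.toℚᵘ-injective (ℚᵘ.≃-trans (toℚᵘ-ι (a ℤ.* b)) (ℚᵘ.≃-trans (*≡* refl)
    (ℚᵘ.≃-sym (ℚᵘ.≃-trans (ℚ.toℚᵘ-homo-* (ι a) (ι b)) (ℚᵘ.*-cong (toℚᵘ-ι a) (toℚᵘ-ι b))))))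

  ι-neg : ∀ a → ι (ℤ.- a) ≡ ℚ.- ι a
  ι-neg a = ℚ.toℚᵘ-injective (ℚᵘ.≃-trans (toℚᵘ-ι (ℤ.- a))
    (ℚᵘ.≃-sym (ℚᵘ.≃-trans (ℚ.toℚᵘ-homo‿- (ι a)) (ℚᵘ.-‿cong (toℚᵘ-ι a)))))

  ι-∣∣ : ∀ a → ι (+ ℤ.∣ a ∣) ≡ ℚ.∣ ι a ∣
  ι-∣∣ a = ℚ.toℚᵘ-injective (ℚᵘ.≃-trans (toℚᵘ-ι (+ ℤ.∣ a ∣)) (ℚᵘ.≃-trans (*≡* refl)
    (ℚᵘ.≃-sym (ℚᵘ.≃-trans (ℚ.toℚᵘ-homo-∣-∣ (ι a)) (ℚᵘ.∣-∣-cong (toℚᵘ-ι a))))))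

  ι-mono : ∀ {a b} → a ℤ.≤ b → ι a ℚ.≤ ι b
  ι-mono {a} {b} a≤b = ℚ.toℚᵘ-cancel-≤ (ℚᵘ.≤-respˡ-≃ (ℚᵘ.≃-sym (toℚᵘ-ι a)) (ℚᵘ.≤-respʳ-≃ (ℚᵘ.≃-sym (toℚᵘ-ι b))
    (*≤* (ℤ.*-monoʳ-≤-nonNeg 1ℤ a≤b))))

  ι-numerator : ∀ q → ι (↥ q) ≡ ι (↧ q) ℚ.* q
  ι-numerator q@record{} = ℚ.toℚᵘ-injective (ℚᵘ.≃-trans (toℚᵘ-ι (↥ q)) (ℚᵘ.≃-trans (*≡* (ring (↥ q) (↧ q)))
    (ℚᵘ.≃-sym (ℚᵘ.≃-trans (ℚ.toℚᵘ-homo-* (ι (↧ q)) q) (ℚᵘ.*-cong {x = toℚᵘ (ι (↧ q))} {y = mkℚᵘ (↧ q) 0} {u = toℚᵘ q} {v = toℚᵘ q} (toℚᵘ-ι (↧ q)) ℚᵘ.≃-refl)))))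
    where
    ring : ∀ n d → n ℤ.* (1ℤ ℤ.* d) ≡ d ℤ.* n ℤ.* 1ℤ
    ring = ℤ-Solver.solve-∀

  ι-^ : ∀ a n → ι (+ (a ^ n)) ≡ ι (+ a) ^ℚ n
  ι-^ a zero    = refl
  ι-^ a (suc n) = trans (cong ι (ℤ.pos-* a (a ^ n))) (trans (ι-* (+ a) (+ (a ^ n))) (cong (ι (+ a) ℚ.*_) (ι-^ a n)))

  interchange : ∀ a b c d → a ℚ.* b ℚ.* (c ℚ.* d) ≡ a ℚ.* c ℚ.* (b ℚ.* d)
  interchange a b c d = trans (ℚ.*-assoc a b (c ℚ.* d)) (trans (cong (a ℚ.*_)
    (trans (sym (ℚ.*-assoc b c d)) (trans (cong (ℚ._* d) (ℚ.*-comm b c)) (ℚ.*-assoc c b d)))) (sym (ℚ.*-assoc a c (b ℚ.* d))))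

  ^ℚ-distrib-* : ∀ p q n → (p ℚ.* q) ^ℚ n ≡ p ^ℚ n ℚ.* q ^ℚ n
  ^ℚ-distrib-* p q zero    = refl
  ^ℚ-distrib-* p q (suc n) = trans (cong (p ℚ.* q ℚ.*_) (^ℚ-distrib-* p q n)) (interchange p q (p ^ℚ n) (q ^ℚ n))

  ι-positive : ∀ {a} → 0 < a → ℚ.Positive (ι (+ a))
  ι-positive {suc a} _ = ℚ.normalize-pos (suc a) 1

  -- Both lengths become natural numbers when multiplied by the same D. The estimate is made there,
  -- where fourth powers are monotone, and the common factor D^4 is cancelled.
  transfer : ∀ {l l* : ℚ} {D w w* f c k : ℕ} → 0 < D → ι (+ w) ≡ ι (+ D) ℚ.* l → ι (+ w*) ≡ ι (+ D) ℚ.* l* →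
    w ≤ f * w* → f ^ 4 ≤ c ^ 4 * k → l ^ℚ 4 ℚ.≤ ι (+ c) ^ℚ 4 ℚ.* ι (+ k) ℚ.* l* ^ℚ 4
  transfer {l} {l*} {D} {w} {w*} {f} {c} {k} 0<D eq eq* w≤ f≤ = ℚ.*-cancelˡ-≤-pos (ι (+ (D ^ 4))) {{ι-positive (m^n>0 D {{>-nonZero 0<D}} 4)}}
    (subst₂ ℚ._≤_ lhs rhs (ι-mono (ℤ.+≤+ bound)))
    where
    bound : w ^ 4 ≤ c ^ 4 * k * w* ^ 4
    bound = begin
      w ^ 4                     ≤⟨ ^-monoˡ-≤ 4 w≤ ⟩
      (f * w*) ^ 4              ≡⟨ ^-distribʳ-* 4 f w* ⟩
      f ^ 4 * w* ^ 4            ≤⟨ *-monoˡ-≤ (w* ^ 4) f≤ ⟩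
      c ^ 4 * k * w* ^ 4        ∎
      where
      open ≤-Reasoning
    power : ∀ {v m} → ι (+ v) ≡ ι (+ D) ℚ.* m → ι (+ (v ^ 4)) ≡ ι (+ (D ^ 4)) ℚ.* m ^ℚ 4
    power {v} {m} e = trans (ι-^ v 4) (trans (cong (_^ℚ 4) e) (trans (^ℚ-distrib-* (ι (+ D)) m 4)
      (cong (ℚ._* m ^ℚ 4) (sym (ι-^ D 4)))))
    lhs : ι (+ (w ^ 4)) ≡ ι (+ (D ^ 4)) ℚ.* l ^ℚ 4
    lhs = power {w} {l} eq
    rhs : ι (+ (c ^ 4 * k * w* ^ 4)) ≡ ι (+ (D ^ 4)) ℚ.* (ι (+ c) ^ℚ 4 ℚ.* ι (+ k) ℚ.* l* ^ℚ 4)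
    rhs = trans (cong ι (ℤ.pos-* (c ^ 4 * k) (w* ^ 4))) (trans (ι-* (+ (c ^ 4 * k)) (+ (w* ^ 4)))
      (trans (cong₂ ℚ._*_ (trans (cong ι (ℤ.pos-* (c ^ 4) k)) (trans (ι-* (+ (c ^ 4)) (+ k)) (cong (ℚ._* ι (+ k)) (ι-^ c 4)))) (power {w*} {l*} eq*))
        (swap (ι (+ c) ^ℚ 4 ℚ.* ι (+ k)) (ι (+ (D ^ 4))) (l* ^ℚ 4))))
      where
      swap : ∀ x y z → x ℚ.* (y ℚ.* z) ≡ y ℚ.* (x ℚ.* z)
      swap x y z = trans (sym (ℚ.*-assoc x y z)) (trans (cong (ℚ._* z) (ℚ.*-comm x y)) (ℚ.*-assoc y x z))

  module Scaling (q : ℕ → ℚ) where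

    num : ℕ → ℤ
    num c = ↥ (q c)

    den : ℕ → ℕ
    den c = ↧ₙ (q c)

    full : ℕ → ℕ
    full m = foldn m (λ d acc → acc * den d) 1

    others-before : ∀ c m → m ≤ c → others den c m ≡ full m
    others-before c zero    _   = refl
    others-before c (suc m) m<c = trans (if-false (dec-false (m ≟ c) (<⇒≢ m<c))) (cong (_* den m) (others-before c m (<⇒≤ m<c)))

    -- Once position c has been passed, the product lacks exactly the factor `den c`. Hence scaling
    -- numerators by `others` multiplies all coordinates by one and the same number, `full`.
    others-after : ∀ c m → c < m → others den c m * den c ≡ full m
    others-after c (suc m) (s≤s c≤m) with m ≟ c
    ... | yes refl = cong (_* den c) (trans (if-true (dec-true (m ≟ c) refl)) (others-before c m ≤-refl))
    ... | no m≢c   = trans (cong (_* den c) (if-false (dec-false (m ≟ c) m≢c)))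
      (trans (swap (others den c m) (den m) (den c)) (cong (_* den m) (others-after c m (≤∧≢⇒< c≤m (≢-sym m≢c)))))
      where
      swap : ∀ x y z → x * y * z ≡ x * z * y
      swap = solve-∀

    full-positive : ∀ m → 0 < full m
    full-positive zero    = s≤s z≤n
    full-positive (suc m) = *-mono-≤ (full-positive m) (s≤s z≤n)

    others-bound : ∀ {ℓ} c m → (∀ d → d < m → den d ≤ 2 ^ ℓ) → others den c m ≤ 2 ^ (m * ℓ)
    others-bound c zero    _ = ≤-refl
    others-bound {ℓ} c (suc m) h with m ≟ c
    ... | yes e = ≤-trans (≤-reflexive (if-true (dec-true (m ≟ c) e)))
      (≤-trans (others-bound c m (λ d d<m → h d (m<n⇒m<1+n d<m))) (^-monoʳ-≤ 2 (m≤n+m (m * ℓ) ℓ)))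
    ... | no ne = ≤-trans (≤-reflexive (if-false (dec-false (m ≟ c) ne)))
      (≤-trans (*-mono-≤ (others-bound c m (λ d d<m → h d (m<n⇒m<1+n d<m))) (h m ≤-refl))
        (≤-reflexive (trans (*-comm (2 ^ (m * ℓ)) (2 ^ ℓ)) (sym (^-distribˡ-+-* 2 ℓ (m * ℓ))))))

    module _ (N : ℕ) where

      scaled : ℕ → ℤ
      scaled c = num c ℤ.* + others den c N

      ι-scaled : ∀ c → c < N → ι (scaled c) ≡ ι (+ full N) ℚ.* q c
      ι-scaled c c<N = trans (ι-* (num c) (+ others den c N)) (trans (cong (ℚ._* ι (+ others den c N)) (ι-numerator (q c)))
        (trans (swap (ι (+ den c)) (q c) (ι (+ others den c N)))
          (cong (ℚ._* q c) (trans (sym (ι-* (+ others den c N) (+ den c)))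
            (cong ι (trans (sym (ℤ.pos-* (others den c N) (den c))) (cong +_ (others-after c N c<N))))))))
        where
        swap : ∀ x y z → x ℚ.* y ℚ.* z ≡ z ℚ.* x ℚ.* y
        swap x y z = trans (ℚ.*-comm (x ℚ.* y) z) (sym (ℚ.*-assoc z x y))

      -- The width B is chosen so that this exponent is B - 1: the offset 2^(B - 1) then makes
      -- coordinates positive, and the shifted ones have B bits.
      scaled-bound : ∀ {ℓ} c → (∀ d → d < N → den d ≤ 2 ^ ℓ) → ℤ.∣ num c ∣ < 2 ^ ℓ → ℤ.∣ scaled c ∣ < 2 ^ (N * ℓ + ℓ)
      scaled-bound {ℓ} c h num< = begin-strict
        ℤ.∣ scaled c ∣                          ≡⟨ ℤ.abs-* (num c) (+ others den c N) ⟩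
        ℤ.∣ num c ∣ * others den c N            ≤⟨ *-monoʳ-≤ ℤ.∣ num c ∣ (others-bound c N h) ⟩
        ℤ.∣ num c ∣ * 2 ^ (N * ℓ)               <⟨ *-monoˡ-< (2 ^ (N * ℓ)) {{>-nonZero (m^n>0 2 (N * ℓ))}} num< ⟩
        2 ^ ℓ * 2 ^ (N * ℓ)                     ≡⟨ *-comm (2 ^ ℓ) _ ⟩
        2 ^ (N * ℓ) * 2 ^ ℓ                     ≡⟨ ^-distribˡ-+-* 2 (N * ℓ) ℓ ⟨
        2 ^ (N * ℓ + ℓ)                         ∎
        where open ≤-Reasoning

      shifted : ℕ → ℕ → ℕ
      shifted o c = ℤ.∣ scaled c ℤ.+ + o ∣

      module _ {o c : ℕ} (small : ℤ.∣ scaled c ∣ < o) where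

        private
          shift : ∀ z → ℤ.∣ z ∣ < o → + ℤ.∣ z ℤ.+ + o ∣ ≡ z ℤ.+ + o × ℤ.∣ z ℤ.+ + o ∣ < o + o
          shift (+ a)      a<o = refl , +-monoˡ-< o a<o
          shift ℤ.-[1+ a ] a<o rewrite ℤ.⊖-≥ (<⇒≤ a<o) = refl , ≤-<-trans (m∸n≤m o (suc a)) (m<m+n o (≤-trans (s≤s z≤n) a<o))

        shifted-value : + shifted o c ≡ scaled c ℤ.+ + o
        shifted-value = proj₁ (shift (scaled c) small)

        shifted-bound : shifted o c < o + o
        shifted-bound = proj₂ (shift (scaled c) small)

      -- The common offset cancels in the difference, and the common factor can be taken out of the
      -- absolute value.
      ι-difference : ∀ {o a b} → a < N → b < N → ℤ.∣ scaled a ∣ < o → ℤ.∣ scaled b ∣ < o →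
        ι (+ ∣ shifted o a - shifted o b ∣) ≡ ι (+ full N) ℚ.* ℚ.∣ q a ℚ.- q b ∣
      ι-difference {o} {a} {b} a<N b<N a< b< = begin
        ι (+ ∣ shifted o a - shifted o b ∣)                        ≡⟨ cong (λ z → ι (+ z)) (∣+-+∣ (shifted o a) (shifted o b)) ⟨
        ι (+ ℤ.∣ + shifted o a ℤ.- + shifted o b ∣)                ≡⟨ cong (λ z → ι (+ ℤ.∣ z ∣)) (trans (cong₂ ℤ._-_ (shifted-value a<) (shifted-value b<)) (ring (scaled a) (scaled b) (+ o))) ⟩
        ι (+ ℤ.∣ scaled a ℤ.+ ℤ.- scaled b ∣)                      ≡⟨ ι-∣∣ (scaled a ℤ.+ ℤ.- scaled b) ⟩
        ℚ.∣ ι (scaled a ℤ.+ ℤ.- scaled b) ∣                        ≡⟨ cong ℚ.∣_∣ (trans (ι-+ (scaled a) (ℤ.- scaled b)) (cong (ι (scaled a) ℚ.+_) (ι-neg (scaled b)))) ⟩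
        ℚ.∣ ι (scaled a) ℚ.- ι (scaled b) ∣                        ≡⟨ cong ℚ.∣_∣ (cong₂ ℚ._-_ (ι-scaled a a<N) (ι-scaled b b<N)) ⟩
        ℚ.∣ D ℚ.* q a ℚ.- D ℚ.* q b ∣                              ≡⟨ cong ℚ.∣_∣ (trans (cong (D ℚ.* q a ℚ.+_) (ℚ.neg-distribʳ-* D (q b))) (sym (ℚ.*-distribˡ-+ D (q a) (ℚ.- q b)))) ⟩
        ℚ.∣ D ℚ.* (q a ℚ.- q b) ∣                                  ≡⟨ ℚ.∣p*q∣≡∣p∣*∣q∣ D (q a ℚ.- q b) ⟩
        ℚ.∣ D ∣ ℚ.* ℚ.∣ q a ℚ.- q b ∣                              ≡⟨ cong (ℚ._* ℚ.∣ q a ℚ.- q b ∣) (sym (ι-∣∣ (+ full N))) ⟩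
        D ℚ.* ℚ.∣ q a ℚ.- q b ∣                                    ∎
        where
        open ≡-Reasoning
        D : ℚ
        D = ι (+ full N)
        ring : ∀ a b o → a ℤ.+ o ℤ.- (b ℤ.+ o) ≡ a ℤ.+ ℤ.- b
        ring = ℤ-Solver.solve-∀

-- Tables, tree and output for a given instance

module Construct where

  open Compiler
  open Preamble
  open Walks
  open Morton using (morton; mortonHierarchy; suc-∸; quotient-≤; quotient-remainder)
  open PathTree
  open Optimum
  open Algorithm
  open Scale
  open import Defs using (Point; Graph; L₁; vertices; edges; encodePoint; encodeGraph; Connected)
  open import Data.Fin.Base as Fin using (Fin; zero; suc; toℕ; fromℕ<)
  open import Data.Fin.Patterns
  open import Data.Fin.Subset using (∣_∣; Nonempty)
  open import Data.Integer.Base as ℤ using (ℤ; +_; 0ℤ; 1ℤ)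
  open import Data.List.Base as List using (List; []; _∷_; _++_; length; concatMap; allFin; take; applyUpTo)
  import Data.List.Properties as List
  open import Data.List.Relation.Unary.All using (All; []; _∷_)
  open import Data.List.Relation.Unary.AllPairs using ([]; _∷_)
  open import Data.List.Relation.Unary.Linked using (Linked; []; [-]; _∷_)
  open import Data.List.Relation.Unary.Linked.Properties using (AllPairs⇒Linked)
  import Data.List.Relation.Unary.Unique.Propositional.Properties as Unique
  open import Data.Nat.Base hiding (_/_)
  open import Data.Nat.ListAction using (sum)
  open import Data.Nat.ListAction.Properties using (sum-++)
  open import Data.Rational.Base as ℚ using (ℚ; 0ℚ; ↥_; ↧_)
  import Data.Rational.Properties as ℚ
  open import Data.Vec.Base using (Vec; []; _∷_; lookup; _[_]≔_; tabulate; toList)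

  -- One sequence with abscissas at even and ordinates at odd positions, as in the input; past the
  -- end it defaults to 0.
  coordinate : ∀ {n} → Vec Point n → ℕ → ℚ
  coordinate []             _             = 0ℚ
  coordinate ((x , y) ∷ ps) zero          = x
  coordinate ((x , y) ∷ ps) (suc zero)    = y
  coordinate ((x , y) ∷ ps) (suc (suc c)) = coordinate ps c

  pairs : ∀ {n} → Vec Point n → List (ℤ × ℤ)
  pairs []             = []
  pairs ((x , y) ∷ ps) = (↥ x , ↧ x) ∷ (↥ y , ↧ y) ∷ pairs ps

  flatten-pairs : ∀ {n} (ps : Vec Point n) → flatten (pairs ps) ≡ concatMap encodePoint (toList ps)
  flatten-pairs []             = refl
  flatten-pairs ((x , y) ∷ ps) = cong (λ l → ↥ x ∷ ↧ x ∷ ↥ y ∷ ↧ y ∷ l) (flatten-pairs ps)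

  length-pairs : ∀ {n} (ps : Vec Point n) → n + n ≡ length (pairs ps)
  length-pairs []                     = refl
  length-pairs {suc n} ((x , y) ∷ ps) = cong suc (trans (+-suc n n) (cong suc (length-pairs ps)))

  nth-pairs : ∀ {n} (ps : Vec Point n) c → c < n + n → nth (pairs ps) c ≡ (↥ coordinate ps c , ↧ coordinate ps c)
  nth-pairs ((x , y) ∷ ps) zero          _ = refl
  nth-pairs ((x , y) ∷ ps) (suc zero)    _ = refl
  nth-pairs {suc n} ((x , y) ∷ ps) (suc (suc c)) (s≤s c<) =
    nth-pairs ps c (s≤s⁻¹ (subst (suc c <_) (+-suc n n) c<))

  coordinate-x : ∀ {n} (ps : Vec Point n) i → coordinate ps (toℕ i + toℕ i) ≡ proj₁ (lookup ps i)
  coordinate-x ((x , y) ∷ ps) zero    = refl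
  coordinate-x ((x , y) ∷ ps) (suc i) =
    trans (cong (coordinate ((x , y) ∷ ps) ∘ suc) (+-suc (toℕ i) (toℕ i))) (coordinate-x ps i)

  coordinate-y : ∀ {n} (ps : Vec Point n) i → coordinate ps (toℕ i + toℕ i + 1) ≡ proj₂ (lookup ps i)
  coordinate-y ((x , y) ∷ ps) zero    = refl
  coordinate-y ((x , y) ∷ ps) (suc i) =
    trans (cong (λ z → coordinate ((x , y) ∷ ps) (suc z + 1)) (+-suc (toℕ i) (toℕ i))) (coordinate-y ps i)

  double-half : ∀ {B} → 0 < B → 2 ^ (B ∸ 1) + 2 ^ (B ∸ 1) ≡ 2 ^ B
  double-half {suc B} _ = cong (λ z → 2 ^ B + z) (sym (+-identityʳ (2 ^ B)))

  if-float : ∀ {A B : Set} (f : A → B) b {x y} → (if b then f x else f y) ≡ f (if b then x else y)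
  if-float f true  = refl
  if-float f false = refl

  applyUpTo-tabulate : ∀ {A : Set} l (f : ℕ → A) (g : Fin l → Bool) (h : Bool → A) →
    (∀ i → f (toℕ i) ≡ h (g i)) → applyUpTo f l ≡ List.map h (toList (tabulate g))
  applyUpTo-tabulate zero    f g h eq = refl
  applyUpTo-tabulate (suc l) f g h eq = cong₂ _∷_ (eq zero) (applyUpTo-tabulate l (f ∘ suc) (g ∘ suc) h (eq ∘ suc))

  module Construction {n m : ℕ} (m<n : m < n) (ps : Vec Point n) {ℓ : ℕ}
                      (input< : magnitudes (pairs ps) (n + n) < 2 ^ ℓ) where

    0<n : 0 < n
    0<n = ≤-<-trans z≤n m<n

    π : Params
    π = parameters n (suc m) ℓ

    N B o : ℕ
    N = n + n
    B = width n ℓ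
    o = 2 ^ (B ∸ 1)

    B-1≡ : B ∸ 1 ≡ N * ℓ + ℓ
    B-1≡ = cong (_∸ 1) (+-suc (N * ℓ) ℓ)

    0<B : 0 < B
    0<B = subst (0 <_) (sym (+-suc (N * ℓ) ℓ)) (s≤s z≤n)

    q : ℕ → ℚ
    q = coordinate ps

    open Scaling q

    magnitude< : ∀ c → c < N → ℤ.∣ num c ∣ + den c < 2 ^ ℓ
    magnitude< c c<N = ≤-<-trans (≤-reflexive (cong magnitude (sym (nth-pairs ps c c<N))))
      (≤-<-trans (magnitude≤magnitudes (pairs ps) c<N) input<)

    den≤ : ∀ c → c < N → den c ≤ 2 ^ ℓ
    den≤ c c<N = <⇒≤ (≤-<-trans (m≤n+m (den c) ℤ.∣ num c ∣) (magnitude< c c<N))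

    scaled< : ∀ c → c < N → ℤ.∣ scaled N c ∣ < o
    scaled< c c<N = subst (λ z → ℤ.∣ scaled N c ∣ < 2 ^ z) (sym B-1≡)
      (scaled-bound N c den≤ (≤-<-trans (m≤m+n ℤ.∣ num c ∣ (den c)) (magnitude< c c<N)))

    abstract
      V : ℕ → ℕ
      V = shifted N o

      V-value : ∀ {c} → c < N → + V c ≡ scaled N c ℤ.+ + o
      V-value c<N = shifted-value N (scaled< _ c<N)

      V<2o : ∀ {c} → c < N → V c < o + o
      V<2o c<N = shifted-bound N (scaled< _ c<N)

      ι-V : ∀ {a b} → a < N → b < N → ι (+ ∣ V a - V b ∣) ≡ ι (+ full N) ℚ.* ℚ.∣ q a ℚ.- q b ∣
      ι-V a<N b<N = ι-difference N a<N b<N (scaled< _ a<N) (scaled< _ b<N)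

    X Y : ℕ → ℕ
    X i = V (i + i)
    Y i = V (i + i + 1)

    V< : ∀ c → c < N → V c < 2 ^ B
    V< c c<N = subst (V c <_) (double-half 0<B) (V<2o c<N)

    2i< : ∀ {i} → i < n → i + i < N
    2i< i<n = +-mono-< i<n i<n

    2i+1< : ∀ {i} → i < n → i + i + 1 < N
    2i+1< {i} i<n = subst (_≤ N) (lemma i) (+-mono-≤ i<n i<n)
      where
      lemma : ∀ i → suc i + suc i ≡ suc (i + i + 1)
      lemma = solve-∀

    label : ℕ → ℕ
    label i = n * morton B (X i) (Y i) + i

    d : ℕ → ℕ → ℕ
    d j i = ∣ X j - X i ∣ + ∣ Y j - Y i ∣

    inf : ℕ
    inf = infinity (suc m) o

    open Increasing label d inf n m 0<n

    module Fill (σ : Arrays) (a : Fin 8) (p : Fin 7) (e : Ex 1) where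

      contents : ℤ → ℤ
      contents = filled π σ a e (lookup π p)

      private module F = Filling (filled π σ a e) (λ t → eval π (σ [ a ]≔ filled π σ a e t) (+ t ∷ []) e) (λ _ → refl)

      at : ∀ {t} → t < lookup π p → contents (+ t) ≡ eval π (σ [ a ]≔ filled π σ a e t) (+ t ∷ []) e
      at = F.filled-at

      before : ∀ {s t} → s < t → t ≤ lookup π p → filled π σ a e t (+ s) ≡ contents (+ s)
      before = F.stable-≤

    record Prepared (σ : Arrays) : Set where
      field
        powers : ∀ j → j < B → lookup σ 2F (+ j) ≡ + (2 ^ j)
        values : ∀ c → c < N → lookup σ 3F (+ c) ≡ + V c
        labels : ∀ i → i < n → lookup σ 4F (+ i) ≡ + label i

    module _ {σ : Arrays} (prepared : Prepared σ) where

      open Prepared prepared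
      open Evaluation π σ hiding (B)
      open Bits powers

      step-value : ∀ {Γ} (ρ : Vec ℤ Γ) (jv iv : Fin Γ) j i → lookup ρ jv ≡ + j → lookup ρ iv ≡ + i → j < n → i < n →
        ⟪ stepᴱ jv iv ⟫ ρ ≡ + w j i
      step-value ρ jv iv j i j≡ i≡ j<n i<n = trans
        (if-cong (pos?-minus (label i) (label j)
                    (trans (cong (lookup σ 4F) i≡) (labels i i<n)) (trans (cong (lookup σ 4F) j≡) (labels j j<n)))
          (distance-value ρ X Y jv iv j≡ i≡ (λ u u<n → values _ (2i< u<n)) (λ u u<n → values _ (2i+1< u<n)) j<n i<n)
          (infinity-value 0<B ρ))
        (if-+ (label j <ᵇ label i))

    σ₀ σ₂ σ₃ σ₄ σ₅ σ₆ σ₇ : Arrays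
    σ₀ = inputArrays (pairs ps) N
    σ₂ = σ₀ [ 2F ]≔ Fill.contents σ₀ 2F 6F powersᴱ
    σ₃ = σ₂ [ 3F ]≔ Fill.contents σ₂ 3F 2F scaledᴱ
    σ₄ = σ₃ [ 4F ]≔ Fill.contents σ₃ 4F 0F labelᴱ
    σ₅ = σ₄ [ 5F ]≔ Fill.contents σ₄ 5F 5F costᴱ
    σ₆ = σ₅ [ 6F ]≔ Fill.contents σ₅ 6F 5F backᴱ
    σ₇ = σ₆ [ 7F ]≔ Fill.contents σ₆ 7F 1F traceᴱ

    powers₂ : ∀ j → j < B → Fill.contents σ₀ 2F 6F powersᴱ (+ j) ≡ + (2 ^ j)
    powers₂ j j<B = trans (Fill.at σ₀ 2F 6F powersᴱ j<B) (Evaluation.powers-value π σ₀ j j<B)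

    values₃ : ∀ c → c < N → Fill.contents σ₂ 3F 2F scaledᴱ (+ c) ≡ + V c
    values₃ c c<N = trans (Fill.at σ₂ 3F 2F scaledᴱ c<N) (trans
      (Evaluation.Bits.scaled-value π (σ₂ [ 3F ]≔ filled π σ₂ 3F scaledᴱ c) powers₂ 0<B num den
        (λ d d<N → trans (load-at _ d<N) (cong proj₁ (nth-pairs ps d d<N)))
        (λ d d<N → trans (load-at _ d<N) (cong proj₂ (nth-pairs ps d d<N)))
        den< c c<N)
      (sym (V-value c<N)))
      where
      den< : ∀ d → d < N → den d < 2 ^ B
      den< d d<N = <-≤-trans (≤-<-trans (m≤n+m (den d) ℤ.∣ num d ∣) (magnitude< d d<N))
        (^-monoʳ-≤ 2 (≤-trans (n≤1+n ℓ) (m≤n+m (1 + ℓ) (N * ℓ))))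

    labels₄ : ∀ i → i < n → Fill.contents σ₃ 4F 0F labelᴱ (+ i) ≡ + label i
    labels₄ i i<n = trans (Fill.at σ₃ 4F 0F labelᴱ i<n)
      (Evaluation.Bits.label-value π (σ₃ [ 4F ]≔ filled π σ₃ 4F labelᴱ i) powers₂ i (X i) (Y i)
        (values₃ _ (2i< i<n)) (values₃ _ (2i+1< i<n)) (V< _ (2i< i<n)) (V< _ (2i+1< i<n)))

    -- Powers, coordinates and labels occupy other arrays than costs, predecessors and path.
    -- Arbitrary f, g, h cover every intermediate stage of filling the latter.
    prepared : ∀ f g h → Prepared (((σ₄ [ 5F ]≔ f) [ 6F ]≔ g) [ 7F ]≔ h)
    prepared f g h = record { powers = powers₂ ; values = values₃ ; labels = labels₄ }

    entry< : ∀ {c i} → c ≤ m → i < n → c * n + i < suc m * n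
    entry< {c} {i} c≤m i<n = <-≤-trans (+-monoʳ-< (c * n) i<n)
      (≤-trans (≤-reflexive (+-comm (c * n) n)) (*-monoˡ-≤ n (s≤s c≤m)))

    unset : Fin 8 → ℤ → ℤ
    unset = lookup σ₀

    -- Induction on the row. An entry of row `suc c` has position at least (c + 1) n, so all of row
    -- c precedes it and is final when it is read.
    costs₅ : ∀ c → c ≤ m → ∀ i → i < n → Fill.contents σ₄ 5F 5F costᴱ (+ (c * n + i)) ≡ + cost c i
    costs₅ zero _ i i<n = trans (Fill.at σ₄ 5F 5F costᴱ (entry< {0} z≤n i<n))
      (Evaluation.Costs.cost-zero-value π (σ₄ [ 5F ]≔ filled π σ₄ 5F costᴱ i) w m 0<n refl
        (step-value (prepared (filled π σ₄ 5F costᴱ i) (unset 6F) (unset 7F))) i i<n)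
    costs₅ (suc c) c<m i i<n = trans (Fill.at σ₄ 5F 5F costᴱ (entry< c<m i<n))
      (Evaluation.Costs.cost-suc-value π (σ₄ [ 5F ]≔ filled π σ₄ 5F costᴱ t) w m 0<n refl
        (step-value (prepared (filled π σ₄ 5F costᴱ t) (unset 6F) (unset 7F))) c
        (λ j j<n → trans (Fill.before σ₄ 5F 5F costᴱ (earlier j<n) (<⇒≤ (entry< c<m i<n))) (costs₅ c (<⇒≤ c<m) j j<n))
        i<n c<m)
      where
      t : ℕ
      t = suc c * n + i
      earlier : ∀ {j} → j < n → c * n + j < t
      earlier j<n = <-≤-trans (+-monoʳ-< (c * n) j<n) (≤-trans (≤-reflexive (+-comm (c * n) n)) (m≤m+n (suc c * n) i))

    backs₆ : ∀ c → c < m → ∀ i → i < n → Fill.contents σ₅ 6F 5F backᴱ (+ (suc c * n + i)) ≡ + back c i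
    backs₆ c c<m i i<n = trans (Fill.at σ₅ 6F 5F backᴱ (entry< c<m i<n))
      (Evaluation.Costs.back-value π (σ₅ [ 6F ]≔ filled π σ₅ 6F backᴱ (suc c * n + i)) w m 0<n refl
        (step-value (prepared (Fill.contents σ₄ 5F 5F costᴱ) (filled π σ₅ 6F backᴱ (suc c * n + i)) (unset 7F))) c
        (costs₅ c (<⇒≤ c<m)) i<n c<m)

    traces₇ : ∀ s → s ≤ m → Fill.contents σ₆ 7F 1F traceᴱ (+ s) ≡ + trace s
    traces₇ zero _ = trans (Fill.at σ₆ 7F 1F traceᴱ {0} (s≤s z≤n))
      (Evaluation.Costs.trace-zero-value π (σ₆ [ 7F ]≔ filled π σ₆ 7F traceᴱ 0) w m 0<n refl
        (step-value (prepared (Fill.contents σ₄ 5F 5F costᴱ) (Fill.contents σ₅ 6F 5F backᴱ) (filled π σ₆ 7F traceᴱ 0)))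
        refl (costs₅ m ≤-refl))
    traces₇ (suc s) s<m = trans (Fill.at σ₆ 7F 1F traceᴱ {suc s} (s≤s s<m))
      (Evaluation.Costs.trace-suc-value π (σ₆ [ 7F ]≔ filled π σ₆ 7F traceᴱ (suc s)) w m 0<n refl
        (step-value (prepared (Fill.contents σ₄ 5F 5F costᴱ) (Fill.contents σ₅ 6F 5F backᴱ) (filled π σ₆ 7F traceᴱ (suc s))))
        refl s s<m
        (trans (Fill.before σ₆ 7F 1F traceᴱ {s} {suc s} ≤-refl (m≤n⇒m≤1+n s<m)) (traces₇ s (<⇒≤ s<m)))
        (backs₆ (m ∸ suc s) (subst (_≤ m) (sym (suc-∸ s<m)) (m∸n≤m m s))))

    outputs≡ : outputs π σ₀ statements ≡ emitted π σ₇ (markᴱ ∷ []) n ++ emitted π σ₇ (minᴱ ∷ maxᴱ ∷ []) m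
    outputs≡ = cong (emitted π σ₇ (markᴱ ∷ []) n ++_) (List.++-identityʳ _)

    H : Hierarchy (Fin n)
    H = mortonHierarchy (X ∘ toℕ) (Y ∘ toℕ) B (λ i → V< _ (2i< (Fin.toℕ<n i))) (λ i → V< _ (2i+1< (Fin.toℕ<n i)))

    labelᶠ : Fin n → ℕ
    labelᶠ = label ∘ toℕ

    -- A label is a number in base n whose last digit is the index, so the index can be read off.
    labelᶠ-injective : ∀ {a b} → labelᶠ a ≡ labelᶠ b → a ≡ b
    labelᶠ-injective {a} {b} eq = Fin.toℕ-injective
      (proj₂ (quotient-remainder n {morton B (X (toℕ a)) (Y (toℕ a))} (Fin.toℕ<n a) (Fin.toℕ<n b) eq))

    label-refines : ∀ {a b} → labelᶠ a ≤ labelᶠ b → Hierarchy.key H 0 a ≤ Hierarchy.key H 0 b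
    label-refines {a} {b} le = quotient-≤ n {d = toℕ a} (Fin.toℕ<n b) le

    dᶠ : Fin n → Fin n → ℕ
    dᶠ = Hierarchy.d H

    -- Shifted coordinates lie between 0 and 2 o, so each of the two contributes at most 2 o; this
    -- is the unit in which `infinity` is measured.
    dᶠ≤ : ∀ a b → dᶠ a b ≤ o + o + (o + o)
    dᶠ≤ a b = +-mono-≤ (near (2i< (Fin.toℕ<n a)) (2i< (Fin.toℕ<n b))) (near (2i+1< (Fin.toℕ<n a)) (2i+1< (Fin.toℕ<n b)))
      where
      near : ∀ {c e} → c < N → e < N → ∣ V c - V e ∣ ≤ o + o
      near {c} {e} c<N e<N = ≤-trans (∣m-n∣≤m⊔n (V c) (V e)) (⊔-lub (<⇒≤ (V<2o c<N)) (<⇒≤ (V<2o e<N)))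

    path-toℕ : ∀ x ys → Paths.pathFrom d (toℕ x) (List.map toℕ ys) ≡ Paths.pathFrom dᶠ x ys
    path-toℕ x []       = refl
    path-toℕ x (y ∷ ys) = cong (λ z → dᶠ x y + z) (path-toℕ y ys)

    linked-toℕ : ∀ {x ys} → Linked (λ a b → labelᶠ a < labelᶠ b) (x ∷ ys) →
      Linked (λ a b → label a < label b) (toℕ x ∷ List.map toℕ ys)
    linked-toℕ {ys = []}     _       = [-]
    linked-toℕ {ys = y ∷ ys} (p ∷ l) = p ∷ linked-toℕ l

    inside : ∀ (xs : List (Fin n)) → All (_< n) (List.map toℕ xs)
    inside []       = []
    inside (x ∷ xs) = Fin.toℕ<n x ∷ inside xs

    cheap : ∀ x ys → Paths.pathFrom dᶠ x ys ≤ length ys * (o + o + (o + o))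
    cheap x []       = z≤n
    cheap x (y ∷ ys) = +-mono-≤ (dᶠ≤ x y) (cheap y ys)

    record Candidate : Set where
      field
        first  : Fin n
        rest   : List (Fin n)
        size   : length rest ≡ m
        sorted : Linked (λ a b → labelᶠ a < labelᶠ b) (first ∷ rest)

      size′ : length (List.map toℕ rest) ≡ m
      size′ = trans (List.length-map toℕ rest) size

      cheap′ : Paths.pathFrom d (toℕ first) (List.map toℕ rest) < inf
      cheap′ = begin-strict
        Paths.pathFrom d (toℕ first) (List.map toℕ rest)     ≡⟨ path-toℕ first rest ⟩
        Paths.pathFrom dᶠ first rest                         ≤⟨ cheap first rest ⟩
        length rest * (o + o + (o + o))                      ≡⟨ cong (_* (o + o + (o + o))) size ⟩
        m * (o + o + (o + o))                                ≤⟨ m≤n+m _ (o + o + (o + o)) ⟩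
        suc m * (o + o + (o + o))                            <⟨ n<1+n _ ⟩
        1 + suc m * (o + o + (o + o))                        ≡⟨ cong suc (+-identityʳ _) ⟨
        inf                                                  ∎
        where open ≤-Reasoning

    -- Some admissible path has to exist before the traced path can be shown to be increasing, hence
    -- free of repetitions. Any k points in the order of their labels provide one, without reference
    -- to an optimal tree.
    first-points : Candidate
    first-points with Sort.sort labelᶠ labelᶠ-injective (take (suc m) (allFin n))
      | Sort.length-sort labelᶠ labelᶠ-injective (take (suc m) (allFin n))
      | Sort.sort-ascending labelᶠ labelᶠ-injective (take (suc m) (allFin n)) (Unique.take⁺ (suc m) (Unique.allFin⁺ n))
    ... | [] | len | _ = contradiction (trans len taken) λ ()
      where
      taken : length (take (suc m) (allFin n)) ≡ suc m
      taken = trans (List.length-take (suc m) (allFin n))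
        (trans (cong (suc m ⊓_) (List.length-tabulate {n = n} (λ i → i))) (m≤n⇒m⊓n≡m m<n))
    ... | x ∷ ys | len | asc = record { first = x ; rest = ys ; size = suc-injective (trans len taken) ; sorted = AllPairs⇒Linked asc }
      where
      taken : length (take (suc m) (allFin n)) ≡ suc m
      taken = trans (List.length-take (suc m) (allFin n))
        (trans (cong (suc m ⊓_) (List.length-tabulate {n = n} (λ i → i))) (m≤n⇒m⊓n≡m m<n))

    abstract
      path : ℕ → ℕ
      path = trace

      path-< : ∀ s → path s < n
      path-< = trace-<

      path-injective : ∀ s t → s ≤ m → t ≤ m → path s ≡ path t → s ≡ t
      path-injective = trace-injective (toℕ first) (List.map toℕ rest) size′ (inside (first ∷ rest)) (linked-toℕ sorted) cheap′
        where open Candidate first-points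

      path-length : ∀ (c : Candidate) →
        sumTo (λ u → d (path (suc u)) (path u)) m ≤ Paths.pathFrom dᶠ (Candidate.first c) (Candidate.rest c)
      path-length c = ≤-trans
        (trace-length (toℕ first) (List.map toℕ rest) size′ (inside (first ∷ rest)) (linked-toℕ sorted) cheap′)
        (≤-reflexive (path-toℕ first rest))
        where open Candidate c

      path₇ : ∀ s → s ≤ m → lookup σ₇ 7F (+ s) ≡ + path s
      path₇ = traces₇

    τ : ℕ → Fin n
    τ s = fromℕ< (path-< s)

    toℕ-τ : ∀ s → toℕ (τ s) ≡ path s
    toℕ-τ s = Fin.toℕ-fromℕ< (path-< s)

    τ-injective : ∀ s t → s ≤ m → t ≤ m → τ s ≡ τ t → s ≡ t
    τ-injective s t s≤m t≤m eq = path-injective s t s≤m t≤m (trans (sym (toℕ-τ s)) (trans (cong toℕ eq) (toℕ-τ t)))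

    module Tree = PathGraph τ m τ-injective

    tree : Graph n
    tree = Tree.pathGraph

    open Tour dᶠ (Hierarchy.d-sym H) using (weight) public

    weight-++ : ∀ es fs → weight (es ++ fs) ≡ weight es + weight fs
    weight-++ es fs = trans (cong sum (List.map-++ (λ (i , j) → dᶠ i j) es fs)) (sum-++ (List.map (λ (i , j) → dᶠ i j) es) _)

    weight-edge : ∀ {l e} → Tree.Orientation l e → weight (e ∷ []) ≡ d (path (suc l)) (path l)
    weight-edge {l} (Tree.descending _) = trans (+-identityʳ (dᶠ (τ (suc l)) (τ l))) (cong₂ d (toℕ-τ (suc l)) (toℕ-τ l))
    weight-edge {l} (Tree.ascending _)  = trans (+-identityʳ (dᶠ (τ l) (τ (suc l))))
      (trans (Hierarchy.d-sym H (τ l) (τ (suc l))) (cong₂ d (toℕ-τ (suc l)) (toℕ-τ l)))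

    weight-edgesTo : ∀ l → weight (Tree.edgesTo l) ≡ sumTo (λ u → d (path (suc u)) (path u)) l
    weight-edgesTo zero    = refl
    weight-edgesTo (suc l) = trans (weight-++ (Tree.edgesTo l) (Tree.edge l ∷ []))
      (cong₂ _+_ (weight-edgesTo l) (weight-edge (Tree.orientation l)))

    -- The vertices of T in increasing order form a candidate, and the traced path is at most as
    -- long as any candidate.
    weight-tree : ∀ (T : Graph n) p → Connected T → Nonempty (vertices T) → ∣ vertices T ∣ ≡ suc m → suc m ≤ 2 ^ p →
      weight (edges tree) ≤ (29 + 100 * p) * 2 * weight (edges T)
    weight-tree T p conn ne size k≤ =
      bounded-by (ascending-path H labelᶠ labelᶠ-injective label-refines T m p conn ne size k≤)
      where
      bounded-by : (∃[ x ] ∃[ ys ] length ys ≡ m × Linked (λ a b → labelᶠ a < labelᶠ b) (x ∷ ys)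
                   × Paths.pathFrom dᶠ x ys ≤ (29 + 100 * p) * 2 * weight (edges T)) →
                weight (edges tree) ≤ (29 + 100 * p) * 2 * weight (edges T)
      bounded-by (x , ys , len , sorted , bound) = ≤-trans (≤-reflexive (weight-edgesTo m)) (≤-trans (path-length c) bound)
        where
        c : Candidate
        c = record { first = x ; rest = ys ; size = len ; sorted = sorted }

    D : ℕ
    D = full N

    ι-distance : ∀ i j → ι (+ dᶠ i j) ≡ ι (+ D) ℚ.* L₁ (lookup ps i) (lookup ps j)
    ι-distance i j = trans (ι-+ (+ ∣ X (toℕ i) - X (toℕ j) ∣) (+ ∣ Y (toℕ i) - Y (toℕ j) ∣))
      (trans (cong₂ ℚ._+_
          (trans (ι-V (2i< i<n) (2i< j<n))
            (cong₂ (λ a b → ι (+ D) ℚ.* ℚ.∣ a ℚ.- b ∣) (coordinate-x ps i) (coordinate-x ps j)))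
          (trans (ι-V (2i+1< i<n) (2i+1< j<n))
            (cong₂ (λ a b → ι (+ D) ℚ.* ℚ.∣ a ℚ.- b ∣) (coordinate-y ps i) (coordinate-y ps j))))
        (sym (ℚ.*-distribˡ-+ (ι (+ D)) _ _)))
      where
      i<n : toℕ i < n
      i<n = Fin.toℕ<n i
      j<n : toℕ j < n
      j<n = Fin.toℕ<n j

    ι-weight : ∀ es → ι (+ weight es) ≡
      ι (+ D) ℚ.* List.foldr ℚ._+_ 0ℚ (List.map (λ (i , j) → L₁ (lookup ps i) (lookup ps j)) es)
    ι-weight []             = sym (ℚ.*-zeroʳ (ι (+ D)))
    ι-weight ((i , j) ∷ es) = trans (ι-+ (+ dᶠ i j) (+ weight es))
      (trans (cong₂ ℚ._+_ (ι-distance i j) (ι-weight es)) (sym (ℚ.*-distribˡ-+ (ι (+ D)) _ _)))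

    module Emission (σ : Arrays) (path≡ : ∀ s → s ≤ m → lookup σ 7F (+ s) ≡ + path s) where

      open Evaluation.Output π σ path (λ s s<k → path≡ s (s≤s⁻¹ s<k))

      marked≡visited : ∀ k i → marked k (toℕ i) ≡ Tree.visited k i
      marked≡visited zero    i = refl
      marked≡visited (suc k) i = if-cong (cong (_≡ᵇ toℕ i) (sym (toℕ-τ k))) refl (marked≡visited k i)

      emitted-marks : ∀ l → emitted π σ (markᴱ ∷ []) l ≡ applyUpTo (λ i → if marked (suc m) i then 1ℤ else 0ℤ) l
      emitted-marks zero    = refl
      emitted-marks (suc l) = trans (cong₂ (λ xs x → xs ++ x ∷ []) (emitted-marks l) (mark-value l))
        (List.applyUpTo-∷ʳ (λ i → if marked (suc m) i then 1ℤ else 0ℤ) l)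

      emitted-edges : ∀ l → l ≤ m →
        emitted π σ (minᴱ ∷ maxᴱ ∷ []) l ≡ concatMap (λ (i , j) → + toℕ i ∷ + toℕ j ∷ []) (Tree.edgesTo l)
      emitted-edges zero    _   = refl
      emitted-edges (suc l) l<m = trans (cong₂ _++_ (emitted-edges l (<⇒≤ l<m)) pair)
        (sym (List.concatMap-++ (λ (i , j) → + toℕ i ∷ + toℕ j ∷ []) (Tree.edgesTo l) (Tree.edge l ∷ [])))
        where
        pair : List.map (eval π σ (+ l ∷ [])) (minᴱ ∷ maxᴱ ∷ []) ≡
          + toℕ (proj₁ (Tree.edge l)) ∷ + toℕ (proj₂ (Tree.edge l)) ∷ []
        pair = cong₂ (λ x y → x ∷ y ∷ [])
          (trans (min-value l (s≤s l<m)) (cong +_ (trans (if-cong same (sym (toℕ-τ (suc l))) (sym (toℕ-τ l))) (if-float (λ (e : Fin n × Fin n) → toℕ (proj₁ e)) turn {τ (suc l) , τ l} {τ l , τ (suc l)}))))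
          (trans (max-value l (s≤s l<m)) (cong +_ (trans (if-cong same (sym (toℕ-τ l)) (sym (toℕ-τ (suc l)))) (if-float (λ (e : Fin n × Fin n) → toℕ (proj₂ e)) turn {τ (suc l) , τ l} {τ l , τ (suc l)}))))
          where
          turn : Bool
          turn = toℕ (τ (suc l)) <ᵇ toℕ (τ l)
          same : (path (suc l) <ᵇ path l) ≡ turn
          same = sym (cong₂ _<ᵇ_ (toℕ-τ (suc l)) (toℕ-τ l))

      emitted-graph : emitted π σ (markᴱ ∷ []) n ++ emitted π σ (minᴱ ∷ maxᴱ ∷ []) m ≡ encodeGraph tree
      emitted-graph = cong₂ _++_
        (trans (emitted-marks n) (applyUpTo-tabulate n _ (Tree.visited (suc m)) (λ b → if b then 1ℤ else 0ℤ)
          (λ i → cong (λ b → if b then 1ℤ else 0ℤ) (marked≡visited (suc m) i))))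
        (emitted-edges m ≤-refl)

    outputs≡encodeGraph : outputs π σ₀ statements ≡ encodeGraph tree
    outputs≡encodeGraph = trans outputs≡ (Emission.emitted-graph σ₇ path₇)

-- Assembling program, time bound and approximation ratio

module Solution where

  open Compiler
  open Preamble
  open Optimum using (module Factor)
  open Algorithm using (statements)
  open Construct
  open Scale using (transfer; module Scaling)
  open import Defs hiding (length)
  open import Data.Fin.Subset using (∣_∣)
  open import Data.Integer.Base using (ℤ; +_; 0ℤ)
  open import Data.List.Base using (List; []; _∷_; concatMap)
  open import Data.Nat.Base hiding (_/_)
  import Data.Rational.Base as ℚ
  open import Data.Vec.Base using (Vec; toList; lookup)

  -- Abstract because their normal forms are huge.

  abstract
    program : Program
    program = preamble ⨾ compileAll statements

    totalTime : ℕ → ℕ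
    totalTime s = preambleTime (1 + s + s * s) + timeStmts statements (1 + s + s * s)

    poly-totalTime : PolyBounded totalTime
    poly-totalTime = poly-+ (poly-∘ poly-preambleTime square) (poly-∘ (poly-timeStmts statements) square)
      where
      square : PolyBounded (λ s → 1 + s + s * s)
      square = poly-+ (poly-+ (poly-const 1) poly-id) (poly-* poly-id poly-id)

    program-correct : ∀ {n m} (ps : Vec Point n) → m < n →
      ∃[ ℓ ] magnitudes (pairs ps) (n + n) < 2 ^ ℓ ×
        program maps + n ∷ + suc m ∷ flatten (pairs ps)
                to outputs (parameters n (suc m) ℓ) (inputArrays (pairs ps) (n + n)) statements
                within totalTime (size (flatten (pairs ps)))
    program-correct {n} {m} ps m<n =
      continue (PreambleCorrect.preamble-correct (pairs ps) n (suc m) (length-pairs ps) (s≤s z≤n) m<n)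
      where
      input : List ℤ
      input = + n ∷ + suc m ∷ flatten (pairs ps)
      σ : Arrays
      σ = inputArrays (pairs ps) (n + n)
      s M : ℕ
      s = size (flatten (pairs ps))
      M = 1 + s + s * s
      finish : ∀ {mem i out} →
        Runs preamble ⟨ (λ _ → 0ℤ) , input , [] ⟩ ⟨ mem , i , [] ⟩ (preambleTime M) →
        (∃[ mem′ ] Runs (compileAll statements) ⟨ mem , i , [] ⟩ ⟨ mem′ , i , out ⟩ (timeStmts statements M)) →
        program maps input to out within totalTime s
      finish p (mem′ , q) = mem′ , _ , p ⨾ᴿ q
      continue : (∃[ ℓ ] ∃[ mem ] ∃[ i ]
          Runs preamble ⟨ (λ _ → 0ℤ) , input , [] ⟩ ⟨ mem , i , [] ⟩ (preambleTime M)
          × Represents (parameters n (suc m) ℓ) σ mem × magnitudes (pairs ps) (n + n) < 2 ^ ℓ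
          × (∀ p → lookup (parameters n (suc m) ℓ) p ≤ M)) →
        ∃[ ℓ ] magnitudes (pairs ps) (n + n) < 2 ^ ℓ ×
          program maps input to outputs (parameters n (suc m) ℓ) σ statements within totalTime s
      continue (ℓ , mem , i , p , r , small , bounded) =
        ℓ , small , finish p (Simulation.simulateAll (parameters n (suc m) ℓ) M bounded statements r)

    -- The constant is (29 + 4 · 100) · 2 = 858: 29 + 100 p bounds the sorted path in terms of the
    -- walk, and the factor 2 comes from doubling the tree.
    ratio : ∃[ c ] ∀ k → ∃[ p ] suc k ≤ 2 ^ p × ((29 + 100 * p) * 2) ^ 4 ≤ c ^ 4 * suc k
    ratio = Factor.ratio 29 100 , Factor.factor 29 100

  Approximates : (I : Instance) → Graph (Instance.n I) → Set
  Approximates I T = let open Instance I in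
    IsTree T × k ≤ ∣ vertices T ∣ ×
    (∀ T* → IsMinimumTree k points T* →
      Defs.length points T ^ℚ 4 ℚ.≤ (+ proj₁ ratio ℚ./ 1) ^ℚ 4 ℚ.* (+ k ℚ./ 1) ℚ.* Defs.length points T* ^ℚ 4)

  maps-weaken : ∀ {P i o i′ o′ b b′} → i ≡ i′ → o ≡ o′ → b ≤ b′ → P maps i to o within b → P maps i′ to o′ within b′
  maps-weaken refl refl b≤b′ (m , i , t , p , t≤b) = m , i , t , p , ≤-trans t≤b b≤b′

  solve : ∀ I → Σ[ T ∈ Graph (Instance.n I) ] Approximates I T ×
    program maps encodeInstance I to encodeGraph T
      within (proj₁ poly-totalTime * size (encodeInstance I) ^ proj₁ (proj₂ poly-totalTime))
  solve record { n = n ; k = suc m ; 1≤k = 1≤k ; k≤n = k≤n ; points = ps } = construct (program-correct ps k≤n)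
    where
    s input-size : ℕ
    s = size (flatten (pairs ps))
    input-size = size (+ n ∷ + suc m ∷ concatMap encodePoint (toList ps))

    -- Polynomial bounds are stated in powers of `suc s`, where s counts only the coordinates; the
    -- leading numbers n and k of the input supply the missing 1.
    1+s≤ : suc s ≤ input-size
    1+s≤ = subst (λ xs → suc s ≤ size (+ n ∷ + suc m ∷ xs)) (flatten-pairs ps)
      (s≤s (≤-trans (m≤n+m s (bits (+ suc m))) (m≤n+m _ _)))

    I : Instance
    I = record { n = n ; k = suc m ; 1≤k = 1≤k ; k≤n = k≤n ; points = ps }

    construct : (∃[ ℓ ] magnitudes (pairs ps) (n + n) < 2 ^ ℓ ×
        program maps + n ∷ + suc m ∷ flatten (pairs ps)
                to outputs (parameters n (suc m) ℓ) (inputArrays (pairs ps) (n + n)) statements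
                within totalTime s) →
      Σ[ T ∈ Graph n ] Approximates I T ×
        program maps encodeInstance I to encodeGraph T within (proj₁ poly-totalTime * input-size ^ proj₁ (proj₂ poly-totalTime))
    construct (ℓ , input< , runs) = C.tree , (C.Tree.isTree , C.Tree.suc-m≤∣vertices∣ , approximates) ,
      maps-weaken (cong (λ xs → + n ∷ + suc m ∷ xs) (flatten-pairs ps)) C.outputs≡encodeGraph
        (≤-trans (proj₂ (proj₂ poly-totalTime) s)
          (*-monoʳ-≤ (proj₁ poly-totalTime) (^-monoˡ-≤ (proj₁ (proj₂ poly-totalTime)) 1+s≤))) runs
      where
      module C = Construction k≤n ps {ℓ} input<

      approximates : ∀ T* → IsMinimumTree (suc m) ps T* →
        Defs.length ps C.tree ^ℚ 4 ℚ.≤ (+ proj₁ ratio ℚ./ 1) ^ℚ 4 ℚ.* (+ suc m ℚ./ 1) ℚ.* Defs.length ps T* ^ℚ 4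
      approximates T* T*-min = transfer {w = C.weight (edges C.tree)} {w* = C.weight (edges T*)} {f = (29 + 100 * proj₁ (proj₂ ratio m)) * 2} {c = proj₁ ratio}
        (Scaling.full-positive (coordinate ps) (n + n))
        (C.ι-weight (edges C.tree)) (C.ι-weight (edges T*))
        (C.weight-tree T* (proj₁ (proj₂ ratio m)) (IsTree.connected T*-tree) (IsTree.nonempty T*-tree)
          (IsMinimumTree.spans T*-min) (proj₁ (proj₂ (proj₂ ratio m))))
        (proj₂ (proj₂ (proj₂ ratio m)))
        where
        T*-tree : IsTree T*
        T*-tree = IsMinimumTree.isTree T*-min

open import Defs
open import Data.Fin.Subset using (∣_∣)
open import Data.Integer.Base using (+_)
open import Data.Nat.Base as ℕ using (ℕ)
open import Data.Product.Base using (_×_; Σ-syntax)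
open import Data.Rational.Base using (_/_; _*_; _≤_)

corollary1p4 : Σ[ c ∈ ℕ ] PolynomialTimeSolvable
    {I = Instance} {O = λ I → Graph (Instance.n I)}
    encodeInstance (λ _ → encodeGraph)
    (λ I T → let open Instance I in
    IsTree T × k ℕ.≤ ∣ vertices T ∣ ×
    (∀ T* → IsMinimumTree k points T* →
    length points T ^ℚ 4 ≤ (+ c / 1) ^ℚ 4 * (+ k / 1) * length points T* ^ℚ 4))
corollary1p4 =
  proj₁ ratio , program , proj₁ poly-totalTime , proj₁ (proj₂ poly-totalTime) , solve
  where open Solution
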